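{- Let $a_i=i-\tfrac12$ ($i\in\mathbb Z$) and $FS_\mu:=s_{\mu;a}$. For every Young diagram $(p_1,\dots,p_d\mid q_1,\dots,q_d)$ in Frobenius notation, $$FS_{(p_1,\dots,p_d\mid q_1,\dots,q_d)}=\sum_{\substack{p'_1\le p_1,\dots,p'_d\le p_d\\ q'_1\le q_1,\dots,q'_d\le q_d}}\det[c_{p_i,p'_j}]_{i,j=1}^d\,\det[c_{q_i,q'_j}]_{i,j=1}^d\,s_{(p'_1,\dots,p'_d\mid q'_1,\dots,q'_d)},$$ where $c_{pp'}=(-1)^{p-p'}e_{p-p'}(\tfrac12,\tfrac32,\dots,\tfrac{2p-1}2)$ for $p\ge p'$ (with $p$ arguments), $c_{pp'}=0$ for $p'>p$, and the sum is over tuples of nonnegative integers $p'_1>\dots>p'_d\ge0$, $q'_1>\dots>q'_d\ge0$ (so that the indices are Young diagrams in Frobenius notation).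
   Context: $\Lambda$ is the algebra of symmetric functions over $\mathbb C$ with complete homogeneous $h_k$, elementary $e_k$ and Schur functions $s_\mu$. For a sequence $a=(a_i)_{i\in\mathbb Z}$ define $h_{k;a}=\sum_{i=1}^k(-1)^{k-i}e_{k-i}(a_1,\dots,a_{k-1})h_i$ for $k\ge1$, $h_{0;a}=1$, $h_{k;a}=0$ for $k<0$; let $(\tau^ra)_i=a_{i+r}$; and set $s_{\mu;a}=\det[h_{\mu_i-i+j;\,\tau^{1-j}a}]_{i,j=1}^N$ for any $N\ge\ell(\mu)$. Frobenius notation: a diagram $\mu$ with $d$ diagonal boxes is $(p_1,\dots,p_d\mid q_1,\dots,q_d)$ with $p_i=\mu_i-i$, $q_i=\mu'_i-i$, $\mu'$ the transposed diagram. -}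

module Defs where

open import Algebra.Bundles using (CommutativeRing)
open import Data.Bool.Base using (if_then_else_)
open import Data.Fin.Base as Fin using (Fin; zero; suc; toℕ; fromℕ; inject₁; punchIn)
import Data.Fin.Properties as Fin
open import Data.Integer.Base as ℤ using (ℤ; +_; -[1+_])
open import Data.List.Base as List
  using (List; []; _∷_; _++_; _∷ʳ_; foldr; length; filter; mapMaybe; replicate; upTo; cartesianProductWith)
open import Data.List.Relation.Binary.Permutation.Propositional as ↭ using (_↭_; ↭-refl)
open import Data.List.Relation.Unary.All using (All; []; _∷_)
open import Data.List.Relation.Unary.Linked using (Linked; []; [-]; _∷_)
import Data.Integer.Properties as ℤ
import Data.List.Properties as List
open import Data.Maybe.Base as Maybe using (Maybe)
open import Data.Nat.Base as ℕ using (ℕ; zero; suc; _∸_; _≤_; _<_; _≥_; _>_; z≤n; s≤s; z<s)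
open import Data.Nat.ListAction using () renaming (sum to degree)
open import Data.Nat.ListAction.Properties using (sum-↭; sum-++)
import Data.Nat.Properties as ℕ
open import Data.Product.Base using (Σ-syntax; ∃-syntax; _×_; _,_; proj₁; proj₂)
open import Data.Sum.Base using (_⊎_; inj₁; inj₂; [_,_]′)
open import Data.Vec.Base as Vec using (Vec; []; _∷_; lookup; tabulate)
open import Data.Vec.Relation.Unary.Linked as VLinked using ([]; [-]; _∷_)
open import Function.Base using (_∘_; id)
open import Function.Bundles using (_⇔_; mk⇔; Equivalence)
open import Level using (_⊔_)
open import Relation.Binary.PropositionalEquality as ≡ using (_≡_)
open import Relation.Nullary.Decidable.Core using (Dec; does; yes; no; dec⇒maybe)
open import Relation.Nullary.Negation.Core using (¬_; contradiction)
open import Relation.Unary using (Pred; Decidable)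

------------------------------------------------------------------------
-- Young diagrams

record YoungDiagram : Set where
  constructor youngDiagram
  field
    rows       : List ℕ
    decreasing : Linked _≥_ rows
    positive   : All (0 <_) rows

open YoungDiagram public

rowOf : List ℕ → ℕ → ℕ
rowOf []       _       = 0
rowOf (r ∷ _)  zero    = r
rowOf (_ ∷ rs) (suc i) = rowOf rs i

columnOf : List ℕ → ℕ → ℕ
columnOf rs j = length (filter (j ℕ.<?_) rs)

-- Rows and columns are numbered from 0: row μ i is μ_{i+1} and
-- column μ j is μ′_{j+1}, where μ′ is the transposed diagram.
row column : YoungDiagram → ℕ → ℕ
row    μ = rowOf (rows μ)
column μ = columnOf (rows μ)

ℓ[_] : YoungDiagram → ℕ
ℓ[ μ ] = length (rows μ)

diagonal : YoungDiagram → ℕ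
diagonal μ = length (filter (λ i → i ℕ.<? row μ i) (upTo ℓ[ μ ]))

-- The Frobenius coordinates p_i = μ_i - i and q_i = μ′_i - i.
arms legs : (μ : YoungDiagram) → Vec ℕ (diagonal μ)
arms μ = tabulate λ i → row    μ (toℕ i) ∸ suc (toℕ i)
legs μ = tabulate λ i → column μ (toℕ i) ∸ suc (toℕ i)

StrictlyDecreasing : ∀ {d} → Vec ℕ d → Set
StrictlyDecreasing = VLinked.Linked _>_

-- The diagram with given Frobenius coordinates, built from nested hooks:
-- the outermost hook has p boxes to the right of the corner and q below it,
-- and encloses the diagram of the remaining coordinates.
border : ℕ → ℕ → List ℕ → List ℕ
border p q rs = suc p ∷ (List.map suc rs ++ replicate (q ∸ length rs) 1)

hooks : ∀ {d} → Vec ℕ d → Vec ℕ d → List ℕ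
hooks []       []       = []
hooks (p ∷ ps) (q ∷ qs) = border p q (hooks ps qs)

private
  replicate-decreasing : ∀ n → Linked _≥_ (replicate n 1)
  replicate-decreasing 0             = []
  replicate-decreasing 1             = [-]
  replicate-decreasing (suc (suc n)) = ℕ.≤-refl ∷ replicate-decreasing (suc n)

  padded-decreasing : ∀ {rs} n → Linked _≥_ rs →
                      Linked _≥_ (List.map suc rs ++ replicate n 1)
  padded-decreasing n       []           = replicate-decreasing n
  padded-decreasing zero    [-]          = [-]
  padded-decreasing (suc n) [-]          = s≤s z≤n ∷ replicate-decreasing (suc n)
  padded-decreasing n       (r≥s ∷ rest) = s≤s r≥s ∷ padded-decreasing n rest

  ∷-decreasing : ∀ {r rs} → rowOf rs 0 ≤ r → Linked _≥_ rs → Linked _≥_ (r ∷ rs)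
  ∷-decreasing {rs = []}    _ _  = [-]
  ∷-decreasing {rs = _ ∷ _} h dc = h ∷ dc

  padded-row₀ : ∀ {p} rs n → rowOf rs 0 ≤ p →
                rowOf (List.map suc rs ++ replicate n 1) 0 ≤ suc p
  padded-row₀ []      zero    _ = z≤n
  padded-row₀ []      (suc n) _ = s≤s z≤n
  padded-row₀ (_ ∷ _) n       h = s≤s h

  hooks-row₀ : ∀ {d p} {ps : Vec ℕ d} (qs : Vec ℕ d) → StrictlyDecreasing (p ∷ ps) →
               rowOf (hooks ps qs) 0 ≤ p
  hooks-row₀ {ps = []}    []      _         = z≤n
  hooks-row₀ {ps = _ ∷ _} (_ ∷ _) (p>p′ ∷ _) = p>p′

  hooks-decreasing : ∀ {d} {p : Vec ℕ d} (q : Vec ℕ d) → StrictlyDecreasing p →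
                     Linked _≥_ (hooks p q)
  hooks-decreasing {p = []}     []       _  = []
  hooks-decreasing {p = p ∷ ps} (q ∷ qs) dp =
    ∷-decreasing (padded-row₀ (hooks ps qs) _ (hooks-row₀ qs dp))
                 (padded-decreasing _ (hooks-decreasing qs (VLinked.tail dp)))

  padded-positive : ∀ rs n → All (0 <_) (List.map suc rs ++ replicate n 1)
  padded-positive []       zero    = []
  padded-positive []       (suc n) = z<s ∷ padded-positive [] n
  padded-positive (_ ∷ rs) n       = z<s ∷ padded-positive rs n

  hooks-positive : ∀ {d} (p q : Vec ℕ d) → All (0 <_) (hooks p q)
  hooks-positive []      []      = []
  hooks-positive (_ ∷ p) (_ ∷ q) = z<s ∷ padded-positive (hooks p q) _

Strict : ℕ → Set
Strict d = Σ[ p ∈ Vec ℕ d ] StrictlyDecreasing p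

⟨_∣_⟩ : ∀ {d} → Strict d → Strict d → YoungDiagram
⟨ p , dp ∣ q , _ ⟩ = youngDiagram (hooks p q) (hooks-decreasing q dp) (hooks-positive p q)

private
  padded-length : ∀ {q} rs → length rs ≤ q →
                  length (List.map suc rs ++ replicate (q ∸ length rs) 1) ≡ q
  padded-length []       z≤n     = List.length-replicate _
  padded-length (_ ∷ rs) (s≤s h) = ≡.cong suc (padded-length rs h)

  hooks-length≤ : ∀ {d q} (ps : Vec ℕ d) {qs : Vec ℕ d} → StrictlyDecreasing (q ∷ qs) →
                  length (hooks ps qs) ≤ q
  hooks-length≤ []       {[]}    [-]        = z≤n
  hooks-length≤ (p ∷ ps) {_ ∷ qs} (q>q′ ∷ dq) =
    ℕ.≤-trans (ℕ.≤-reflexive (≡.cong suc (padded-length (hooks ps qs) (hooks-length≤ ps dq)))) q>q′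

  padded-row : ∀ rs n i {k} → k < rowOf rs i →
               rowOf (List.map suc rs ++ replicate n 1) i ≡ suc (rowOf rs i)
  padded-row (_ ∷ _)  n zero    _ = ≡.refl
  padded-row (_ ∷ rs) n (suc i) h = padded-row rs n i h

  padded-row⁻ : ∀ rs n i k → suc k < rowOf (List.map suc rs ++ replicate n 1) i → k < rowOf rs i
  padded-row⁻ []       (suc n) zero    k (s≤s ())
  padded-row⁻ []       (suc n) (suc i) k h       = padded-row⁻ [] n i k h
  padded-row⁻ (_ ∷ _)  n       zero    k (s≤s h) = h
  padded-row⁻ (_ ∷ rs) n       (suc i) k h       = padded-row⁻ rs n i k h

  hooks-diagonal : ∀ {d} (p q : Vec ℕ d) i → i < rowOf (hooks p q) i ⇔ i < d
  hooks-diagonal []      []      i       = mk⇔ (λ ()) (λ ())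
  hooks-diagonal (_ ∷ p) (_ ∷ q) zero    = mk⇔ (λ _ → z<s) (λ _ → z<s)
  hooks-diagonal (_ ∷ p) (_ ∷ q) (suc i) = mk⇔
    (λ h → s≤s (E.to (padded-row⁻ (hooks p q) _ i i h)))
    (λ { (s≤s h) → ≡.subst (suc i <_) (≡.sym (padded-row (hooks p q) _ i (E.from h))) (s≤s (E.from h)) })
    where module E = Equivalence (hooks-diagonal p q i)

  row<⇒<length : ∀ rs i {k} → k < rowOf rs i → i < length rs
  row<⇒<length (_ ∷ _)  zero    _ = z<s
  row<⇒<length (_ ∷ rs) (suc i) h = s≤s (row<⇒<length rs i h)

  count-below : ∀ {ℓ} {P : Pred ℕ ℓ} (P? : Decidable P) (f : ℕ → ℕ) d n →
                (∀ i → P (f i) ⇔ i < d) → d ≤ n →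
                length (filter P? (List.applyUpTo f n)) ≡ d
  count-below P? f zero    zero    _ _ = ≡.refl
  count-below P? f zero    (suc n) h _ =
    ≡.trans (≡.cong length (List.filter-reject P? λ pf → contradiction (Equivalence.to (h 0) pf) λ ()))
            (count-below P? (f ∘ suc) zero n
               (λ i → mk⇔ (λ pf → contradiction (Equivalence.to (h (suc i)) pf) λ ()) λ ()) z≤n)
  count-below P? f (suc d) (suc n) h (s≤s d≤n) =
    ≡.trans (≡.cong length (List.filter-accept P? (Equivalence.from (h 0) z<s)))
            (≡.cong suc (count-below P? (f ∘ suc) d n
               (λ i → mk⇔ (λ pf → ℕ.s<s⁻¹ (Equivalence.to (h (suc i)) pf))
                          (λ i<d → Equivalence.from (h (suc i)) (s≤s i<d)))
               d≤n))

  hooks-row : ∀ {d} (p q : Vec ℕ d) i →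
              rowOf (hooks p q) (toℕ i) ≡ suc (toℕ i) ℕ.+ lookup p i
  hooks-row (_ ∷ p) (_ ∷ q) zero    = ≡.refl
  hooks-row (_ ∷ p) (_ ∷ q) (suc i) =
    ≡.trans (padded-row (hooks p q) _ (toℕ i)
               (≡.subst (toℕ i <_) (≡.sym (hooks-row p q i)) (ℕ.m≤m+n _ _)))
            (≡.cong suc (hooks-row p q i))

  padded-column₀ : ∀ rs n → columnOf (List.map suc rs ++ replicate n 1) 0
                            ≡ length (List.map suc rs ++ replicate n 1)
  padded-column₀ []       zero    = ≡.refl
  padded-column₀ []       (suc n) = ≡.cong suc (padded-column₀ [] n)
  padded-column₀ (_ ∷ rs) n       = ≡.cong suc (padded-column₀ rs n)

  columnOf-accept : ∀ j {r} rs → j < r → columnOf (r ∷ rs) j ≡ suc (columnOf rs j)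
  columnOf-accept j rs j<r = ≡.cong length (List.filter-accept (j ℕ.<?_) {xs = rs} j<r)

  columnOf-reject : ∀ j {r} rs → r ≤ j → columnOf (r ∷ rs) j ≡ columnOf rs j
  columnOf-reject j rs r≤j = ≡.cong length (List.filter-reject (j ℕ.<?_) {xs = rs} (ℕ.≤⇒≯ r≤j))

  padded-column : ∀ rs n j → columnOf (List.map suc rs ++ replicate n 1) (suc j) ≡ columnOf rs j
  padded-column []       zero    j = ≡.refl
  padded-column []       (suc n) j = ≡.trans (columnOf-reject (suc j) (replicate n 1) (s≤s z≤n)) (padded-column [] n j)
  padded-column (r ∷ rs) n       j with j ℕ.<? r
  ... | yes j<r = ≡.trans (columnOf-accept (suc j) _ (s≤s j<r))
                 (≡.trans (≡.cong suc (padded-column rs n j)) (≡.sym (columnOf-accept j rs j<r)))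
  ... | no  j≮r = ≡.trans (columnOf-reject (suc j) _ (s≤s (ℕ.≮⇒≥ j≮r)))
                 (≡.trans (padded-column rs n j) (≡.sym (columnOf-reject j rs (ℕ.≮⇒≥ j≮r))))

  strict-≥ : ∀ {d p} {ps : Vec ℕ d} → StrictlyDecreasing (p ∷ ps) → (i : Fin d) → toℕ i < p
  strict-≥ {ps = _ ∷ _} (p>p′ ∷ _)  zero    = ℕ.≤-<-trans z≤n p>p′
  strict-≥ {ps = _ ∷ _} (p>p′ ∷ dp) (suc i) = ℕ.≤-<-trans (strict-≥ dp i) p>p′

  hooks-column : ∀ {d} {p q : Vec ℕ d} → StrictlyDecreasing p → StrictlyDecreasing q → ∀ i →
                 columnOf (hooks p q) (toℕ i) ≡ suc (toℕ i) ℕ.+ lookup q i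
  hooks-column {p = _ ∷ p} {_ ∷ q} dp dq zero =
    ≡.cong suc (≡.trans (padded-column₀ (hooks p q) _) (padded-length (hooks p q) (hooks-length≤ p dq)))
  hooks-column {p = _ ∷ p} {_ ∷ q} dp dq (suc i) =
    ≡.trans (columnOf-accept (suc (toℕ i)) _ (s≤s (strict-≥ dp i)))
            (≡.cong suc (≡.trans (padded-column (hooks p q) _ (toℕ i))
                                 (hooks-column (VLinked.tail dp) (VLinked.tail dq) i)))

-- ⟨ p ∣ q ⟩ is indeed the diagram whose Frobenius coordinates are p and q.
module _ {d} (p q : Strict d) where

  ⟨∣⟩-diagonal : diagonal ⟨ p ∣ q ⟩ ≡ d
  ⟨∣⟩-diagonal = count-below _ id d _ (hooks-diagonal (proj₁ p) (proj₁ q)) (d≤length (proj₁ p) (proj₁ q))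
    where
    d≤length : ∀ {d} (p q : Vec ℕ d) → d ≤ length (hooks p q)
    d≤length []      []      = z≤n
    d≤length p@(_ ∷ _) q = row<⇒<length (hooks p q) _ (Equivalence.from (hooks-diagonal p q _) ℕ.≤-refl)

  ⟨∣⟩-row : ∀ i → row ⟨ p ∣ q ⟩ (toℕ i) ∸ suc (toℕ i) ≡ lookup (proj₁ p) i
  ⟨∣⟩-row i = ≡.trans (≡.cong (_∸ suc (toℕ i)) (hooks-row (proj₁ p) (proj₁ q) i)) (ℕ.m+n∸m≡n (suc (toℕ i)) _)

  ⟨∣⟩-column : ∀ i → column ⟨ p ∣ q ⟩ (toℕ i) ∸ suc (toℕ i) ≡ lookup (proj₁ q) i
  ⟨∣⟩-column i = ≡.trans (≡.cong (_∸ suc (toℕ i)) (hooks-column (proj₂ p) (proj₂ q) i)) (ℕ.m+n∸m≡n (suc (toℕ i)) _)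

-- All tuples p′₁ > … > p′_d ≥ 0 with p′_i ≤ p_i for every i.
box : ∀ {d} → Vec ℕ d → List (Vec ℕ d)
box []       = [] ∷ []
box (p ∷ ps) = cartesianProductWith _∷_ (upTo (suc p)) (box ps)

strict? : ∀ {d} → Vec ℕ d → Maybe (Strict d)
strict? p = Maybe.map (p ,_) (dec⇒maybe (VLinked.linked? ℕ._>?_ p))

below : ∀ {d} → Vec ℕ d → List (Strict d)
below p = mapMaybe strict? (box p)

------------------------------------------------------------------------
-- Sums and determinants over a commutative ring

module RingOperations {c ℓ} (R : CommutativeRing c ℓ) where

  open CommutativeRing R hiding (zero)
  open import Algebra.Properties.Semiring.Sum semiring public using (sum)
  open import Algebra.Properties.Semiring.Sum semiring using (sum-cong-≋; sum-replicate-zero)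
  open import Algebra.Properties.Semiring.Exp semiring public using (_^_)

  ∑ : ∀ {x} {X : Set x} → List X → (X → Carrier) → Carrier
  ∑ xs f = foldr (λ x s → f x + s) 0# xs

  infix 8 -1^_
  -1^_ : ℕ → Carrier
  -1^ n = (- 1#) ^ n

  Matrix : ℕ → Set c
  Matrix n = Fin n → Fin n → Carrier

  -- Expansion along the first row.
  det : ∀ {n} → Matrix n → Carrier
  det {zero}  M = 1#
  det {suc n} M = sum λ j → -1^ toℕ j * (M zero j * det λ k l → M (suc k) (punchIn j l))

  -- elementary k xs is e_k evaluated at the finitely many arguments xs.
  elementary : ℕ → List Carrier → Carrier
  elementary zero    _        = 1#
  elementary (suc k) []       = 0#
  elementary (suc k) (x ∷ xs) = x * elementary k xs + elementary (suc k) xs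

  sum-zero : ∀ {n} (f : Fin n → Carrier) → (∀ i → f i ≈ 0#) → sum f ≈ 0#
  sum-zero {n} f f≈0 = trans (sum-cong-≋ f≈0) (sum-replicate-zero n)

  det-cong : ∀ {n} {M M′ : Matrix n} → (∀ i j → M i j ≈ M′ i j) → det M ≈ det M′
  det-cong {zero}  eq = refl
  det-cong {suc n} eq = sum-cong-≋ {suc n} λ j →
    *-congˡ { -1^ toℕ j} (*-cong (eq zero j) (det-cong λ k l → eq (suc k) (punchIn j l)))

  private
    det-zero-row : ∀ {n} (M : Matrix (suc n)) → (∀ j → M (fromℕ n) j ≈ 0#) → det M ≈ 0#
    det-zero-row {zero} M z = trans (+-identityʳ _) (trans (*-identityˡ _)
      (trans (*-identityʳ _) (z zero)))
    det-zero-row {suc n} M z = sum-zero {suc (suc n)} _ λ j →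
      trans (*-congˡ { -1^ toℕ j} (trans
        (*-congˡ {M zero j} (det-zero-row (λ k l → M (suc k) (punchIn j l)) λ l → z (punchIn j l)))
        (zeroʳ _))) (zeroʳ _)

    punchIn-inject₁ : ∀ {n} (j : Fin (suc n)) (k : Fin n) →
                      punchIn (inject₁ j) (inject₁ k) ≡ inject₁ (punchIn j k)
    punchIn-inject₁ zero    k       = ≡.refl
    punchIn-inject₁ (suc j) zero    = ≡.refl
    punchIn-inject₁ (suc j) (suc k) = ≡.cong suc (punchIn-inject₁ j k)

    punchIn-fromℕ : ∀ {n} (j : Fin (suc n)) → punchIn (inject₁ j) (fromℕ n) ≡ fromℕ (suc n)
    punchIn-fromℕ         zero    = ≡.refl
    punchIn-fromℕ {suc n} (suc j) = ≡.cong suc (punchIn-fromℕ j)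

    punchIn-last : ∀ {n} (k : Fin n) → punchIn (fromℕ n) k ≡ inject₁ k
    punchIn-last {suc n} zero    = ≡.refl
    punchIn-last {suc n} (suc k) = ≡.cong suc (punchIn-last k)

    sum-last : ∀ {n} (f : Fin (suc n) → Carrier) → sum f ≈ sum (f ∘ inject₁) + f (fromℕ n)
    sum-last {zero}  f = +-comm _ _
    sum-last {suc n} f = trans (+-congˡ (sum-last (f ∘ suc))) (sym (+-assoc _ _ _))

  det-unit-last-row : ∀ {n} (M : Matrix (suc n)) →
    (∀ j → M (fromℕ n) (inject₁ j) ≈ 0#) → M (fromℕ n) (fromℕ n) ≈ 1# →
    det M ≈ det (λ i j → M (inject₁ i) (inject₁ j))
  det-unit-last-row {zero} M z u =
    trans (+-identityʳ _) (trans (*-identityˡ _) (trans (*-identityʳ _) u))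
  det-unit-last-row {suc n} M z u =
    trans (sum-last {suc n} t) (trans (+-cong (sum-cong-≋ init-term) last-term) (+-identityʳ _))
    where
    minor : Fin (suc (suc n)) → Matrix (suc n)
    minor j k l = M (suc k) (punchIn j l)

    t : Fin (suc (suc n)) → Carrier
    t j = -1^ toℕ j * (M zero j * det (minor j))

    last-term : t (fromℕ (suc n)) ≈ 0#
    last-term = trans (*-congˡ (trans (*-congˡ (det-zero-row (minor (fromℕ (suc n)))
      λ l → trans (reflexive (≡.cong (M (fromℕ (suc n))) (punchIn-last l))) (z l))) (zeroʳ _))) (zeroʳ _)

    init-term : ∀ j → t (inject₁ j) ≈
      -1^ toℕ j * (M zero (inject₁ j) * det λ k l → M (suc (inject₁ k)) (inject₁ (punchIn j l)))
    init-term j = *-cong (reflexive (≡.cong -1^_ (Fin.toℕ-inject₁ j))) (*-congˡ (trans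
      (det-unit-last-row (minor (inject₁ j))
        (λ l → trans (reflexive (≡.cong (M (fromℕ (suc n))) (punchIn-inject₁ j l))) (z (punchIn j l)))
        (trans (reflexive (≡.cong (M (fromℕ (suc n))) (punchIn-fromℕ j))) u))
      (det-cong λ k l → reflexive (≡.cong (M (suc (inject₁ k))) (punchIn-inject₁ j l)))))

------------------------------------------------------------------------
-- The algebra Λ of symmetric functions with coefficients in K

module SymmetricFunctions {c ℓ} (K : CommutativeRing c ℓ) where

  open CommutativeRing K hiding (zero)
  open import Relation.Binary.Reasoning.Setoid setoid

  -- convolution F n = Σ_{i + j = n} F i j
  convolution : (ℕ → ℕ → Carrier) → ℕ → Carrier
  convolution F zero    = F 0 0
  convolution F (suc n) = F 0 (suc n) + convolution (λ i j → F (suc i) j) n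

  -- A formal power series in x₁, x₂, … is given by its coefficients; the list
  -- m₁ ∷ … ∷ mₙ ∷ [] stands for the monomial x₁^m₁ ⋯ xₙ^mₙ.
  Coefficients : Set c
  Coefficients = List ℕ → Carrier

  product : Coefficients → Coefficients → Coefficients
  product f g []      = f [] * g []
  product f g (m ∷ v) = convolution (λ i j → product (λ w → f (i ∷ w)) (λ w → g (j ∷ w)) v) m

  record SymmetricFunction : Set (c ⊔ ℓ) where
    no-eta-equality
    field
      coeff     : Coefficients
      -- trailing zero exponents do not change the monomial
      stable    : ∀ v → coeff (v ∷ʳ 0) ≈ coeff v
      symmetric : ∀ {v w} → v ↭ w → coeff v ≈ coeff w
      bounded   : ∃[ d ] (∀ v → d < degree v → coeff v ≈ 0#)

  open SymmetricFunction public

  private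
    +-zero : ∀ {x y} → x ≈ 0# → y ≈ 0# → x + y ≈ 0#
    +-zero p q = trans (+-cong p q) (+-identityˡ _)

    interchange : ∀ a b x y → (a + b) + (x + y) ≈ (a + x) + (b + y)
    interchange a b x y = begin
      (a + b) + (x + y)  ≈⟨ +-assoc a b _ ⟩
      a + (b + (x + y))  ≈⟨ +-congˡ (+-assoc b x y) ⟨
      a + ((b + x) + y)  ≈⟨ +-congˡ (+-congʳ (+-comm b x)) ⟩
      a + ((x + b) + y)  ≈⟨ +-congˡ (+-assoc x b y) ⟩
      a + (x + (b + y))  ≈⟨ +-assoc a x _ ⟨
      (a + x) + (b + y)  ∎

    conv = convolution

    conv-cong : ∀ {F G} → (∀ i j → F i j ≈ G i j) → ∀ n → conv F n ≈ conv G n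
    conv-cong eq zero    = eq 0 0
    conv-cong eq (suc n) = +-cong (eq 0 (suc n)) (conv-cong (λ i → eq (suc i)) n)

    conv-zero : ∀ {F} n → (∀ i j → i ℕ.+ j ≡ n → F i j ≈ 0#) → conv F n ≈ 0#
    conv-zero zero    z = z 0 0 ≡.refl
    conv-zero (suc n) z = +-zero (z 0 (suc n) ≡.refl) (conv-zero n λ i j e → z (suc i) j (≡.cong suc e))

    conv-+ : ∀ F G n → conv (λ i j → F i j + G i j) n ≈ conv F n + conv G n
    conv-+ F G zero    = refl
    conv-+ F G (suc n) = trans (+-congˡ (conv-+ _ _ n)) (interchange _ _ _ _)

    conv-snoc : ∀ F n → conv F (suc n) ≈ conv (λ i j → F i (suc j)) n + F (suc n) 0
    conv-snoc F zero    = refl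
    conv-snoc F (suc n) = trans (+-congˡ (conv-snoc (λ i → F (suc i)) n)) (sym (+-assoc _ _ _))

    conv-comm : ∀ F n → conv F n ≈ conv (λ i j → F j i) n
    conv-comm F zero    = refl
    conv-comm F (suc n) = trans (conv-snoc F n) (trans (+-comm _ _) (+-congˡ (conv-comm _ n)))

    conv-assoc : ∀ (G : ℕ → ℕ → ℕ → Carrier) n →
                 conv (λ i k → conv (λ a b → G a b k) i) n ≈ conv (λ a i → conv (λ b k → G a b k) i) n
    conv-assoc G zero    = refl
    conv-assoc G (suc n) = begin
      G 0 0 (suc n) + conv (λ i k → G 0 (suc i) k + conv (λ a b → G (suc a) b k) i) n
        ≈⟨ +-congˡ (conv-+ _ _ n) ⟩
      G 0 0 (suc n) + (conv (λ i k → G 0 (suc i) k) n + conv (λ i k → conv (λ a b → G (suc a) b k) i) n)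
        ≈⟨ +-assoc _ _ _ ⟨
      conv (G 0) (suc n) + conv (λ i k → conv (λ a b → G (suc a) b k) i) n
        ≈⟨ +-congˡ (conv-assoc (λ a → G (suc a)) n) ⟩
      conv (G 0) (suc n) + conv (λ a i → conv (λ b k → G (suc a) b k) i) n ∎

    conv-swap : ∀ (F : ℕ → ℕ → ℕ → ℕ → Carrier) m n →
                conv (λ i j → conv (λ k l → F i j k l) n) m ≈ conv (λ k l → conv (λ i j → F i j k l) m) n
    conv-swap F zero    n = refl
    conv-swap F (suc m) n = trans (+-congˡ (conv-swap (λ i → F (suc i)) m n)) (sym (conv-+ _ _ n))

    product-cong : ∀ {f f′ g g′} → (∀ v → f v ≈ f′ v) → (∀ v → g v ≈ g′ v) →
                   ∀ v → product f g v ≈ product f′ g′ v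
    product-cong p q []      = *-cong (p []) (q [])
    product-cong p q (m ∷ v) = conv-cong (λ i j → product-cong (λ w → p (i ∷ w)) (λ w → q (j ∷ w)) v) m

    product-comm : ∀ f g v → product f g v ≈ product g f v
    product-comm f g []      = *-comm _ _
    product-comm f g (m ∷ v) = trans (conv-cong (λ i j → product-comm _ _ v) m) (conv-comm _ m)

    product-distribʳ : ∀ h f g v → product (λ w → f w + g w) h v ≈ product f h v + product g h v
    product-distribʳ h f g []      = distribʳ _ _ _
    product-distribʳ h f g (m ∷ v) = trans (conv-cong (λ i j → product-distribʳ _ _ _ v) m) (conv-+ _ _ m)

    product-convˡ : ∀ (P : ℕ → ℕ → Coefficients) h n v →
                    product (λ w → conv (λ i j → P i j w) n) h v ≈ conv (λ i j → product (P i j) h v) n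
    product-convˡ P h zero    v = refl
    product-convˡ P h (suc n) v =
      trans (product-distribʳ h _ _ v) (+-congˡ (product-convˡ (λ i → P (suc i)) h n v))

    product-convʳ : ∀ (P : ℕ → ℕ → Coefficients) h n v →
                    product h (λ w → conv (λ i j → P i j w) n) v ≈ conv (λ i j → product h (P i j) v) n
    product-convʳ P h n v = trans (product-comm _ _ v)
      (trans (product-convˡ P h n v) (conv-cong (λ i j → product-comm _ _ v) n))

    product-assoc : ∀ f g h v → product (product f g) h v ≈ product f (product g h) v
    product-assoc f g h []      = *-assoc _ _ _
    product-assoc f g h (m ∷ v) = begin
      conv (λ i k → product (λ w → conv (λ a b → product (f′ a) (g′ b) w) i) (h′ k) v) m
        ≈⟨ conv-cong (λ i k → product-convˡ _ (h′ k) i v) m ⟩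
      conv (λ i k → conv (λ a b → product (product (f′ a) (g′ b)) (h′ k) v) i) m
        ≈⟨ conv-cong (λ i k → conv-cong (λ a b → product-assoc (f′ a) (g′ b) (h′ k) v) i) m ⟩
      conv (λ i k → conv (λ a b → product (f′ a) (product (g′ b) (h′ k)) v) i) m
        ≈⟨ conv-assoc (λ a b k → product (f′ a) (product (g′ b) (h′ k)) v) m ⟩
      conv (λ a i → conv (λ b k → product (f′ a) (product (g′ b) (h′ k)) v) i) m
        ≈⟨ conv-cong (λ a i → product-convʳ _ (f′ a) i v) m ⟨
      conv (λ a i → product (f′ a) (λ w → conv (λ b k → product (g′ b) (h′ k) w) i) v) m ∎
      where
      f′ g′ h′ : ℕ → Coefficients
      f′ i w = f (i ∷ w)
      g′ i w = g (i ∷ w)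
      h′ i w = h (i ∷ w)

    product-zero : ∀ {f g} v → (∀ u w → degree u ℕ.+ degree w ≡ degree v → f u ≈ 0# ⊎ g w ≈ 0#) →
                   product f g v ≈ 0#
    product-zero [] z =
      [ (λ e → trans (*-congʳ e) (zeroˡ _)) , (λ e → trans (*-congˡ e) (zeroʳ _)) ]′ (z [] [] ≡.refl)
    product-zero (m ∷ v) z = conv-zero m λ i j e → product-zero v λ u w e′ → z (i ∷ u) (j ∷ w)
      (≡.trans (ℕ-interchange i (degree u) j (degree w)) (≡.cong₂ ℕ._+_ e e′))
      where
      ℕ-interchange : ∀ a b c d → (a ℕ.+ b) ℕ.+ (c ℕ.+ d) ≡ (a ℕ.+ c) ℕ.+ (b ℕ.+ d)
      ℕ-interchange a b c d = ≡.trans (ℕ.+-assoc a b _) (≡.trans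
        (≡.cong (a ℕ.+_) (≡.trans (≡.sym (ℕ.+-assoc b c d))
          (≡.trans (≡.cong (ℕ._+ d) (ℕ.+-comm b c)) (ℕ.+-assoc c b d))))
        (≡.sym (ℕ.+-assoc a c _)))

    product-stable : ∀ {f g} → (∀ v → f (v ∷ʳ 0) ≈ f v) → (∀ v → g (v ∷ʳ 0) ≈ g v) →
                     ∀ v → product f g (v ∷ʳ 0) ≈ product f g v
    product-stable p q []      = *-cong (p []) (q [])
    product-stable p q (m ∷ v) =
      conv-cong (λ i j → product-stable (λ w → p (i ∷ w)) (λ w → q (j ∷ w)) v) m

    Symmetric : Coefficients → Set ℓ
    Symmetric f = ∀ {v w} → v ↭ w → f v ≈ f w

    product-symmetric : ∀ {f g} → Symmetric f → Symmetric g → Symmetric (product f g)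
    product-symmetric p q ↭.refl         = refl
    product-symmetric p q (↭.prep x σ)   =
      conv-cong (λ i j → product-symmetric (p ∘ ↭.prep i) (q ∘ ↭.prep j) σ) x
    product-symmetric p q (↭.swap {xs} x y σ) = trans (conv-swap _ x y)
      (conv-cong (λ k l → conv-cong (λ i j → trans
        (product-cong (λ w → p (↭.swap i k ↭-refl)) (λ w → q (↭.swap j l ↭-refl)) xs)
        (product-symmetric (p ∘ ↭.prep k ∘ ↭.prep i) (q ∘ ↭.prep l ∘ ↭.prep j) σ)) x) y)
    product-symmetric p q (↭.trans σ τ)  = trans (product-symmetric p q σ) (product-symmetric p q τ)

    bounded-split : ∀ d e s t → d ℕ.+ e < s ℕ.+ t → d < s ⊎ e < t
    bounded-split d e s t h with d ℕ.<? s
    ... | yes d<s = inj₁ d<s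
    ... | no  d≮s = inj₂ (ℕ.+-cancelˡ-< d e t (ℕ.<-≤-trans h (ℕ.+-monoˡ-≤ t (ℕ.≮⇒≥ d≮s))))

    when : ∀ {p} {P : Set p} → Dec P → Carrier
    when P? = if does P? then 1# else 0#

    when-no : ∀ {p} {P : Set p} (P? : Dec P) → ¬ P → when P? ≈ 0#
    when-no (yes p) ¬p = contradiction p ¬p
    when-no (no _)  ¬p = refl

  -- The complete homogeneous symmetric function: the sum of all monomials of degree k.
  h : ℕ → SymmetricFunction
  h k .coeff v = if does (degree v ℕ.≟ k) then 1# else 0#
  h k .stable v = reflexive (≡.cong (λ n → when (n ℕ.≟ k))
    (≡.trans (sum-++ v (0 ∷ [])) (ℕ.+-identityʳ (degree v))))
  h k .symmetric σ = reflexive (≡.cong (λ n → when (n ℕ.≟ k)) (sum-↭ σ))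
  h k .bounded = k , λ v k<v → when-no (degree v ℕ.≟ k) λ e → ℕ.<-irrefl (≡.sym e) k<v

  infix  4 _≈Λ_
  infixl 6 _+Λ_
  infixl 7 _*Λ_
  infixr 7 _•_
  infix  8 -Λ_

  record _≈Λ_ (f g : SymmetricFunction) : Set ℓ where
    constructor pointwise
    field coeff-≈ : ∀ v → coeff f v ≈ coeff g v

  open _≈Λ_ public

  _+Λ_ _*Λ_ : SymmetricFunction → SymmetricFunction → SymmetricFunction
  (f +Λ g) .coeff v     = coeff f v + coeff g v
  (f +Λ g) .stable v    = +-cong (stable f v) (stable g v)
  (f +Λ g) .symmetric σ = +-cong (symmetric f σ) (symmetric g σ)
  (f +Λ g) .bounded     = proj₁ (bounded f) ℕ.+ proj₁ (bounded g) , λ v h → +-zero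
    (proj₂ (bounded f) v (ℕ.≤-<-trans (ℕ.m≤m+n _ _) h))
    (proj₂ (bounded g) v (ℕ.≤-<-trans (ℕ.m≤n+m _ _) h))

  (f *Λ g) .coeff       = product (coeff f) (coeff g)
  (f *Λ g) .stable      = product-stable (stable f) (stable g)
  (f *Λ g) .symmetric   = product-symmetric (symmetric f) (symmetric g)
  (f *Λ g) .bounded     = proj₁ (bounded f) ℕ.+ proj₁ (bounded g) , λ v h → product-zero v λ u w e →
    [ inj₁ ∘ proj₂ (bounded f) u , inj₂ ∘ proj₂ (bounded g) w ]′
      (bounded-split (proj₁ (bounded f)) (proj₁ (bounded g)) (degree u) (degree w)
        (≡.subst (_ <_) (≡.sym e) h))

  _•_ : Carrier → SymmetricFunction → SymmetricFunction
  (x • f) .coeff v     = x * coeff f v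
  (x • f) .stable v    = *-congˡ (stable f v)
  (x • f) .symmetric σ = *-congˡ (symmetric f σ)
  (x • f) .bounded     = proj₁ (bounded f) , λ v h → trans (*-congˡ (proj₂ (bounded f) v h)) (zeroʳ x)

  -Λ_ : SymmetricFunction → SymmetricFunction
  (-Λ f) .coeff v     = - coeff f v
  (-Λ f) .stable v    = -‿cong (stable f v)
  (-Λ f) .symmetric σ = -‿cong (symmetric f σ)
  (-Λ f) .bounded     = proj₁ (bounded f) , λ v h →
    trans (-‿cong (proj₂ (bounded f) v h)) -0#≈0#
    where open import Algebra.Properties.Ring ring using (-0#≈0#)

  0Λ 1Λ : SymmetricFunction
  0Λ .coeff _     = 0#
  0Λ .stable _    = refl
  0Λ .symmetric _ = refl
  0Λ .bounded     = 0 , λ _ _ → refl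
  1Λ = h 0

  private
    product-identityˡ : ∀ f v → product (coeff 1Λ) f v ≈ f v
    product-identityˡ f []          = *-identityˡ _
    product-identityˡ f (zero ∷ v)  = product-identityˡ (λ w → f (0 ∷ w)) v
    product-identityˡ f (suc m ∷ v) = trans
      (+-cong (product-identityˡ (λ w → f (suc m ∷ w)) v)
              (conv-zero m λ i j _ → product-zero v λ _ _ _ → inj₁ refl))
      (+-identityʳ _)

  Λ : CommutativeRing (c ⊔ ℓ) ℓ
  Λ = record
    { Carrier = SymmetricFunction
    ; _≈_ = _≈Λ_
    ; _+_ = _+Λ_
    ; _*_ = _*Λ_
    ; -_  = -Λ_
    ; 0#  = 0Λ
    ; 1#  = 1Λ
    ; isCommutativeRing = record
      { isRing = record
        { +-isAbelianGroup = record
          { isGroup = record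
            { isMonoid = record
              { isSemigroup = record
                { isMagma = record
                  { isEquivalence = record
                    { refl  = pointwise λ _ → refl
                    ; sym   = λ p → pointwise λ v → sym (coeff-≈ p v)
                    ; trans = λ p q → pointwise λ v → trans (coeff-≈ p v) (coeff-≈ q v)
                    }
                  ; ∙-cong = λ p q → pointwise λ v → +-cong (coeff-≈ p v) (coeff-≈ q v)
                  }
                ; assoc = λ _ _ _ → pointwise λ _ → +-assoc _ _ _
                }
              ; identity = (λ _ → pointwise λ _ → +-identityˡ _) , (λ _ → pointwise λ _ → +-identityʳ _)
              }
            ; inverse = (λ _ → pointwise λ _ → -‿inverseˡ _) , (λ _ → pointwise λ _ → -‿inverseʳ _)
            ; ⁻¹-cong = λ p → pointwise λ v → -‿cong (coeff-≈ p v)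
            }
          ; comm = λ _ _ → pointwise λ _ → +-comm _ _
          }
        ; *-cong = λ p q → pointwise (product-cong (coeff-≈ p) (coeff-≈ q))
        ; *-assoc = λ f g k → pointwise (product-assoc (coeff f) (coeff g) (coeff k))
        ; *-identity = (λ f → pointwise (product-identityˡ (coeff f)))
                     , (λ f → pointwise λ v → trans (product-comm _ _ v) (product-identityˡ (coeff f) v))
        ; distrib = (λ f g k → pointwise λ v → trans (product-comm _ _ v)
                       (trans (product-distribʳ (coeff f) (coeff g) (coeff k) v)
                              (+-cong (product-comm _ _ v) (product-comm _ _ v))))
                  , (λ f g k → pointwise (product-distribʳ (coeff f) (coeff g) (coeff k)))
        }
      ; *-comm = λ f g → pointwise (product-comm (coeff f) (coeff g))
      }
    }

------------------------------------------------------------------------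
-- Schur functions and their multiparameter analogues

module SchurFunctions {c ℓ} (K : CommutativeRing c ℓ) where

  open CommutativeRing K using (Carrier; _*_)
  open RingOperations K using (-1^_; elementary)
  open SymmetricFunctions K
  module Λ = RingOperations Λ

  τ : ℤ → (ℤ → Carrier) → (ℤ → Carrier)
  τ r a i = a (i ℤ.+ r)

  -- h_{k;a}; in the positive case k + 1 the summation index is i + 1.
  hₐ : (ℤ → Carrier) → ℤ → SymmetricFunction
  hₐ a (+ zero)  = 1Λ
  hₐ a (+ suc k) = Λ.sum {suc k} λ i →
    (-1^ (k ∸ toℕ i) * elementary (k ∸ toℕ i) (List.map (λ m → a (+ suc m)) (upTo k))) • h (suc (toℕ i))
  hₐ a -[1+ _ ]  = 0Λ

  hℤ : ℤ → SymmetricFunction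
  hℤ (+ k)    = h k
  hℤ -[1+ _ ] = 0Λ

  -- The N × N determinants defining s_{μ;a} and (Jacobi–Trudi) s_μ.
  -- Indices i and j start from 0 here, so the shift 1 - j becomes - j.
  schurDetₐ : (N : ℕ) → YoungDiagram → (ℤ → Carrier) → SymmetricFunction
  schurDetₐ N μ a = Λ.det {N} λ i j →
    hₐ (τ (ℤ.- (+ toℕ j)) a) (+ row μ (toℕ i) ℤ.- + toℕ i ℤ.+ + toℕ j)

  schurDet : (N : ℕ) → YoungDiagram → SymmetricFunction
  schurDet N μ = Λ.det {N} λ i j → hℤ (+ row μ (toℕ i) ℤ.- + toℕ i ℤ.+ + toℕ j)

  sₐ : YoungDiagram → (ℤ → Carrier) → SymmetricFunction
  sₐ μ a = schurDetₐ ℓ[ μ ] μ a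

  s : YoungDiagram → SymmetricFunction
  s μ = schurDet ℓ[ μ ] μ

  private
    module L = CommutativeRing Λ

    rowOf-beyond : ∀ rs {i} → length rs ≤ i → rowOf rs i ≡ 0
    rowOf-beyond []       _       = ≡.refl
    rowOf-beyond (_ ∷ rs) (s≤s h) = rowOf-beyond rs h

    0-n+n : ∀ n → + 0 ℤ.- + n ℤ.+ + n ≡ + 0
    0-n+n n = ≡.trans (≡.cong (ℤ._+ + n) (ℤ.+-identityˡ (ℤ.- + n))) (ℤ.+-inverseˡ (+ n))

    0-n+j : ∀ {n j} → j < n → ∃[ m ] (+ 0 ℤ.- + n ℤ.+ + j ≡ -[1+ m ])
    0-n+j {suc n} {j} (s≤s j≤n) = n ∸ j , ≡.trans (≡.cong (ℤ._+ + j) (ℤ.+-identityˡ -[1+ n ]))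
      (≡.trans (ℤ.⊖-< (s≤s j≤n)) (≡.cong (λ k → ℤ.- + k) (ℕ.+-∸-assoc 1 j≤n)))

    -- Both determinants come from a family H with H₀ = 1 and H_k = 0 for k < 0.
    module _ (H : ℕ → ℤ → SymmetricFunction)
             (H-zero : ∀ j → H j (+ 0) ≡ 1Λ) (H-neg : ∀ j m → H j -[1+ m ] ≡ 0Λ)
             (μ : YoungDiagram) where

      entry : ∀ {N} → Λ.Matrix N
      entry i j = H (toℕ j) (+ row μ (toℕ i) ℤ.- + toℕ i ℤ.+ + toℕ j)

      D : ℕ → SymmetricFunction
      D N = Λ.det {N} entry

      D-step : ∀ {N} → ℓ[ μ ] ≤ N → D (suc N) L.≈ D N
      D-step {N} ℓ≤N = L.trans (Λ.det-unit-last-row {N} (entry {suc N}) below-diag on-diag)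
        (Λ.det-cong {N} λ i j → L.reflexive (≡.cong₂ (λ x y → H y (+ row μ x ℤ.- + x ℤ.+ + y))
                                           (Fin.toℕ-inject₁ i) (Fin.toℕ-inject₁ j)))
        where
        last-row : row μ (toℕ (fromℕ N)) ≡ 0
        last-row = rowOf-beyond (rows μ) (≡.subst (ℓ[ μ ] ≤_) (≡.sym (Fin.toℕ-fromℕ N)) ℓ≤N)

        below-diag : ∀ (j : Fin N) → H (toℕ (inject₁ j))
          (+ row μ (toℕ (fromℕ N)) ℤ.- + toℕ (fromℕ N) ℤ.+ + toℕ (inject₁ j)) L.≈ 0Λ
        below-diag j rewrite last-row | Fin.toℕ-fromℕ N | Fin.toℕ-inject₁ j
          with m , eq ← 0-n+j (Fin.toℕ<n j) = L.reflexive (≡.trans (≡.cong (H (toℕ j)) eq) (H-neg (toℕ j) m))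

        on-diag : H (toℕ (fromℕ N))
          (+ row μ (toℕ (fromℕ N)) ℤ.- + toℕ (fromℕ N) ℤ.+ + toℕ (fromℕ N)) L.≈ 1Λ
        on-diag rewrite last-row | Fin.toℕ-fromℕ N | 0-n+n N = L.reflexive (H-zero N)

      D-stable : ∀ {N} → ℓ[ μ ] ≤ N → D N L.≈ D ℓ[ μ ]
      D-stable ℓ≤N = go (ℕ.≤⇒≤′ ℓ≤N)
        where
        go : ∀ {N} → ℓ[ μ ] ℕ.≤′ N → D N L.≈ D ℓ[ μ ]
        go (ℕ.≤′-reflexive ≡.refl) = L.refl
        go (ℕ.≤′-step h)           = L.trans (D-step (ℕ.≤′⇒≤ h)) (go h)

  schurDetₐ-stable : ∀ {N} μ a → ℓ[ μ ] ≤ N → schurDetₐ N μ a ≈Λ sₐ μ a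
  schurDetₐ-stable μ a = D-stable (λ j → hₐ (τ (ℤ.- (+ j)) a)) (λ _ → ≡.refl) (λ _ _ → ≡.refl) μ

  schurDet-stable : ∀ {N} μ → ℓ[ μ ] ≤ N → schurDet N μ ≈Λ s μ
  schurDet-stable μ = D-stable (λ _ → hℤ) (λ _ → ≡.refl) (λ _ _ → ≡.refl) μ

------------------------------------------------------------------------
-- Frobenius–Schur functions

module FrobeniusSchur {c ℓ} (K : CommutativeRing c ℓ) (½ : CommutativeRing.Carrier K) where

  open CommutativeRing K using (Carrier; _*_; _-_; -_; 0#; 1#; +-rawMonoid)
  open import Algebra.Definitions.RawMonoid +-rawMonoid using () renaming (_×_ to _·_)
  open RingOperations K using (-1^_; elementary)
  open SymmetricFunctions K
  open SchurFunctions K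

  fromℤ : ℤ → Carrier
  fromℤ (+ n)    = n · 1#
  fromℤ -[1+ n ] = - (suc n · 1#)

  a : ℤ → Carrier
  a i = fromℤ i - ½

  FS : YoungDiagram → SymmetricFunction
  FS μ = sₐ μ a

  c[_,_] : ℕ → ℕ → Carrier
  c[ p , p′ ] =
    if does (p′ ℕ.≤? p)
    then -1^ (p ∸ p′) * elementary (p ∸ p′) (List.map (λ i → suc (2 ℕ.* i) · ½) (upTo p))
    else 0#

module Submission where

open import Defs
open import Algebra.Bundles using (CommutativeRing; CommutativeMonoid)
open import Data.Bool.Base using (if_then_else_)
open import Data.Fin.Base as Fin using (Fin; zero; suc; toℕ; fromℕ; inject₁; punchIn)
import Data.Fin.Properties as Fin
open import Data.Integer.Base as ℤ using (ℤ; +_; -[1+_])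
import Data.Integer.Properties as ℤ
open import Data.List.Base as List
  using (List; []; _∷_; _++_; _∷ʳ_; applyUpTo; applyDownFrom; length; replicate; upTo; cartesianProductWith; mapMaybe)
import Data.List.Properties as List
open import Data.List.Relation.Unary.All using (All; []; _∷_)
open import Data.List.Relation.Unary.Linked as LLinked using ([]; [-]; _∷_)
open import Data.Maybe.Base using (Maybe; just; nothing; maybe)
open import Data.Nat.Base as ℕ using (ℕ; zero; suc; _∸_; _≤_; _<_; _≥_; z≤n; s≤s; z<s)
import Data.Nat.Properties as ℕ
open import Data.Product.Base using (Σ-syntax; _,_; proj₁)
open import Data.Sum.Base using (inj₁; inj₂)
open import Data.Vec.Base using (Vec; []; _∷_; lookup; removeAt; tabulate)
import Data.Vec.Properties as Vec
open import Data.Vec.Relation.Unary.Linked as Linked using ([]; [-]; _∷_)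
open import Function.Base using (_∘_; _⟨_⟩_)
open import Relation.Binary.PropositionalEquality as ≡ using (_≡_; _≗_)
open import Relation.Nullary.Decidable using (Dec; does; yes; no; dec-true; dec-false)
open import Relation.Nullary.Negation.Core using (contradiction)

-- Let φ be the linear map with φ(tⁿ) = h_n, and h_n = 0 for n < 0. Then h_{x+j;τ^{-j}a} =
-- φ(t A_x(t) B_j(t)), where B_j = (t - a_0)⋯(t - a_{1-j}), A_{p+1} = (t - a_1)⋯(t - a_p) and, as a series
-- in 1/t, A_{-k} = 1/((t - a_0)⋯(t - a_{-k})). Row i of the determinant of a diagram (p ∣ q) has x = p_i + 1
-- for i < d; in the other rows -x runs through the numbers outside q. The rows with x ≤ 0 form a
-- unitriangular family, so the determinant is ± det X_{p_i,q_j}, where X_{p,k} are the coordinates of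
-- row p + 1 in that family. Expanding A_{p+1} in powers of t and powers of 1/t in the A_{-k} gives
-- X_{p,k} = Σ c_{p,p′} X⁰_{p′,y} γ_{y,k} with X⁰ the coordinates for a = 0; here γ_{y,k} = ± c_{k,y}
-- because a_{-i} = - a_{i+1}. Two applications of the Cauchy–Binet formula finish the proof.

-- The obstacle is the shift `τ`, which changes the parameters from column to column. Under φ it
-- becomes a factor B_j depending on the column alone, so one expansion of the row factor serves all
-- columns at once, and this is what turns it into a factorisation of the matrix. No series is ever
-- formed. The expansions are cut off at the size n of the determinant, which loses nothing because
-- the k-th row of either unitriangular family vanishes in all columns j < k. Cauchy-Binet produces
-- all strictly decreasing tuples below a bound. Those with some p′_i > p_i drop out because their
-- coefficient matrix contains a zero block that is too large.

module Determinants {c ℓ} (R : CommutativeRing c ℓ) where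

  open CommutativeRing R hiding (zero)
  open RingOperations R using (sum; det; Matrix; -1^_; det-cong; det-unit-last-row)
  import Algebra.Properties.Semiring.Sum semiring as S
  open import Algebra.Properties.Ring ring using (-1*x≈-x; -‿involutive)
  open import Relation.Binary.Reasoning.Setoid setoid
  open import Algebra.Properties.CommutativeSemigroup *-commutativeSemigroup public using ()
    renaming (x∙yz≈y∙xz to swap-factors)
  open import Algebra.Solver.CommutativeMonoid *-commutativeMonoid public using (solve; _⊕_; _⊜_)

  -- Opaque copies of sum and det: unification then sees the summand and the matrix.
  opaque
    ∑ : ∀ {n} → (Fin n → Carrier) → Carrier
    ∑ f = sum f

    Det : ∀ {n} → Matrix n → Carrier
    Det M = det M

    ∑-zero : ∀ (f : Fin 0 → Carrier) → ∑ f ≈ 0#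
    ∑-zero f = refl

    ∑-suc : ∀ {n} (f : Fin (suc n) → Carrier) → ∑ f ≈ f zero + ∑ (f ∘ suc)
    ∑-suc f = refl

    ∑-cong : ∀ {n} {f g : Fin n → Carrier} → (∀ i → f i ≈ g i) → ∑ f ≈ ∑ g
    ∑-cong {n} = S.sum-cong-≋ {n}

    ∑-0 : ∀ {n} {f : Fin n → Carrier} → (∀ i → f i ≈ 0#) → ∑ f ≈ 0#
    ∑-0 {n} f≈0 = trans (S.sum-cong-≋ {n} f≈0) (S.sum-replicate-zero n)

    ∑-swap : ∀ {m n} (f : Fin m → Fin n → Carrier) →
             ∑ (λ i → ∑ λ j → f i j) ≈ ∑ (λ j → ∑ λ i → f i j)
    ∑-swap = S.∑-comm

    ∑-+ : ∀ {n} (f g : Fin n → Carrier) → ∑ (λ i → f i + g i) ≈ ∑ f + ∑ g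
    ∑-+ = S.∑-distrib-+

    *-∑ : ∀ {n} x (f : Fin n → Carrier) → x * ∑ f ≈ ∑ λ i → x * f i
    *-∑ = S.*-distribˡ-sum

    ∑≈sum : ∀ {n} (f : Fin n → Carrier) → ∑ f ≈ sum f
    ∑≈sum f = refl

    Det-zero : ∀ (M : Matrix 0) → Det M ≈ 1#
    Det-zero M = refl

    Det-suc : ∀ {n} (M : Matrix (suc n)) →
      Det M ≈ ∑ λ j → -1^ toℕ j * (M zero j * Det λ k l → M (suc k) (punchIn j l))
    Det-suc M = refl

    Det-cong : ∀ {n} {M M′ : Matrix n} → (∀ i j → M i j ≈ M′ i j) → Det M ≈ Det M′
    Det-cong = det-cong

    Det-unit-last-row : ∀ {n} (M : Matrix (suc n)) →
      (∀ j → M (fromℕ n) (inject₁ j) ≈ 0#) → M (fromℕ n) (fromℕ n) ≈ 1# →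
      Det M ≈ Det (λ i j → M (inject₁ i) (inject₁ j))
    Det-unit-last-row = det-unit-last-row

    Det≈det : ∀ {n} (M : Matrix n) → Det M ≈ det M
    Det≈det M = refl

  -- Column expansion, transposition and the alternating property of determinants.

  ε : Carrier
  ε = - 1#

  ε² : ε * ε ≈ 1#
  ε² = trans (-1*x≈-x ε) (-‿involutive 1#)

  ε-cancel : ∀ x → x + ε * x ≈ 0#
  ε-cancel x = trans (+-congˡ (-1*x≈-x x)) (-‿inverseʳ x)

  -1^-square : ∀ n → -1^ n * -1^ n ≈ 1#
  -1^-square zero    = *-identityˡ 1#
  -1^-square (suc n) = begin
    (ε * x) * (ε * x)  ≈⟨ solve 2 (λ e x → (e ⊕ x) ⊕ (e ⊕ x) ⊜ (e ⊕ e) ⊕ (x ⊕ x)) refl ε x ⟩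
    (ε * ε) * (x * x)  ≈⟨ *-cong ε² (-1^-square n) ⟩
    1# * 1#            ≈⟨ *-identityˡ 1# ⟩
    1#                 ∎
    where x = -1^ n

  **-∑ : ∀ {n} x y (f : Fin n → Carrier) → x * (y * ∑ f) ≈ ∑ λ i → x * (y * f i)
  **-∑ x y f = trans (*-congˡ (*-∑ y f)) (*-∑ x _)

  -- Expand along the first row, then every minor except the corner one along its first column by
  -- induction. The resulting double sum is the one obtained with the roles of rows and columns
  -- exchanged, and the corner term is common to both.
  Det-column : ∀ {n} (M : Matrix (suc n)) →
    Det M ≈ ∑ λ i → -1^ toℕ i * (M i zero * Det λ k l → M (punchIn i k) (suc l))
  Det-column {zero}  M = trans (Det-suc M) (∑-cong λ { zero → *-congˡ (*-congˡ (trans (Det-zero _) (sym (Det-zero _)))) })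
  Det-column {suc n} M = trans (Det-suc M) (trans (∑-suc _) (trans (+-congˡ main) (sym (∑-suc _))))
    where
    D : Fin (suc n) → Fin (suc n) → Carrier
    D i j = Det λ k l → M (suc (punchIn i k)) (suc (punchIn j l))

    x : Fin (suc n) → Carrier
    x i = -1^ toℕ i

    main : (∑ λ j → -1^ suc (toℕ j) * (M zero (suc j) * Det λ k l → M (suc k) (punchIn (suc j) l)))
         ≈ (∑ λ i → -1^ suc (toℕ i) * (M (suc i) zero * Det λ k l → M (punchIn (suc i) k) (suc l)))
    main = begin
      _ ≈⟨ ∑-cong (λ j → *-congˡ (*-congˡ (Det-column _))) ⟩
      (∑ λ j → (ε * x j) * (M zero (suc j) * ∑ λ i → x i * (M (suc i) zero * D i j)))
        ≈⟨ ∑-cong (λ j → **-∑ _ _ _) ⟩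
      (∑ λ j → ∑ λ i → (ε * x j) * (M zero (suc j) * (x i * (M (suc i) zero * D i j))))
        ≈⟨ ∑-swap _ ⟩
      (∑ λ i → ∑ λ j → (ε * x j) * (M zero (suc j) * (x i * (M (suc i) zero * D i j))))
        ≈⟨ ∑-cong (λ i → ∑-cong λ j →
             solve 6 (λ e x m y m′ d → (e ⊕ x) ⊕ (m ⊕ (y ⊕ (m′ ⊕ d))) ⊜ (e ⊕ y) ⊕ (m′ ⊕ (x ⊕ (m ⊕ d)))) refl
               ε (x j) (M zero (suc j)) (x i) (M (suc i) zero) (D i j)) ⟩
      (∑ λ i → ∑ λ j → (ε * x i) * (M (suc i) zero * (x j * (M zero (suc j) * D i j))))
        ≈⟨ ∑-cong (λ i → **-∑ _ _ _) ⟨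
      (∑ λ i → (ε * x i) * (M (suc i) zero * ∑ λ j → x j * (M zero (suc j) * D i j)))
        ≈⟨ ∑-cong (λ i → *-congˡ (*-congˡ (Det-suc _))) ⟨
      _ ∎

  Det-transpose : ∀ {n} (M : Matrix n) → Det (λ i j → M j i) ≈ Det M
  Det-transpose {zero}  M = trans (Det-zero _) (sym (Det-zero _))
  Det-transpose {suc n} M = begin
    Det (λ i j → M j i)
      ≈⟨ Det-suc _ ⟩
    (∑ λ i → -1^ toℕ i * (M i zero * Det λ k l → M (punchIn i l) (suc k)))
      ≈⟨ ∑-cong (λ i → *-congˡ (*-congˡ (Det-transpose λ k l → M (punchIn i k) (suc l)))) ⟩
    (∑ λ i → -1^ toℕ i * (M i zero * Det λ k l → M (punchIn i k) (suc l)))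
      ≈⟨ Det-column M ⟨
    Det M ∎

  -- A sum over ordered pairs j ≠ m with the sign of the permutation that moves
  -- columns j and m to the front; the third argument of F lists the other columns.
  pairTerm : ∀ {n} → (Fin (suc (suc n)) → Fin (suc (suc n)) → (Fin n → Fin (suc (suc n))) → Carrier) →
             Fin (suc (suc n)) → Fin (suc n) → Carrier
  pairTerm F j l = (-1^ toℕ j * -1^ toℕ l) * F j (punchIn j l) (λ k → punchIn j (punchIn l k))

  pairs : ∀ {n} → (Fin (suc (suc n)) → Fin (suc (suc n)) → (Fin n → Fin (suc (suc n))) → Carrier) → Carrier
  pairs F = ∑ λ j → ∑ λ l → pairTerm F j l

  -- The pairs (j, m) and (m, j) carry opposite signs. Those containing column `zero` cancel against
  -- each other; the others form the same sum with one column fewer. Cancelling term by term works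
  -- over every commutative ring, whereas knowing only that the sum equals its own negative would
  -- require cancelling 2.
  pairs-symmetric : ∀ {n} F →
    (∀ a b {c c′ : Fin n → Fin (suc (suc n))} → c ≗ c′ → F a b c ≈ F a b c′) →
    (∀ a b c → F a b c ≈ F b a c) → pairs F ≈ 0#
  pairs-symmetric {n} F ext F-sym = begin
    pairs F                            ≈⟨ ∑-suc (λ j → ∑ λ l → pairTerm F j l) ⟩
    ∑ first + ∑ (λ j → ∑ λ l → pairTerm F (suc j) l)
      ≈⟨ +-congˡ (∑-cong λ j → ∑-suc (pairTerm F (suc j))) ⟩
    ∑ first + ∑ (λ j → second j + rest j) ≈⟨ +-congˡ (∑-+ second rest) ⟩
    ∑ first + (∑ second + ∑ rest)      ≈⟨ +-assoc _ _ _ ⟨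
    (∑ first + ∑ second) + ∑ rest      ≈⟨ +-congʳ (∑-+ first second) ⟨
    ∑ (λ i → first i + second i) + ∑ rest ≈⟨ +-cong (∑-0 cancel) (rest-zero n F ext F-sym) ⟩
    0# + 0#  ≈⟨ +-identityˡ 0# ⟩
    0#       ∎
    where
    first second rest : Fin (suc n) → Carrier
    first  l = pairTerm F zero l
    second j = pairTerm F (suc j) zero
    rest   j = ∑ λ l → pairTerm F (suc j) (suc l)

    cancel : ∀ i → first i + second i ≈ 0#
    cancel i = begin
      (1# * x) * y + (ε * x * 1#) * F (suc i) zero _  ≈⟨ +-cong (*-congʳ (*-identityˡ x)) (*-cong (*-identityʳ _) (F-sym _ _ _)) ⟩
      x * y + (ε * x) * y                            ≈⟨ +-congˡ (*-assoc ε x y) ⟩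
      x * y + ε * (x * y)                            ≈⟨ ε-cancel _ ⟩
      0#                                             ∎
      where
      x = -1^ toℕ i
      y = F zero (suc i) (λ k → suc (punchIn i k))

    rest-zero : ∀ n F →
      (∀ a b {c c′ : Fin n → Fin (suc (suc n))} → c ≗ c′ → F a b c ≈ F a b c′) →
      (∀ a b c → F a b c ≈ F b a c) →
      (∑ λ j → ∑ λ l → pairTerm F (suc j) (suc l)) ≈ 0#
    rest-zero zero    F ext F-sym = ∑-0 λ _ → ∑-zero _
    rest-zero (suc n) F ext F-sym = trans
      (∑-cong λ j → ∑-cong {f = λ l → pairTerm F (suc j) (suc l)} {g = pairTerm F″ j} λ l → *-cong
        (begin
          (ε * -1^ toℕ j) * (ε * -1^ toℕ l)
            ≈⟨ solve 3 (λ e x y → (e ⊕ x) ⊕ (e ⊕ y) ⊜ (e ⊕ e) ⊕ (x ⊕ y)) refl ε (-1^ toℕ j) (-1^ toℕ l) ⟩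
          (ε * ε) * (-1^ toℕ j * -1^ toℕ l)  ≈⟨ *-congʳ ε² ⟩
          1# * (-1^ toℕ j * -1^ toℕ l)       ≈⟨ *-identityˡ _ ⟩
          -1^ toℕ j * -1^ toℕ l              ∎)
        (ext (suc j) (suc (punchIn j l))
          {punchIn (suc j) ∘ punchIn (suc l)} {Fin.lift 1 (punchIn j ∘ punchIn l)}
          λ { zero → ≡.refl ; (suc k) → ≡.refl }))
      (pairs-symmetric {n} F″
        (λ a b {c} {c′} eq → ext (suc a) (suc b) {Fin.lift 1 c} {Fin.lift 1 c′}
          λ { zero → ≡.refl ; (suc k) → ≡.cong suc (eq k) })
        (λ a b c → F-sym (suc a) (suc b) (Fin.lift 1 c)))
      where
      -- Column `zero` lies outside every remaining pair, so `Fin.lift 1` keeps it as the first of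
      -- the other columns.
      F″ = λ a b c → F (suc a) (suc b) (Fin.lift 1 c)

  -- A term of the Laplace expansion along the top two rows, with the two orders of a column pair
  -- kept apart.
  topPair : ∀ {n} → Matrix (suc (suc n)) →
            Fin (suc (suc n)) → Fin (suc (suc n)) → (Fin n → Fin (suc (suc n))) → Carrier
  topPair M a b c = M zero a * (M (suc zero) b * Det λ k l → M (suc (suc k)) (c l))

  topPair-ext : ∀ {n} (M : Matrix (suc (suc n))) a b {c c′ : Fin n → Fin (suc (suc n))} →
                c ≗ c′ → topPair M a b c ≈ topPair M a b c′
  topPair-ext M a b c≗ = *-congˡ (*-congˡ (Det-cong λ k l → reflexive (≡.cong (M (suc (suc k))) (c≗ l))))

  Det-pairs : ∀ {n} (M : Matrix (suc (suc n))) → Det M ≈ pairs (topPair M)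
  Det-pairs M = begin
    Det M
      ≈⟨ Det-suc M ⟩
    _ ≈⟨ ∑-cong (λ j → *-congˡ (*-congˡ (Det-suc _))) ⟩
    _ ≈⟨ ∑-cong (λ j → **-∑ _ _ _) ⟩
    (∑ λ j → ∑ λ l → -1^ toℕ j * (M zero j * (-1^ toℕ l * (M (suc zero) (punchIn j l) * D j l))))
      ≈⟨ ∑-cong (λ j → ∑-cong λ l →
           solve 5 (λ x m y m′ d → x ⊕ (m ⊕ (y ⊕ (m′ ⊕ d))) ⊜ (x ⊕ y) ⊕ (m ⊕ (m′ ⊕ d))) refl
             (-1^ toℕ j) (M zero j) (-1^ toℕ l) (M (suc zero) (punchIn j l)) (D j l)) ⟩
    pairs (topPair M) ∎
    where
    D = λ j l → Det λ k m → M (suc (suc k)) (punchIn j (punchIn l m))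

  Det-equal-top : ∀ {n} (M : Matrix (suc (suc n))) → (∀ j → M zero j ≈ M (suc zero) j) → Det M ≈ 0#
  Det-equal-top M eq = trans (Det-pairs M) (pairs-symmetric (topPair M) (topPair-ext M)
    (λ a b c → trans (*-cong (eq a) (*-congʳ (sym (eq b)))) (swap-factors _ _ _)))

  -- Exchanging the rows exchanges the two columns in `topPair`. Hence the sum of the two functions
  -- is symmetric in the pair, and `pairs-symmetric` makes Det M′ + Det M vanish.
  Det-swap : ∀ {n} (M M′ : Matrix (suc (suc n))) →
    (∀ j → M′ zero j ≈ M (suc zero) j) → (∀ j → M′ (suc zero) j ≈ M zero j) →
    (∀ k j → M′ (suc (suc k)) j ≈ M (suc (suc k)) j) → Det M′ ≈ ε * Det M
  Det-swap M M′ e₀ e₁ e₂ = begin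
    Det M′                             ≈⟨ +-identityʳ _ ⟨
    Det M′ + 0#                        ≈⟨ +-congˡ (ε-cancel (Det M)) ⟨
    Det M′ + (Det M + ε * Det M)       ≈⟨ +-assoc _ _ _ ⟨
    (Det M′ + Det M) + ε * Det M       ≈⟨ +-congʳ cancel ⟩
    0# + ε * Det M                     ≈⟨ +-identityˡ _ ⟩
    ε * Det M                          ∎
    where
    F  = topPair M
    F′ = topPair M′

    flip-F : ∀ a b c → F′ a b c ≈ F b a c
    flip-F a b c = trans (*-cong (e₀ a) (*-cong (e₁ b) (Det-cong λ k l → e₂ k (c l)))) (swap-factors _ _ _)

    cancel : Det M′ + Det M ≈ 0#
    cancel = begin
      Det M′ + Det M                   ≈⟨ +-cong (Det-pairs M′) (Det-pairs M) ⟩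
      pairs F′ + pairs F               ≈⟨ ∑-+ _ _ ⟨
      _ ≈⟨ ∑-cong (λ j → trans (sym (∑-+ _ _)) (∑-cong λ l → sym (distribˡ _ _ _))) ⟩
      pairs (λ a b c → F′ a b c + F a b c)
        ≈⟨ pairs-symmetric _
             (λ a b c≗ → +-cong (topPair-ext M′ a b c≗) (topPair-ext M a b c≗))
             (λ a b c → trans (+-cong (flip-F a b c) (sym (flip-F b a c))) (+-comm _ _)) ⟩
      0# ∎

  toFront : ∀ {n} → Fin (suc n) → Fin (suc n) → Fin (suc n)
  toFront i zero    = i
  toFront i (suc k) = punchIn i k

  toSecond : ∀ {n} → Fin (suc n) → Fin (suc (suc n)) → Fin (suc (suc n))
  toSecond i zero    = zero
  toSecond i (suc k) = suc (toFront i k)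

  -- Moving row i + 1 to the front is moving it to second place and then exchanging the top two
  -- rows. A move to second place leaves row `zero` alone, so it is a move to the front inside every
  -- minor of the expansion along that row.
  Det-toFront : ∀ {n} (M : Matrix (suc n)) i → Det (λ k → M (toFront i k)) ≈ -1^ toℕ i * Det M
  Det-toSecond : ∀ {n} (M : Matrix (suc (suc n))) i → Det (λ k → M (toSecond i k)) ≈ -1^ toℕ i * Det M

  Det-toFront         M zero    = trans (Det-cong λ { zero j → refl ; (suc k) j → refl }) (sym (*-identityˡ _))
  Det-toFront {suc n} M (suc i) = begin
    Det (λ k → M (toFront (suc i) k))
      ≈⟨ Det-swap (λ k → M (toSecond i k)) (λ k → M (toFront (suc i) k)) (λ _ → refl) (λ _ → refl) (λ _ _ → refl) ⟩
    ε * Det (λ k → M (toSecond i k))  ≈⟨ *-congˡ (Det-toSecond M i) ⟩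
    ε * (-1^ toℕ i * Det M)           ≈⟨ *-assoc _ _ _ ⟨
    -1^ suc (toℕ i) * Det M           ∎

  Det-toSecond M i = begin
    Det (λ k → M (toSecond i k))
      ≈⟨ Det-suc _ ⟩
    (∑ λ j → -1^ toℕ j * (M zero j * Det λ k l → M (suc (toFront i k)) (punchIn j l)))
      ≈⟨ ∑-cong (λ j → *-congˡ (*-congˡ (Det-toFront (λ k l → M (suc k) (punchIn j l)) i))) ⟩
    (∑ λ j → -1^ toℕ j * (M zero j * (-1^ toℕ i * Det λ k l → M (suc k) (punchIn j l))))
      ≈⟨ ∑-cong (λ j → trans (*-congˡ (swap-factors _ _ _)) (swap-factors _ _ _)) ⟩
    (∑ λ j → -1^ toℕ i * (-1^ toℕ j * (M zero j * Det λ k l → M (suc k) (punchIn j l))))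
      ≈⟨ *-∑ (-1^ toℕ i) _ ⟨
    -1^ toℕ i * (∑ λ j → -1^ toℕ j * (M zero j * Det λ k l → M (suc k) (punchIn j l)))
      ≈⟨ *-congˡ (Det-suc M) ⟨
    -1^ toℕ i * Det M ∎

  sign-involutive : ∀ n x → -1^ n * (-1^ n * x) ≈ x
  sign-involutive n x = trans (sym (*-assoc _ _ _)) (trans (*-congʳ (-1^-square n)) (*-identityˡ x))

  Det-equal-rows : ∀ {n} (M : Matrix (suc n)) i → (∀ j → M zero j ≈ M (suc i) j) → Det M ≈ 0#
  Det-equal-rows {suc n} M i eq = begin
    Det M                                        ≈⟨ sign-involutive (toℕ i) _ ⟨
    -1^ toℕ i * (-1^ toℕ i * Det M)              ≈⟨ *-congˡ (Det-toSecond M i) ⟨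
    -1^ toℕ i * Det (λ k → M (toSecond i k))     ≈⟨ *-congˡ (Det-equal-top (λ k → M (toSecond i k)) eq) ⟩
    -1^ toℕ i * 0#                               ≈⟨ zeroʳ _ ⟩
    0#                                           ∎

-- Strictly decreasing tuples.

lookup-removeAt : ∀ {a} {A : Set a} {n} (xs : Vec A (suc n)) i k →
                  lookup (removeAt xs i) k ≡ lookup xs (punchIn i k)
lookup-removeAt (x ∷ xs)         zero    k       = ≡.refl
lookup-removeAt (x ∷ xs@(_ ∷ _)) (suc i) zero    = ≡.refl
lookup-removeAt (x ∷ xs@(_ ∷ _)) (suc i) (suc k) = lookup-removeAt xs i k

removeAt-suc : ∀ {a} {A : Set a} {n} x (xs : Vec A (suc n)) i → removeAt (x ∷ xs) (suc i) ≡ x ∷ removeAt xs i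
removeAt-suc x (_ ∷ _) i = ≡.refl

punchIn-last : ∀ {n} (k : Fin n) → punchIn (fromℕ n) k ≡ inject₁ k
punchIn-last zero    = ≡.refl
punchIn-last (suc k) = ≡.cong suc (punchIn-last k)

-- From here on `StrictlyDecreasing (m ∷ D)` is the standard way to say that D is strictly
-- decreasing with entries below m; there m is a bound, not an entry.
raise-bound : ∀ {d m n} {D : Vec ℕ d} → m ≤ n → StrictlyDecreasing (m ∷ D) → StrictlyDecreasing (n ∷ D)
raise-bound {D = []}    m≤n _         = [-]
raise-bound {D = _ ∷ _} m≤n (m>x ∷ s) = ℕ.<-≤-trans m>x m≤n ∷ s

lookup< : ∀ {d m} {D : Vec ℕ d} → StrictlyDecreasing (m ∷ D) → ∀ i → lookup D i < m
lookup< {D = _ ∷ _} (m>x ∷ s) zero    = m>x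
lookup< {D = _ ∷ _} (m>x ∷ s) (suc i) = ℕ.<-trans (lookup< s i) m>x

length≤ : ∀ {d m} {D : Vec ℕ d} → StrictlyDecreasing (m ∷ D) → d ≤ m
length≤ {D = []}    _         = z≤n
length≤ {D = _ ∷ _} (m>x ∷ s) = ℕ.≤-<-trans (length≤ s) m>x

lookup-antitone : ∀ {d} {p : Vec ℕ d} → StrictlyDecreasing p → ∀ {i j} → toℕ i ≤ toℕ j → lookup p j ≤ lookup p i
lookup-antitone {p = _ ∷ _} s {zero}  {zero}  _       = ℕ.≤-refl
lookup-antitone {p = _ ∷ _} s {zero}  {suc j} _       = ℕ.<⇒≤ (lookup< s j)
lookup-antitone {p = _ ∷ _} s {suc i} {suc j} (s≤s h) = lookup-antitone (Linked.tail s) h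

-- Sums over strictly decreasing tuples and the Cauchy-Binet formula.

module CauchyBinet {c ℓ} (R : CommutativeRing c ℓ) where

  open CommutativeRing R hiding (zero)
  open RingOperations R using (Matrix; -1^_)
  open Determinants R public
  open import Algebra.Properties.CommutativeSemigroup
    (CommutativeMonoid.commutativeSemigroup +-commutativeMonoid) public using (interchange)
  open import Relation.Binary.Reasoning.Setoid setoid

  Σ< : ℕ → (ℕ → Carrier) → Carrier
  Σ< m f = ∑ {m} λ k → f (toℕ k)

  Σ<-cong : ∀ m {f g : ℕ → Carrier} → (∀ k → k < m → f k ≈ g k) → Σ< m f ≈ Σ< m g
  Σ<-cong m f≈g = ∑-cong λ k → f≈g (toℕ k) (Fin.toℕ<n k)

  Σ<-last : ∀ m f → Σ< (suc m) f ≈ f m + Σ< m f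
  Σ<-last zero    f = trans (∑-suc _) (+-congˡ (trans (∑-zero _) (sym (∑-zero _))))
  Σ<-last (suc m) f = begin
    Σ< (suc (suc m)) f                   ≈⟨ ∑-suc _ ⟩
    f 0 + Σ< (suc m) (f ∘ suc)           ≈⟨ +-congˡ (Σ<-last m (f ∘ suc)) ⟩
    f 0 + (f (suc m) + Σ< m (f ∘ suc))   ≈⟨ +-assoc _ _ _ ⟨
    (f 0 + f (suc m)) + Σ< m (f ∘ suc)   ≈⟨ +-congʳ (+-comm _ _) ⟩
    (f (suc m) + f 0) + Σ< m (f ∘ suc)   ≈⟨ +-assoc _ _ _ ⟩
    f (suc m) + (f 0 + Σ< m (f ∘ suc))   ≈⟨ +-congˡ (∑-suc _) ⟨
    f (suc m) + Σ< (suc m) f             ∎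

  Σ<-truncate : ∀ {m n} f → m ≤ n → (∀ k → m ≤ k → f k ≈ 0#) → Σ< n f ≈ Σ< m f
  Σ<-truncate f z≤n         f≈0 = trans (∑-0 λ k → f≈0 (toℕ k) z≤n) (sym (∑-zero _))
  Σ<-truncate f (s≤s m≤n) f≈0 = trans (∑-suc _) (trans
    (+-congˡ (Σ<-truncate (f ∘ suc) m≤n λ k m≤k → f≈0 (suc k) (s≤s m≤k))) (sym (∑-suc _)))

  Det-last-column : ∀ {n} (M : Matrix (suc n)) → Det M ≈
    -1^ n * ∑ λ i → -1^ toℕ i * (M i (fromℕ n) * Det λ k l → M (punchIn i k) (inject₁ l))
  Det-last-column {n} M = begin
    Det M
      ≈⟨ Det-transpose M ⟨
    Det (λ i j → M j i)
      ≈⟨ sign-involutive n _ ⟨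
    -1^ n * (-1^ n * Det (λ i j → M j i))
      ≈⟨ *-congˡ (*-congʳ (reflexive (≡.cong -1^_ (Fin.toℕ-fromℕ n)))) ⟨
    -1^ n * (-1^ toℕ (fromℕ n) * Det (λ i j → M j i))
      ≈⟨ *-congˡ (Det-toFront (λ i j → M j i) (fromℕ n)) ⟨
    -1^ n * Det (λ i j → M j (toFront (fromℕ n) i))
      ≈⟨ *-congˡ (Det-transpose λ i j → M i (toFront (fromℕ n) j)) ⟩
    -1^ n * Det (λ i j → M i (toFront (fromℕ n) j))
      ≈⟨ *-congˡ (Det-column _) ⟩
    -1^ n * (∑ λ i → -1^ toℕ i * (M i (fromℕ n) * Det λ k l → M (punchIn i k) (punchIn (fromℕ n) l)))
      ≈⟨ *-congˡ (∑-cong λ i → *-congˡ (*-congˡ (Det-cong λ k l → reflexive (≡.cong (M (punchIn i k)) (punchIn-last l))))) ⟩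
    _ ∎

  -- The zero block has n - i rows and i + 1 columns, more than n together. In the expansion along
  -- the first column, either the entry lies in the block or the minor inherits a block with one
  -- column fewer.
  Det-zero-block : ∀ {n} (M : Matrix n) (i : Fin n) → (∀ k l → toℕ i ≤ toℕ k → toℕ l ≤ toℕ i → M k l ≈ 0#) → Det M ≈ 0#
  Det-zero-block {suc n} M i M≈0 = trans (Det-column M) (∑-0 λ k → trans (*-congˡ (factor-zero n M i M≈0 k)) (zeroʳ _))
    where
    punchIn-≥ : ∀ {n} (k : Fin (suc n)) (i k′ : Fin n) → toℕ k ≤ toℕ i → toℕ i ≤ toℕ k′ → suc (toℕ i) ≤ toℕ (punchIn k k′)
    punchIn-≥ zero    i       k′       _         h       = s≤s h
    punchIn-≥ (suc k) (suc i) (suc k′) (s≤s k≤i) (s≤s h) = s≤s (punchIn-≥ k i k′ k≤i h)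

    factor-zero : ∀ n (M : Matrix (suc n)) (i : Fin (suc n)) → (∀ k l → toℕ i ≤ toℕ k → toℕ l ≤ toℕ i → M k l ≈ 0#) → ∀ k →
                  M k zero * Det (λ k′ l → M (punchIn k k′) (suc l)) ≈ 0#
    factor-zero n M i M≈0 k with toℕ i ℕ.≤? toℕ k
    factor-zero n M i M≈0 k | yes i≤k = trans (*-congʳ (M≈0 k zero i≤k z≤n)) (zeroˡ _)
    factor-zero n M zero M≈0 k | no i≰k = contradiction z≤n i≰k
    factor-zero (suc n) M (suc i) M≈0 k | no i≰k = trans (*-congˡ (Det-zero-block _ i λ k′ l i≤k′ l≤i →
      M≈0 (punchIn k k′) (suc l) (punchIn-≥ k i k′ (ℕ.≤-pred (ℕ.≰⇒> i≰k)) i≤k′) (s≤s l≤i))) (zeroʳ _)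

  -- The sum over all m > D₀ > … > D_{d-1} ≥ 0.
  ∑ˢ : ∀ d → ℕ → (Vec ℕ d → Carrier) → Carrier
  ∑ˢ zero    m       f = f []
  ∑ˢ (suc d) zero    f = 0#
  ∑ˢ (suc d) (suc m) f = ∑ˢ d m (λ D → f (m ∷ D)) + ∑ˢ (suc d) m f

  ∑ˢ-cong : ∀ d m {f g : Vec ℕ d → Carrier} → (∀ D → StrictlyDecreasing (m ∷ D) → f D ≈ g D) → ∑ˢ d m f ≈ ∑ˢ d m g
  ∑ˢ-cong zero    m       f≈g = f≈g [] [-]
  ∑ˢ-cong (suc d) zero    f≈g = refl
  ∑ˢ-cong (suc d) (suc m) f≈g = +-cong
    (∑ˢ-cong d m λ D s → f≈g (m ∷ D) (ℕ.≤-refl ∷ s))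
    (∑ˢ-cong (suc d) m λ D s → f≈g D (raise-bound (ℕ.n≤1+n m) s))

  ∑ˢ-+ : ∀ d m (f g : Vec ℕ d → Carrier) → ∑ˢ d m (λ D → f D + g D) ≈ ∑ˢ d m f + ∑ˢ d m g
  ∑ˢ-+ zero    m       f g = refl
  ∑ˢ-+ (suc d) zero    f g = sym (+-identityˡ 0#)
  ∑ˢ-+ (suc d) (suc m) f g = trans (+-cong (∑ˢ-+ d m _ _) (∑ˢ-+ (suc d) m f g)) (interchange _ _ _ _)

  *-∑ˢ : ∀ d m x (f : Vec ℕ d → Carrier) → x * ∑ˢ d m f ≈ ∑ˢ d m (λ D → x * f D)
  *-∑ˢ zero    m       x f = refl
  *-∑ˢ (suc d) zero    x f = zeroʳ x
  *-∑ˢ (suc d) (suc m) x f = trans (distribˡ x _ _) (+-cong (*-∑ˢ d m x _) (*-∑ˢ (suc d) m x f))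

  ∑-∑ˢ : ∀ {n} d m (f : Fin n → Vec ℕ d → Carrier) → ∑ (λ i → ∑ˢ d m (f i)) ≈ ∑ˢ d m (λ D → ∑ λ i → f i D)
  ∑-∑ˢ zero    m       f = refl
  ∑-∑ˢ (suc d) zero    f = ∑-0 λ _ → refl
  ∑-∑ˢ (suc d) (suc m) f = trans (∑-+ _ _) (+-cong (∑-∑ˢ d m _) (∑-∑ˢ (suc d) m f))

  ∑ˢ-empty : ∀ {d m} (f : Vec ℕ d → Carrier) → m < d → ∑ˢ d m f ≈ 0#
  ∑ˢ-empty {suc d} {zero}  f _         = refl
  ∑ˢ-empty {suc d} {suc m} f (s≤s m<d) =
    trans (+-cong (∑ˢ-empty {d} {m} _ m<d) (∑ˢ-empty {suc d} {m} f (ℕ.m≤n⇒m≤1+n m<d))) (+-identityˡ 0#)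

  -- Pairs of a tuple D and a new entry k correspond to pairs of a longer tuple and one of its entries.
  ∑ˢ-insert : ∀ d m (G : ℕ → Vec ℕ d → Carrier) → (∀ D i → G (lookup D i) D ≈ 0#) →
    ∑ˢ d m (λ D → Σ< m λ k → G k D) ≈ ∑ˢ (suc d) m (λ D → ∑ λ i → G (lookup D i) (removeAt D i))
  ∑ˢ-insert zero    zero    G G≈0 = ∑-zero _
  ∑ˢ-insert (suc d) zero    G G≈0 = refl
  ∑ˢ-insert zero    (suc m) G G≈0 = trans (Σ<-last m λ k → G k [])
    (+-cong (sym (trans (∑-suc _) (trans (+-congˡ (∑-zero _)) (+-identityʳ _)))) (∑ˢ-insert zero m G G≈0))
  ∑ˢ-insert (suc d) (suc m) G G≈0 = begin
    ∑ˢ d m (λ E → Σ< (suc m) λ k → G k (m ∷ E)) + ∑ˢ (suc d) m (λ D → Σ< (suc m) λ k → G k D)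
      ≈⟨ +-cong
           (∑ˢ-cong d m λ E _ → trans (Σ<-last m λ k → G k (m ∷ E))
              (trans (+-congʳ (G≈0 (m ∷ E) zero)) (+-identityˡ _)))
           (∑ˢ-cong (suc d) m λ D _ → Σ<-last m λ k → G k D) ⟩
    ∑ˢ d m (λ E → Σ< m λ k → G k (m ∷ E)) + ∑ˢ (suc d) m (λ D → G m D + Σ< m λ k → G k D)
      ≈⟨ +-cong (∑ˢ-insert d m (λ k E → G k (m ∷ E)) λ E i → G≈0 (m ∷ E) (suc i)) (∑ˢ-+ (suc d) m _ _) ⟩
    U + (∑ˢ (suc d) m (G m) + ∑ˢ (suc d) m (λ D → Σ< m λ k → G k D))
      ≈⟨ +-congˡ (+-congˡ (∑ˢ-insert (suc d) m G G≈0)) ⟩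
    U + (∑ˢ (suc d) m (G m) + V)
      ≈⟨ +-assoc _ _ _ ⟨
    (U + ∑ˢ (suc d) m (G m)) + V
      ≈⟨ +-congʳ (trans (+-comm _ _) (sym (∑ˢ-+ (suc d) m _ _))) ⟩
    ∑ˢ (suc d) m (λ D → G m D + ∑ λ i → G (lookup D i) (m ∷ removeAt D i)) + V
      ≈⟨ +-congʳ (∑ˢ-cong (suc d) m λ D _ → trans
           (+-congˡ (∑-cong λ i → reflexive (≡.cong (G (lookup D i)) (≡.sym (removeAt-suc m D i)))))
           (sym (∑-suc _))) ⟩
    ∑ˢ (suc d) m (λ D → ∑ λ i → G (lookup (m ∷ D) i) (removeAt (m ∷ D) i)) + V ∎
    where
    U = ∑ˢ (suc d) m λ D → ∑ λ i → G (lookup D i) (m ∷ removeAt D i)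
    V = ∑ˢ (suc (suc d)) m λ D → ∑ λ i → G (lookup D i) (removeAt D i)

  minorᶜ : ∀ {d} → (Fin d → ℕ → Carrier) → Vec ℕ d → Carrier
  minorᶜ A D = Det λ i j → A i (lookup D j)

  minorʳ : ∀ {d} → (ℕ → Fin d → Carrier) → Vec ℕ d → Carrier
  minorʳ B D = Det λ i j → B (lookup D i) j

  -- Expand along the first row and apply induction to the minors. For fixed k and D the sum over j
  -- rebuilds the determinant of the rows k ∷ D of B, which is zero when k occurs in D. Inserting k
  -- into D leaves a sum over longer tuples, and moving the inserted row to its place in B produces
  -- exactly the signs of the expansion of the A-minor along its first row.
  cauchy-binet : ∀ {d} m (A : Fin d → ℕ → Carrier) (B : ℕ → Fin d → Carrier) →
    Det (λ i j → Σ< m λ k → A i k * B k j) ≈ ∑ˢ d m (λ D → minorᶜ A D * minorʳ B D)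
  cauchy-binet {zero}  m A B = trans (Det-zero _) (sym (trans (*-cong (Det-zero _) (Det-zero _)) (*-identityˡ 1#)))
  cauchy-binet {suc d} m A B = begin
    Det (λ i j → Σ< m λ k → A i k * B k j)
      ≈⟨ Det-suc _ ⟩
    _ ≈⟨ ∑-cong (λ j → *-congˡ (*-congˡ (cauchy-binet m (A ∘ suc) (λ k l → B k (punchIn j l))))) ⟩
    (∑ λ j → x j * ((Σ< m λ k → A zero k * B k j) * ∑ˢ d m λ D → a D * b j D))
      ≈⟨ ∑-cong (λ j → distribute j) ⟩
    (∑ λ j → ∑ˢ d m λ D → Σ< m λ k → x j * ((A zero k * B k j) * (a D * b j D)))
      ≈⟨ ∑-∑ˢ d m _ ⟩
    (∑ˢ d m λ D → ∑ λ j → Σ< m λ k → x j * ((A zero k * B k j) * (a D * b j D)))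
      ≈⟨ ∑ˢ-cong d m (λ D _ → trans (∑-swap _) (∑-cong λ k → collect D (toℕ k))) ⟩
    (∑ˢ d m λ D → Σ< m λ k → G k D)
      ≈⟨ ∑ˢ-insert d m G (λ D i → trans (*-congˡ (Det-equal-rows _ i λ _ → refl)) (zeroʳ _)) ⟩
    (∑ˢ (suc d) m λ D → ∑ λ i → G (lookup D i) (removeAt D i))
      ≈⟨ ∑ˢ-cong (suc d) m (λ D _ → expand D) ⟩
    ∑ˢ (suc d) m (λ D → minorᶜ A D * minorʳ B D) ∎
    where
    x : Fin (suc d) → Carrier
    x j = -1^ toℕ j

    a : Vec ℕ d → Carrier
    a = minorᶜ (A ∘ suc)

    b : Fin (suc d) → Vec ℕ d → Carrier
    b j = minorʳ λ k l → B k (punchIn j l)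

    G : ℕ → Vec ℕ d → Carrier
    G k D = (A zero k * a D) * minorʳ B (k ∷ D)

    distribute : ∀ j → x j * ((Σ< m λ k → A zero k * B k j) * ∑ˢ d m λ D → a D * b j D) ≈
                 ∑ˢ d m λ D → Σ< m λ k → x j * ((A zero k * B k j) * (a D * b j D))
    distribute j = begin
      _ ≈⟨ *-congˡ (*-∑ˢ d m _ _) ⟩
      _ ≈⟨ *-∑ˢ d m _ _ ⟩
      _ ≈⟨ ∑ˢ-cong d m (λ D _ → trans (*-congˡ (*-comm _ _)) (trans (**-∑ _ _ _) (∑-cong λ k → *-congˡ (*-comm _ _)))) ⟩
      _ ∎

    collect : ∀ D k → (∑ λ j → x j * ((A zero k * B k j) * (a D * b j D))) ≈ G k D
    collect D k = begin
      (∑ λ j → x j * ((A zero k * B k j) * (a D * b j D)))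
        ≈⟨ ∑-cong (λ j → solve 5 (λ x α β α′ β′ → x ⊕ ((α ⊕ β) ⊕ (α′ ⊕ β′)) ⊜ (α ⊕ α′) ⊕ (x ⊕ (β ⊕ β′))) refl
             (x j) (A zero k) (B k j) (a D) (b j D)) ⟩
      (∑ λ j → (A zero k * a D) * (x j * (B k j * b j D)))
        ≈⟨ *-∑ _ _ ⟨
      (A zero k * a D) * (∑ λ j → x j * (B k j * b j D))
        ≈⟨ *-congˡ (Det-suc _) ⟨
      G k D ∎

    expand : ∀ D → (∑ λ i → G (lookup D i) (removeAt D i)) ≈ minorᶜ A D * minorʳ B D
    expand D = begin
      (∑ λ i → G (lookup D i) (removeAt D i))
        ≈⟨ ∑-cong (λ i → begin
             G (lookup D i) (removeAt D i)
               ≈⟨ *-cong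
                    (*-congˡ (Det-cong λ k l → reflexive (≡.cong (A (suc k)) (lookup-removeAt D i l))))
                    (trans (Det-cong λ { zero l → refl ; (suc k) l → reflexive (≡.cong (λ r → B r l) (lookup-removeAt D i k)) })
                           (Det-toFront (λ k → B (lookup D k)) i)) ⟩
             (A zero (lookup D i) * C i) * (x i * minorʳ B D)
               ≈⟨ solve 4 (λ α β x γ → (α ⊕ β) ⊕ (x ⊕ γ) ⊜ γ ⊕ (x ⊕ (α ⊕ β))) refl _ _ _ _ ⟩
             minorʳ B D * (x i * (A zero (lookup D i) * C i)) ∎) ⟩
      (∑ λ i → minorʳ B D * (x i * (A zero (lookup D i) * C i)))
        ≈⟨ *-∑ _ _ ⟨
      minorʳ B D * (∑ λ i → x i * (A zero (lookup D i) * C i))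
        ≈⟨ *-congˡ (Det-suc _) ⟨
      minorʳ B D * minorᶜ A D
        ≈⟨ *-comm _ _ ⟩
      minorᶜ A D * minorʳ B D ∎
      where
      C : Fin (suc d) → Carrier
      C i = Det λ k l → A (suc k) (lookup D (punchIn i l))

  δ : ℕ → ℕ → Carrier
  δ zero    zero    = 1#
  δ zero    (suc _) = 0#
  δ (suc _) zero    = 0#
  δ (suc i) (suc j) = δ i j

  δ-diagonal : ∀ i → δ i i ≈ 1#
  δ-diagonal zero    = refl
  δ-diagonal (suc i) = δ-diagonal i

  δ-sym : ∀ i j → δ i j ≈ δ j i
  δ-sym zero    zero    = refl
  δ-sym zero    (suc j) = refl
  δ-sym (suc i) zero    = refl
  δ-sym (suc i) (suc j) = δ-sym i j

  δ-below : ∀ {i j} → j < i → δ i j ≈ 0#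
  δ-below {suc i} {zero}  _       = refl
  δ-below {suc i} {suc j} (s≤s h) = δ-below h

  Σ<-δʳ : ∀ n (f : ℕ → Carrier) j → j < n → (Σ< n λ k → f k * δ k j) ≈ f j
  Σ<-δʳ (suc n) f zero    _         = trans (∑-suc _) (trans
    (+-cong (*-identityʳ _) (∑-0 λ k → zeroʳ _)) (+-identityʳ _))
  Σ<-δʳ (suc n) f (suc j) (s≤s j<n) = trans (∑-suc _) (trans
    (+-cong (zeroʳ _) (Σ<-δʳ n (f ∘ suc) j j<n)) (+-identityˡ _))

  Σ<-δˡ : ∀ n (f : ℕ → Carrier) i → i < n → (Σ< n λ k → δ i k * f k) ≈ f i
  Σ<-δˡ n f i i<n = trans (∑-cong {n} λ k → trans (*-comm _ _) (*-congˡ (δ-sym i (toℕ k)))) (Σ<-δʳ n f i i<n)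

  Det-unitriangular : ∀ n (F : ℕ → ℕ → Carrier) → (∀ k → F k k ≈ 1#) → (∀ {k j} → j < k → F k j ≈ 0#) →
    Det {n} (λ i j → F (toℕ i) (toℕ j)) ≈ 1#
  Det-unitriangular zero    F diag low = Det-zero _
  Det-unitriangular (suc n) F diag low = trans
    (Det-unit-last-row _
      (λ j → low (≡.subst₂ _<_ (≡.sym (Fin.toℕ-inject₁ j)) (≡.sym (Fin.toℕ-fromℕ n)) (Fin.toℕ<n j)))
      (diag _))
    (trans (Det-cong λ i j → reflexive (≡.cong₂ F (Fin.toℕ-inject₁ i) (Fin.toℕ-inject₁ j)))
           (Det-unitriangular n F diag low))

  descending : ∀ n → Vec ℕ n
  descending zero    = []
  descending (suc n) = n ∷ descending n

  ∑ˢ-full : ∀ n (f : Vec ℕ n → Carrier) → ∑ˢ n n f ≈ f (descending n)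
  ∑ˢ-full zero    f = refl
  ∑ˢ-full (suc n) f = trans (+-cong (∑ˢ-full n _) (∑ˢ-empty f ℕ.≤-refl)) (+-identityʳ _)

  -- With n indices below n the only tuple is `descending n`, so Cauchy-Binet gives minors with
  -- reversed columns and reversed rows. Writing A as A δ and B as δ B collects the reversal signs
  -- in `α δ * β δ`, which is the determinant of the identity, so they are never computed.
  Det-* : ∀ n (A B : ℕ → ℕ → Carrier) →
    Det {n} (λ i j → Σ< n λ k → A (toℕ i) k * B k (toℕ j)) ≈
    Det {n} (λ i j → A (toℕ i) (toℕ j)) * Det {n} (λ i j → B (toℕ i) (toℕ j))
  Det-* n A B = sym (begin
    Det {n} (λ i j → A (toℕ i) (toℕ j)) * Det {n} (λ i j → B (toℕ i) (toℕ j))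
      ≈⟨ *-cong (Det-cong {n} λ i j → sym (Σ<-δʳ n (A (toℕ i)) (toℕ j) (Fin.toℕ<n j)))
                (Det-cong {n} λ i j → sym (Σ<-δˡ n (λ k → B k (toℕ j)) (toℕ i) (Fin.toℕ<n i))) ⟩
    Det {n} (λ i j → Σ< n λ k → A (toℕ i) k * δ k (toℕ j)) * Det {n} (λ i j → Σ< n λ k → δ (toℕ i) k * B k (toℕ j))
      ≈⟨ *-cong (product A δ) (product δ B) ⟩
    (α A * β δ) * (α δ * β B)
      ≈⟨ solve 4 (λ a b c d → (a ⊕ b) ⊕ (c ⊕ d) ⊜ (c ⊕ b) ⊕ (a ⊕ d)) refl (α A) (β δ) (α δ) (β B) ⟩
    (α δ * β δ) * (α A * β B)
      ≈⟨ *-congʳ (trans (sym (product δ δ)) (trans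
           (Det-cong {n} λ i j → Σ<-δʳ n (δ (toℕ i)) (toℕ j) (Fin.toℕ<n j))
           (Det-unitriangular n δ δ-diagonal δ-below))) ⟩
    1# * (α A * β B)  ≈⟨ *-identityˡ _ ⟩
    α A * β B         ≈⟨ product A B ⟨
    Det {n} (λ i j → Σ< n λ k → A (toℕ i) k * B k (toℕ j)) ∎)
    where
    α β : (ℕ → ℕ → Carrier) → Carrier
    α A = minorᶜ {n} (λ i → A (toℕ i)) (descending n)
    β B = minorʳ {n} (λ k j → B k (toℕ j)) (descending n)

    product : ∀ A B → Det {n} (λ i j → Σ< n λ k → A (toℕ i) k * B k (toℕ j)) ≈ α A * β B
    product A B = trans (cauchy-binet n (λ i → A (toℕ i)) (λ k j → B k (toℕ j))) (∑ˢ-full n _)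

-- Row patterns of a diagram in Frobenius notation.

-- A diagram with Frobenius coordinates (p ∣ q) has its row i described by p_i
-- when i < d; the other rows are described by the numbers outside q, in increasing order.
hookRow : ∀ {a} {A : Set a} {d} → (Fin d → A) → (ℕ → A) → Vec ℕ d → ℕ → A
hookRow V f []       i       = f i
hookRow V f (q ∷ qs) zero    = V zero
hookRow V f (q ∷ qs) (suc i) = if does (i ℕ.<? q) then hookRow (V ∘ suc) f qs i else f (suc i)

-- `punchIn` on natural numbers: the increasing enumeration of the numbers other than i.
skip : ℕ → ℕ → ℕ
skip zero    k       = suc k
skip (suc i) zero    = zero
skip (suc i) (suc k) = suc (skip i k)

skip-≤ : ∀ i k → skip i k ≤ suc k
skip-≤ zero    k       = ℕ.≤-refl
skip-≤ (suc i) zero    = z≤n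
skip-≤ (suc i) (suc k) = s≤s (skip-≤ i k)

skip-past : ∀ {i k} → i ≤ k → skip i k ≡ suc k
skip-past {zero}          _         = ≡.refl
skip-past {suc i} {suc k} (s≤s i≤k) = ≡.cong suc (skip-past i≤k)

toℕ-punchIn : ∀ {n} (i : Fin (suc n)) k → toℕ (punchIn i k) ≡ skip (toℕ i) (toℕ k)
toℕ-punchIn zero    k       = ≡.refl
toℕ-punchIn (suc i) zero    = ≡.refl
toℕ-punchIn (suc i) (suc k) = ≡.cong suc (toℕ-punchIn i k)

module _ {a} {A : Set a} where

  hookRow-inside : ∀ {d} (V : Fin (suc d) → A) f {q} qs {i} → i < q →
                   hookRow V f (q ∷ qs) (suc i) ≡ hookRow (V ∘ suc) f qs i
  hookRow-inside V f {q} qs {i} i<q rewrite dec-true (i ℕ.<? q) i<q = ≡.refl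

  hookRow-outside : ∀ {d} (V : Fin (suc d) → A) f {q} (qs : Vec ℕ d) {i} → q ≤ i →
                    hookRow V f (q ∷ qs) (suc i) ≡ f (suc i)
  hookRow-outside V f {q} qs {i} q≤i rewrite dec-false (i ℕ.<? q) (ℕ.≤⇒≯ q≤i) = ≡.refl

  hookRow-beyond : ∀ {d n} (V : Fin d → A) f {qs : Vec ℕ d} {i} → StrictlyDecreasing (n ∷ qs) → n ≤ i →
                   hookRow V f qs i ≡ f i
  hookRow-beyond V f {[]}             _        _   = ≡.refl
  hookRow-beyond V f {q ∷ qs} {zero}  (n>q ∷ _) n≤i = contradiction (ℕ.<-≤-trans n>q n≤i) λ ()
  hookRow-beyond V f {q ∷ qs} {suc i} (n>q ∷ _) n≤i = hookRow-outside V f qs (ℕ.≤-pred (ℕ.<-≤-trans n>q n≤i))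

  hookRow-top : ∀ {d n} (V : Fin d → A) f {qs : Vec ℕ d} → StrictlyDecreasing (n ∷ qs) → ∀ i →
                hookRow V f qs (toℕ i) ≡ V i
  hookRow-top V f {q ∷ qs} _       zero    = ≡.refl
  hookRow-top V f {q ∷ qs} (_ ∷ s) (suc i) = ≡.trans
    (hookRow-inside V f qs (ℕ.<-≤-trans (Fin.toℕ<n i) (length≤ s)))
    (hookRow-top (V ∘ suc) f s i)

  -- Deleting one of the top rows moves the rows described by f up by one. Dropping the largest
  -- entry q has the same effect as long as the index stays below q, so the minors in `giambelli-δ`
  -- are again of hook form.
  hookRow-skip : ∀ {d} (V : Fin (suc d) → A) f {q} {qs : Vec ℕ d} → StrictlyDecreasing (q ∷ qs) →
                 ∀ i {k} → k < q →
                 hookRow V f (q ∷ qs) (skip (toℕ i) k) ≡ hookRow (V ∘ punchIn i) f qs k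
  hookRow-skip V f {qs = qs}      _         zero            k<q = hookRow-inside V f qs k<q
  hookRow-skip V f {qs = q′ ∷ qs} _         (suc i) {zero}  _   = ≡.refl
  hookRow-skip V f {qs = q′ ∷ qs} (_ ∷ s)   (suc i) {suc k} k<q = ≡.trans
    (hookRow-inside V f (q′ ∷ qs) (ℕ.≤-<-trans (skip-≤ (toℕ i) k) k<q)) rest
    where
    rest : hookRow (V ∘ suc) f (q′ ∷ qs) (skip (toℕ i) k) ≡ hookRow (V ∘ punchIn (suc i)) f (q′ ∷ qs) (suc k)
    rest with k ℕ.<? q′
    ... | yes k<q′ = ≡.trans (hookRow-skip (V ∘ suc) f s i k<q′) (≡.sym (hookRow-inside (V ∘ punchIn (suc i)) f qs k<q′))
    ... | no  k≮q′ = ≡.trans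
      (≡.cong (hookRow (V ∘ suc) f (q′ ∷ qs))
        (skip-past (ℕ.≤-trans (ℕ.≤-pred (Fin.toℕ<n i)) (ℕ.≤-trans (length≤ s) (ℕ.≮⇒≥ k≮q′)))))
      (≡.trans (hookRow-outside (V ∘ suc) f qs (ℕ.≮⇒≥ k≮q′))
               (≡.sym (hookRow-outside (V ∘ punchIn (suc i)) f qs (ℕ.≮⇒≥ k≮q′))))

-- Row i consults f only at indices k ≤ i. This bound keeps k inside the matrix when `giambelli`
-- replaces a row of F by a row of `δ`.
hookRow-lift : ∀ {a b r} {A : Set a} {B : Set b} (P : A → B → Set r) {d} {V : Fin d → A} {W : Fin d → B} {f g} →
               (∀ i → P (V i) (W i)) → ∀ qs i → (∀ k → k ≤ i → P (f k) (g k)) →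
               P (hookRow V f qs i) (hookRow W g qs i)
hookRow-lift P PV []       i       Pf = Pf i ℕ.≤-refl
hookRow-lift P PV (q ∷ qs) zero    Pf = PV zero
hookRow-lift P PV (q ∷ qs) (suc i) Pf with i ℕ.<? q
... | yes i<q rewrite dec-true (i ℕ.<? q) i<q = hookRow-lift P (PV ∘ suc) qs i (λ k k≤i → Pf k (ℕ.m≤n⇒m≤1+n k≤i))
... | no  i≮q rewrite dec-false (i ℕ.<? q) i≮q = Pf (suc i) ℕ.≤-refl

-- Reduction of the large determinant to one of size d.

module Giambelli {c ℓ} (R : CommutativeRing c ℓ) where

  open CommutativeRing R hiding (zero)
  open RingOperations R using (-1^_)
  open CauchyBinet R public
  open import Relation.Binary.Reasoning.Setoid setoid

  sign : ∀ {d} → Vec ℕ d → Carrier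
  sign []       = 1#
  sign (q ∷ qs) = -1^ q * sign qs

  hookRow-low : ∀ {d} (X : Fin d → ℕ → Carrier) qs {i c} → d ≤ i → i < c → hookRow X δ qs i c ≈ 0#
  hookRow-low X []       {zero}  {suc c} _         _         = refl
  hookRow-low X []       {suc i} {suc c} _         (s≤s i<c) = hookRow-low X [] z≤n i<c
  hookRow-low X (q ∷ qs) {suc i} {c}     (s≤s d≤i) i<c with i ℕ.<? q
  ... | yes i<q rewrite dec-true (i ℕ.<? q) i<q = hookRow-low (X ∘ suc) qs d≤i (ℕ.<-trans ℕ.≤-refl i<c)
  ... | no  i≮q rewrite dec-false (i ℕ.<? q) i≮q = trans (δ-sym (suc i) c) (δ-below i<c)

  -- If the last column index is not in q, the last row is a unit vector and the size drops by one.
  -- Otherwise that index is the largest entry of q and no row of `δ` reaches the last column. Only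
  -- the top rows then contribute to the expansion along it; their minors have the same form without
  -- that entry, and the sum is the first-column expansion of the small determinant.
  giambelli-δ : ∀ {d} N (X : Fin d → ℕ → Carrier) qs → StrictlyDecreasing (N ∷ qs) →
    Det {N} (λ i j → hookRow X δ qs (toℕ i) (toℕ j)) ≈ sign qs * Det (λ i j → X i (lookup qs j))
  giambelli-last : ∀ {d} N (X : Fin d → ℕ → Carrier) qs → StrictlyDecreasing (N ∷ qs) →
    Det {suc N} (λ i j → hookRow X δ qs (toℕ i) (toℕ j)) ≈ sign qs * Det (λ i j → X i (lookup qs j))
  giambelli-δ zero    X []       s = trans (Det-zero _) (sym (trans (*-congˡ (Det-zero _)) (*-identityˡ 1#)))
  giambelli-δ zero    X (q ∷ qs) (() ∷ _)
  giambelli-δ (suc N) X []       s = giambelli-last N X [] [-]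
  giambelli-δ {suc d} (suc N) X (q ∷ qs) (s≤s q≤N ∷ s) with ℕ.m≤n⇒m<n∨m≡n q≤N
  ... | inj₁ q<N    = giambelli-last N X (q ∷ qs) (q<N ∷ s)
  ... | inj₂ ≡.refl = begin
    Det {suc q} (λ i j → W (toℕ i) (toℕ j))
      ≈⟨ Det-last-column _ ⟩
    -1^ q * (∑ {suc q} λ i → -1^ toℕ i * (W (toℕ i) (toℕ (fromℕ q)) * Det {q} λ k l → W (toℕ (punchIn i k)) (toℕ (inject₁ l))))
      ≈⟨ *-congˡ (∑-cong λ i → *-congˡ (*-cong
           (reflexive (≡.cong (W (toℕ i)) (Fin.toℕ-fromℕ q)))
           (Det-cong λ k l → reflexive (≡.cong₂ W (toℕ-punchIn i k) (Fin.toℕ-inject₁ l))))) ⟩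
    -1^ q * Σ< (suc q) t
      ≈⟨ *-congˡ (Σ<-truncate t (s≤s (length≤ s)) λ { (suc i) d≤i → trans
           (*-congˡ (trans (*-congʳ (t-low i d≤i)) (zeroˡ _))) (zeroʳ _) }) ⟩
    -1^ q * Σ< (suc d) t
      ≈⟨ *-congˡ (∑-cong λ i → *-congˡ (*-cong
           (reflexive (≡.cong (λ r → r q) (hookRow-top X δ (ℕ.≤-refl ∷ s) i)))
           (trans (Det-cong λ k l → reflexive (≡.cong (λ r → r (toℕ l)) (hookRow-skip X δ s i (Fin.toℕ<n k))))
                  (giambelli-δ q (X ∘ punchIn i) qs s)))) ⟩
    -1^ q * (∑ {suc d} λ i → -1^ toℕ i * (X i q * (sign qs * Det λ k l → X (punchIn i k) (lookup qs l))))
      ≈⟨ *-congˡ (∑-cong λ i → trans (*-congˡ (swap-factors _ _ _)) (swap-factors _ _ _)) ⟩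
    -1^ q * (∑ {suc d} λ i → sign qs * (-1^ toℕ i * (X i q * Det λ k l → X (punchIn i k) (lookup qs l))))
      ≈⟨ *-congˡ (*-∑ _ _) ⟨
    -1^ q * (sign qs * (∑ {suc d} λ i → -1^ toℕ i * (X i q * Det λ k l → X (punchIn i k) (lookup qs l))))
      ≈⟨ *-congˡ (*-congˡ (Det-column _)) ⟨
    -1^ q * (sign qs * Det (λ i j → X i (lookup (q ∷ qs) j)))
      ≈⟨ *-assoc _ _ _ ⟨
    sign (q ∷ qs) * Det (λ i j → X i (lookup (q ∷ qs) j)) ∎
    where
    W : ℕ → ℕ → Carrier
    W = hookRow X δ (q ∷ qs)

    t : ℕ → Carrier
    t i = -1^ i * (W i q * Det {q} λ k l → W (skip i (toℕ k)) (toℕ l))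

    t-low : ∀ i → suc d ≤ suc i → W (suc i) q ≈ 0#
    t-low i (s≤s d≤i) with i ℕ.<? q
    ... | yes i<q rewrite dec-true (i ℕ.<? q) i<q = hookRow-low (X ∘ suc) qs d≤i i<q
    ... | no  i≮q rewrite dec-false (i ℕ.<? q) i≮q = δ-below (s≤s (ℕ.≮⇒≥ i≮q))

  giambelli-last N X qs s = trans
    (Det-unit-last-row _
      (λ j → trans (last-row (inject₁ j)) (δ-below (≡.subst (_< N) (≡.sym (Fin.toℕ-inject₁ j)) (Fin.toℕ<n j))))
      (trans (last-row (fromℕ N)) (trans (reflexive (≡.cong (δ N) (Fin.toℕ-fromℕ N))) (δ-diagonal N))))
    (trans (Det-cong λ i j → reflexive (≡.cong₂ (hookRow X δ qs) (Fin.toℕ-inject₁ i) (Fin.toℕ-inject₁ j)))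
           (giambelli-δ N X qs s))
    where
    last-row : ∀ j → hookRow X δ qs (toℕ (fromℕ N)) (toℕ j) ≈ δ N (toℕ j)
    last-row j = reflexive (≡.cong (λ r → r (toℕ j))
      (≡.trans (≡.cong (hookRow X δ qs) (Fin.toℕ-fromℕ N)) (hookRow-beyond X δ s ℕ.≤-refl)))

  -- Every row of either kind is a combination of the rows of F, with coefficients X i or a row of
  -- `δ`. The matrix is therefore a product whose second factor has determinant 1.
  giambelli : ∀ {d} N (F : ℕ → ℕ → Carrier) → (∀ k → F k k ≈ 1#) → (∀ {k j} → j < k → F k j ≈ 0#) →
    ∀ (V X : Fin d → ℕ → Carrier) → (∀ i j → j < N → V i j ≈ Σ< N λ k → X i k * F k j) →
    ∀ qs → StrictlyDecreasing (N ∷ qs) →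
    Det {N} (λ i j → hookRow V F qs (toℕ i) (toℕ j)) ≈ sign qs * Det (λ i j → X i (lookup qs j))
  giambelli N F diag low V X V≈XF qs s = begin
    Det {N} (λ i j → hookRow V F qs (toℕ i) (toℕ j))
      ≈⟨ Det-cong {N} (λ i j → hookRow-lift IsProduct V≈XF qs (toℕ i)
           (λ k k≤i j j<N → sym (Σ<-δˡ N (λ k′ → F k′ j) k (ℕ.≤-<-trans k≤i (Fin.toℕ<n i))))
           (toℕ j) (Fin.toℕ<n j)) ⟩
    Det {N} (λ i j → Σ< N λ k → hookRow X δ qs (toℕ i) k * F k (toℕ j))
      ≈⟨ Det-* N (hookRow X δ qs) F ⟩
    Det {N} (λ i j → hookRow X δ qs (toℕ i) (toℕ j)) * Det {N} (λ i j → F (toℕ i) (toℕ j))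
      ≈⟨ *-cong (giambelli-δ N X qs s) (Det-unitriangular N F diag low) ⟩
    (sign qs * Det (λ i j → X i (lookup qs j))) * 1#
      ≈⟨ *-identityʳ _ ⟩
    sign qs * Det (λ i j → X i (lookup qs j)) ∎
    where
    IsProduct : (ℕ → Carrier) → (ℕ → Carrier) → Set ℓ
    IsProduct v x = ∀ j → j < N → v j ≈ Σ< N λ k → x k * F k j

-- Polynomials given by their roots, umbral evaluation and coefficient determinants.

module Polynomials {c ℓ} (R : CommutativeRing c ℓ) where

  open CommutativeRing R hiding (zero)
  open RingOperations R using (-1^_; elementary)
  open Giambelli R public
  open import Algebra.Properties.Ring ring using (-1*x≈-x; -‿distribˡ-*)
  open import Relation.Binary.Reasoning.Setoid setoid

  -- The coefficient of tⁱ in the product of the t - x for x in xs.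
  rootCoeff : List Carrier → ℕ → Carrier
  rootCoeff []       zero    = 1#
  rootCoeff []       (suc i) = 0#
  rootCoeff (x ∷ xs) zero    = - x * rootCoeff xs zero
  rootCoeff (x ∷ xs) (suc i) = rootCoeff xs i + - x * rootCoeff xs (suc i)

  -- The image of that product under the linear map tⁱ ↦ ψ i.
  umbral : List Carrier → (ℕ → Carrier) → Carrier
  umbral []       ψ = ψ 0
  umbral (x ∷ xs) ψ = umbral xs (ψ ∘ suc) + - x * umbral xs ψ

  umbral-cong : ∀ xs {φ ψ : ℕ → Carrier} → (∀ l → l ≤ length xs → φ l ≈ ψ l) → umbral xs φ ≈ umbral xs ψ
  umbral-cong []       eq = eq 0 z≤n
  umbral-cong (x ∷ xs) eq = +-cong
    (umbral-cong xs λ l l≤ → eq (suc l) (s≤s l≤))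
    (*-congˡ (umbral-cong xs λ l l≤ → eq l (ℕ.m≤n⇒m≤1+n l≤)))

  umbral-linear : ∀ xs y (φ ψ : ℕ → Carrier) → umbral xs (λ l → φ l + y * ψ l) ≈ umbral xs φ + y * umbral xs ψ
  umbral-linear []       y φ ψ = refl
  umbral-linear (x ∷ xs) y φ ψ = begin
    umbral xs (λ l → φ (suc l) + y * ψ (suc l)) + - x * umbral xs (λ l → φ l + y * ψ l)
      ≈⟨ +-cong (umbral-linear xs y _ _) (trans (*-congˡ (umbral-linear xs y _ _)) (distribˡ _ _ _)) ⟩
    (umbral xs (φ ∘ suc) + y * umbral xs (ψ ∘ suc)) + (- x * umbral xs φ + - x * (y * umbral xs ψ))
      ≈⟨ interchange _ _ _ _ ⟩
    umbral (x ∷ xs) φ + (y * umbral xs (ψ ∘ suc) + - x * (y * umbral xs ψ))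
      ≈⟨ +-congˡ (trans (distribˡ _ _ _) (+-congˡ (swap-factors _ _ _))) ⟨
    umbral (x ∷ xs) φ + y * umbral (x ∷ xs) ψ ∎

  umbral-∑ : ∀ {n} xs (y : Fin n → Carrier) (ψ : Fin n → ℕ → Carrier) →
    umbral xs (λ l → ∑ λ i → y i * ψ i l) ≈ ∑ λ i → y i * umbral xs (ψ i)
  umbral-∑ []       y ψ = refl
  umbral-∑ (x ∷ xs) y ψ = begin
    umbral xs (λ l → ∑ λ i → y i * ψ i (suc l)) + - x * umbral xs (λ l → ∑ λ i → y i * ψ i l)
      ≈⟨ +-cong (umbral-∑ xs y _) (trans (*-congˡ (umbral-∑ xs y ψ)) (*-∑ _ _)) ⟩
    (∑ λ i → y i * umbral xs (ψ i ∘ suc)) + (∑ λ i → - x * (y i * umbral xs (ψ i)))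
      ≈⟨ ∑-+ _ _ ⟨
    (∑ λ i → y i * umbral xs (ψ i ∘ suc) + - x * (y i * umbral xs (ψ i)))
      ≈⟨ ∑-cong (λ i → trans (distribˡ _ _ _) (+-congˡ (swap-factors _ _ _))) ⟨
    (∑ λ i → y i * umbral (x ∷ xs) (ψ i)) ∎

  umbral-++ : ∀ xs ys ψ → umbral (xs ++ ys) ψ ≈ umbral ys (λ n → umbral xs (λ l → ψ (l ℕ.+ n)))
  umbral-++ []       ys ψ = refl
  umbral-++ (x ∷ xs) ys ψ = trans
    (+-cong (umbral-++ xs ys (ψ ∘ suc)) (*-congˡ (umbral-++ xs ys ψ)))
    (sym (umbral-linear ys (- x) _ _))

  umbral-rootCoeff : ∀ xs {m} ψ → length xs < m → umbral xs ψ ≈ Σ< m λ i → rootCoeff xs i * ψ i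
  umbral-rootCoeff []       {suc m} ψ _       = sym (trans (∑-suc _)
    (trans (+-cong (*-identityˡ _) (∑-0 λ i → zeroˡ _)) (+-identityʳ _)))
  umbral-rootCoeff (x ∷ xs) {suc m} ψ (s≤s h) = begin
    umbral xs (ψ ∘ suc) + - x * umbral xs ψ
      ≈⟨ +-cong (umbral-rootCoeff xs _ h) (*-congˡ (trans (umbral-rootCoeff xs {suc m} ψ (ℕ.m≤n⇒m≤1+n h)) (∑-suc _))) ⟩
    A + - x * (rootCoeff xs 0 * ψ 0 + B)
      ≈⟨ +-congˡ (trans (distribˡ _ _ _) (+-cong (sym (*-assoc _ _ _)) (*-∑ _ _))) ⟩
    A + ((- x * rootCoeff xs 0) * ψ 0 + B′)
      ≈⟨ +-assoc _ _ _ ⟨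
    (A + (- x * rootCoeff xs 0) * ψ 0) + B′
      ≈⟨ +-congʳ (+-comm _ _) ⟩
    ((- x * rootCoeff xs 0) * ψ 0 + A) + B′
      ≈⟨ +-assoc _ _ _ ⟩
    (- x * rootCoeff xs 0) * ψ 0 + (A + B′)
      ≈⟨ +-congˡ (trans (∑-cong λ i → trans (distribʳ _ _ _) (+-congˡ (*-assoc _ _ _))) (∑-+ _ _)) ⟨
    (- x * rootCoeff xs 0) * ψ 0 + Σ< m (λ i → rootCoeff (x ∷ xs) (suc i) * ψ (suc i))
      ≈⟨ ∑-suc _ ⟨
    Σ< (suc m) (λ i → rootCoeff (x ∷ xs) i * ψ i) ∎
    where
    A  = Σ< m λ i → rootCoeff xs i * ψ (suc i)
    B  = Σ< m λ i → rootCoeff xs (suc i) * ψ (suc i)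
    B′ = Σ< m λ i → - x * (rootCoeff xs (suc i) * ψ (suc i))

  rootCoeff-beyond : ∀ xs {i} → length xs < i → rootCoeff xs i ≈ 0#
  rootCoeff-beyond []       {suc i} _       = refl
  rootCoeff-beyond (x ∷ xs) {suc i} (s≤s h) = trans
    (+-cong (rootCoeff-beyond xs h) (trans (*-congˡ (rootCoeff-beyond xs (ℕ.m≤n⇒m≤1+n h))) (zeroʳ _)))
    (+-identityˡ 0#)

  elementary-beyond : ∀ xs {m} → length xs < m → elementary m xs ≈ 0#
  elementary-beyond []       {suc m} _       = refl
  elementary-beyond (x ∷ xs) {suc m} (s≤s h) = trans
    (+-cong (trans (*-congˡ (elementary-beyond xs h)) (zeroʳ _)) (elementary-beyond xs (ℕ.m≤n⇒m≤1+n h)))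
    (+-identityˡ 0#)

  neg-* : ∀ x y → - x * y ≈ ε * (x * y)
  neg-* x y = trans (sym (-‿distribˡ-* x y)) (sym (-1*x≈-x _))

  -- Vieta's formulas. Having `i + m` equal to the length lets both recursions step without
  -- truncated subtraction.
  rootCoeff-elementary : ∀ xs {i m} → i ℕ.+ m ≡ length xs → rootCoeff xs i ≈ -1^ m * elementary m xs
  rootCoeff-elementary []       {zero}  {zero}  _  = sym (*-identityˡ 1#)
  rootCoeff-elementary (x ∷ xs) {zero}  {suc m} eq = begin
    - x * rootCoeff xs 0
      ≈⟨ *-congˡ (rootCoeff-elementary xs (ℕ.suc-injective eq)) ⟩
    - x * (-1^ m * elementary m xs)
      ≈⟨ neg-* _ _ ⟩
    ε * (x * (-1^ m * elementary m xs))
      ≈⟨ *-congˡ (swap-factors _ _ _) ⟩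
    ε * (-1^ m * (x * elementary m xs))
      ≈⟨ *-assoc _ _ _ ⟨
    -1^ suc m * (x * elementary m xs)
      ≈⟨ *-congˡ (+-identityʳ _) ⟨
    -1^ suc m * (x * elementary m xs + 0#)
      ≈⟨ *-congˡ (+-congˡ (elementary-beyond xs (ℕ.≤-reflexive (≡.sym eq)))) ⟨
    -1^ suc m * elementary (suc m) (x ∷ xs) ∎
  rootCoeff-elementary (x ∷ xs) {suc i} {zero}  eq = begin
    rootCoeff xs i + - x * rootCoeff xs (suc i)
      ≈⟨ +-cong (rootCoeff-elementary xs (ℕ.suc-injective eq))
                (*-congˡ (rootCoeff-beyond xs (s≤s (ℕ.≤-reflexive (≡.sym (≡.trans (≡.sym (ℕ.+-identityʳ i)) (ℕ.suc-injective eq))))))) ⟩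
    1# * 1# + - x * 0#
      ≈⟨ +-congˡ (zeroʳ _) ⟩
    1# * 1# + 0#
      ≈⟨ +-identityʳ _ ⟩
    1# * 1# ∎
  rootCoeff-elementary (x ∷ xs) {suc i} {suc m} eq = begin
    rootCoeff xs i + - x * rootCoeff xs (suc i)
      ≈⟨ +-cong (rootCoeff-elementary xs (ℕ.suc-injective eq))
                (*-congˡ (rootCoeff-elementary xs (≡.trans (≡.sym (ℕ.+-suc i m)) (ℕ.suc-injective eq)))) ⟩
    -1^ suc m * elementary (suc m) xs + - x * (-1^ m * elementary m xs)
      ≈⟨ +-comm _ _ ⟩
    - x * (-1^ m * elementary m xs) + -1^ suc m * elementary (suc m) xs
      ≈⟨ +-congʳ (trans (neg-* _ _) (trans (*-congˡ (swap-factors _ _ _)) (sym (*-assoc _ _ _)))) ⟩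
    -1^ suc m * (x * elementary m xs) + -1^ suc m * elementary (suc m) xs
      ≈⟨ distribˡ _ _ _ ⟨
    -1^ suc m * elementary (suc m) (x ∷ xs) ∎

  -- Replacing t by -t turns each factor t + α i into -(t - α i): the k factors give -1^ k and the
  -- power t^y gives -1^ y. This is where the antisymmetry of the parameters turns leg constants
  -- into arm constants.
  rootCoeff-neg : ∀ (α b : ℕ → Carrier) → (∀ i → b i ≈ - α i) → ∀ k y →
    rootCoeff (applyUpTo b k) y ≈ -1^ k * (-1^ y * rootCoeff (applyUpTo α k) y)
  rootCoeff-neg α b b≈-α zero    zero    = sym (trans (*-identityˡ _) (*-identityˡ _))
  rootCoeff-neg α b b≈-α zero    (suc y) = sym (trans (*-congˡ (zeroʳ _)) (zeroʳ _))
  rootCoeff-neg α b b≈-α (suc k) y = step y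
    where
    r = rootCoeff (applyUpTo (α ∘ suc) k)
    IH = rootCoeff-neg (α ∘ suc) (b ∘ suc) (b≈-α ∘ suc) k

    -b₀ : - b 0 ≈ ε * - α 0
    -b₀ = trans (-‿cong (b≈-α 0)) (sym (-1*x≈-x _))

    step : ∀ y → rootCoeff (applyUpTo b (suc k)) y ≈ -1^ suc k * (-1^ y * rootCoeff (applyUpTo α (suc k)) y)
    step zero = trans (*-cong -b₀ (IH 0))
      (solve 4 (λ e a x r → (e ⊕ a) ⊕ (x ⊕ r) ⊜ (e ⊕ x) ⊕ (a ⊕ r)) refl ε (- α 0) (-1^ k) (1# * r 0)
        ⟨ trans ⟩ *-congˡ (swap-factors _ _ _))
    step (suc y) = begin
      _ ≈⟨ +-cong (IH y) (*-cong -b₀ (IH (suc y))) ⟩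
      -1^ k * (-1^ y * r y) + (ε * - α 0) * (-1^ k * ((ε * -1^ y) * r (suc y)))
        ≈⟨ +-cong (trans (sym (*-identityˡ _)) (*-congʳ (sym ε²)))
                  (solve 5 (λ e a x y r → (e ⊕ a) ⊕ (x ⊕ ((e ⊕ y) ⊕ r)) ⊜ (e ⊕ x) ⊕ ((e ⊕ y) ⊕ (a ⊕ r))) refl
                     ε (- α 0) (-1^ k) (-1^ y) (r (suc y))) ⟩
      (ε * ε) * (-1^ k * (-1^ y * r y)) + (ε * -1^ k) * ((ε * -1^ y) * (- α 0 * r (suc y)))
        ≈⟨ +-congʳ (solve 4 (λ e x y r → (e ⊕ e) ⊕ (x ⊕ (y ⊕ r)) ⊜ (e ⊕ x) ⊕ ((e ⊕ y) ⊕ r)) refl ε (-1^ k) (-1^ y) (r y)) ⟩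
      (ε * -1^ k) * ((ε * -1^ y) * r y) + (ε * -1^ k) * ((ε * -1^ y) * (- α 0 * r (suc y)))
        ≈⟨ trans (*-congˡ (distribˡ _ _ _)) (distribˡ _ _ _) ⟨
      _ ∎

  Det-scale-rows : ∀ {d} (q : Vec ℕ d) (M : Fin d → Fin d → Carrier) →
    Det (λ i j → -1^ lookup q i * M i j) ≈ sign q * Det M
  Det-scale-rows []       M = trans (Det-zero _) (sym (trans (*-congˡ (Det-zero _)) (*-identityˡ 1#)))
  Det-scale-rows (q ∷ qs) M = begin
    _ ≈⟨ Det-suc _ ⟩
    _ ≈⟨ ∑-cong (λ j → *-congˡ (*-congˡ (Det-scale-rows qs λ k l → M (suc k) (punchIn j l)))) ⟩
    _ ≈⟨ ∑-cong (λ j → solve 5 (λ x y m s d → x ⊕ ((y ⊕ m) ⊕ (s ⊕ d)) ⊜ (y ⊕ s) ⊕ (x ⊕ (m ⊕ d))) refl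
           (-1^ toℕ j) (-1^ q) (M zero j) (sign qs) (Det λ k l → M (suc k) (punchIn j l))) ⟩
    (∑ λ j → sign (q ∷ qs) * (-1^ toℕ j * (M zero j * Det λ k l → M (suc k) (punchIn j l))))
      ≈⟨ *-∑ _ _ ⟨
    sign (q ∷ qs) * (∑ λ j → -1^ toℕ j * (M zero j * Det λ k l → M (suc k) (punchIn j l)))
      ≈⟨ *-congˡ (Det-suc M) ⟨
    sign (q ∷ qs) * Det M ∎

  Det-scale-columns : ∀ {d} (q : Vec ℕ d) (M : Fin d → Fin d → Carrier) →
    Det (λ i j → -1^ lookup q j * M i j) ≈ sign q * Det M
  Det-scale-columns q M = trans (sym (Det-transpose _))
    (trans (Det-scale-rows q λ i j → M j i) (*-congˡ (Det-transpose M)))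

  sign² : ∀ {d} (q : Vec ℕ d) → sign q * sign q ≈ 1#
  sign² []       = *-identityˡ 1#
  sign² (q ∷ qs) = trans
    (solve 2 (λ x s → (x ⊕ s) ⊕ (x ⊕ s) ⊜ (x ⊕ x) ⊕ (s ⊕ s)) refl (-1^ q) (sign qs))
    (trans (*-cong (-1^-square q) (sign² qs)) (*-identityˡ 1#))

  coefficientDet : ∀ {d} → (ℕ → Carrier) → Vec ℕ d → Vec ℕ d → Carrier
  coefficientDet α p p′ = Det λ i j → rootCoeff (applyUpTo α (lookup p i)) (lookup p′ j)

  -- For k ≥ i ≥ l monotonicity gives p_k ≤ p_i < p′_i ≤ p′_l, so these entries ask for a
  -- coefficient above the degree and form the block of `Det-zero-block`.
  coefficientDet-vanishes : ∀ {d} α {p p′ : Vec ℕ d} → StrictlyDecreasing p → StrictlyDecreasing p′ →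
    ∀ i → lookup p i < lookup p′ i → coefficientDet α p p′ ≈ 0#
  coefficientDet-vanishes α {p} {p′} dp dp′ i p<p′ = Det-zero-block _ i λ k l i≤k l≤i →
    rootCoeff-beyond (applyUpTo α (lookup p k)) (≡.subst (_< lookup p′ l) (≡.sym (List.length-applyUpTo α (lookup p k)))
      (ℕ.≤-<-trans (lookup-antitone dp i≤k) (ℕ.<-≤-trans p<p′ (lookup-antitone dp′ l≤i))))

-- Coordinates of the rows and the expansion of the determinant.

module FrobeniusExpansion {c ℓ} (R : CommutativeRing c ℓ)
  (h : ℕ → CommutativeRing.Carrier R)
  (h₀ : CommutativeRing._≈_ R (h 0) (CommutativeRing.1# R)) where

  open CommutativeRing R hiding (zero)
  open RingOperations R using (-1^_)
  open Polynomials R public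
  open import Relation.Binary.Reasoning.Setoid setoid

  -- `delay y h` is the row of h_{l-y}, that is, the case b = 0 of `legRow`.
  delay : ℕ → (ℕ → Carrier) → ℕ → Carrier
  delay zero    ψ l       = ψ l
  delay (suc y) ψ zero    = 0#
  delay (suc y) ψ (suc l) = delay y ψ l

  delay-diagonal : ∀ k → delay k h k ≈ 1#
  delay-diagonal zero    = h₀
  delay-diagonal (suc k) = delay-diagonal k

  delay-low : ∀ {k j} → j < k → delay k h j ≈ 0#
  delay-low {suc k} {zero}  _       = refl
  delay-low {suc k} {suc j} (s≤s p) = delay-low p

  -- The row of h_{j-k;τ^{-j}a}, where b i stands for a_{-i}.
  legRow : (ℕ → Carrier) → ℕ → ℕ → Carrier
  legRow b zero    zero    = h 0
  legRow b zero    (suc j) = umbral (applyDownFrom (b ∘ suc) j) (h ∘ suc)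
  legRow b (suc k) zero    = 0#
  legRow b (suc k) (suc j) = legRow (b ∘ suc) k j

  legRow-diagonal : ∀ b k → legRow b k k ≈ 1#
  legRow-diagonal b zero    = h₀
  legRow-diagonal b (suc k) = legRow-diagonal (b ∘ suc) k

  legRow-low : ∀ b {k j} → j < k → legRow b k j ≈ 0#
  legRow-low b {suc k} {zero}  _       = refl
  legRow-low b {suc k} {suc j} (s≤s p) = legRow-low (b ∘ suc) p

  -- The row of h_{p+1+j;τ^{-j}a}, where α i stands for a_{i+1}.
  armRow : (α b : ℕ → Carrier) → ℕ → ℕ → Carrier
  armRow α b p j = umbral (applyDownFrom b j ++ applyUpTo α p) (h ∘ suc)

  -- As power series in 1/t, t^{-y} is a combination of the t/((t - b 0)⋯(t - b k));
  -- multiplying by (t - b 0)⋯(t - b (j - 1)) gives this identity.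
  umbral-delay : ∀ b y {j n} → j < n →
    umbral (applyDownFrom b j) (delay y h) ≈ Σ< n λ k → rootCoeff (applyUpTo b k) y * legRow b k j
  umbral-delay b zero    {zero}  {suc n} _ = sym (trans (∑-suc _)
    (trans (+-cong (*-identityˡ _) (∑-0 λ k → zeroʳ _)) (+-identityʳ _)))
  umbral-delay b (suc y) {zero}  {suc n} _ = sym (trans (∑-suc _)
    (trans (+-cong (zeroˡ _) (∑-0 λ k → zeroʳ _)) (+-identityʳ _)))
  umbral-delay b y {suc j} {suc n} (s≤s j<n) = begin
    umbral (applyDownFrom b (suc j)) (delay y h)
      ≈⟨ reflexive (≡.cong (λ ys → umbral ys (delay y h)) (≡.sym (List.applyDownFrom-∷ʳ b j))) ⟩
    umbral (xs ∷ʳ b 0) (delay y h)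
      ≈⟨ umbral-++ xs (b 0 ∷ []) (delay y h) ⟩
    umbral xs (λ l → delay y h (l ℕ.+ 1)) + - b 0 * umbral xs (λ l → delay y h (l ℕ.+ 0))
      ≈⟨ +-cong (umbral-cong xs λ l _ → reflexive (≡.cong (delay y h) (ℕ.+-comm l 1)))
                (*-congˡ (trans (umbral-cong xs λ l _ → reflexive (≡.cong (delay y h) (ℕ.+-identityʳ l)))
                                (umbral-delay (b ∘ suc) y j<n))) ⟩
    umbral xs (delay y h ∘ suc) + - b 0 * (Σ< n λ k → r k y * L k)
      ≈⟨ step y ⟩
    (Σ< (suc n) λ k → rootCoeff (applyUpTo b k) y * legRow b k (suc j)) ∎
    where
    xs = applyDownFrom (b ∘ suc) j

    r : ℕ → ℕ → Carrier
    r k = rootCoeff (applyUpTo (b ∘ suc) k)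

    L : ℕ → Carrier
    L k = legRow (b ∘ suc) k j

    step : ∀ y → umbral xs (delay y h ∘ suc) + - b 0 * (Σ< n λ k → r k y * L k) ≈
                 Σ< (suc n) λ k → rootCoeff (applyUpTo b k) y * legRow b k (suc j)
    step zero    = sym (trans (∑-suc _) (+-cong (*-identityˡ _)
      (trans (∑-cong λ k → *-assoc _ _ _) (sym (*-∑ _ _)))))
    step (suc y) = begin
      umbral xs (delay y h) + - b 0 * (Σ< n λ k → r k (suc y) * L k)
        ≈⟨ +-cong (umbral-delay (b ∘ suc) y j<n) (*-∑ _ _) ⟩
      (Σ< n λ k → r k y * L k) + (Σ< n λ k → - b 0 * (r k (suc y) * L k))
        ≈⟨ ∑-+ _ _ ⟨
      (Σ< n λ k → r k y * L k + - b 0 * (r k (suc y) * L k))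
        ≈⟨ ∑-cong (λ k → trans (distribʳ _ _ _) (+-congˡ (*-assoc _ _ _))) ⟨
      (Σ< n λ k → (r k y + - b 0 * r k (suc y)) * L k)
        ≈⟨ trans (∑-suc _) (trans (+-congʳ (zeroˡ _)) (+-identityˡ _)) ⟨
      (Σ< (suc n) λ k → rootCoeff (applyUpTo b k) (suc y) * legRow b k (suc j)) ∎

  -- Coordinates with respect to the unitriangular family of rows delay y h.
  coordinate : (ℕ → Carrier) → ℕ → Carrier
  coordinate v zero    = v 0
  coordinate v (suc y) = coordinate (λ l → v (suc l) + - v 0 * h (suc l)) y

  coordinate-correct : ∀ v {l n} → l < n → v l ≈ Σ< n λ y → coordinate v y * delay y h l
  coordinate-correct v {zero}  {suc n} _         = sym (trans (∑-suc _) (trans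
    (+-cong (trans (*-congˡ h₀) (*-identityʳ _)) (∑-0 λ y → zeroʳ _)) (+-identityʳ _)))
  coordinate-correct v {suc l} {suc n} (s≤s l<n) = sym (trans (∑-suc _) (begin
    v 0 * h (suc l) + (Σ< n λ y → coordinate v′ y * delay y h l)
      ≈⟨ +-congˡ (coordinate-correct v′ l<n) ⟨
    v 0 * h (suc l) + (v (suc l) + - v 0 * h (suc l))
      ≈⟨ +-congˡ (trans (+-comm _ _) (+-congʳ (neg-* _ _))) ⟩
    v 0 * h (suc l) + (ε * (v 0 * h (suc l)) + v (suc l))
      ≈⟨ +-assoc _ _ _ ⟨
    (v 0 * h (suc l) + ε * (v 0 * h (suc l))) + v (suc l)
      ≈⟨ trans (+-congʳ (ε-cancel _)) (+-identityˡ _) ⟩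
    v (suc l) ∎))
    where
    v′ : ℕ → Carrier
    v′ l = v (suc l) + - v 0 * h (suc l)

  -- These are the X⁰ of the overview. By `giambelli` with d = 1, the entry at (p, y) is, for the
  -- complete functions, (-1)^y times the hook Schur function of (p ∣ y).
  armCoordinate : ℕ → ℕ → Carrier
  armCoordinate p = coordinate λ l → h (suc (l ℕ.+ p))

  module _ (α b : ℕ → Carrier) where

    -- Kept as a triple matrix product because Cauchy-Binet applies to that form. The numbers m and
    -- n are cut-offs: m > p retains the whole polynomial, and n bounds the columns in use.
    armCoordinateₐ : (m n p k : ℕ) → Carrier
    armCoordinateₐ m n p k = Σ< m λ p′ → rootCoeff (applyUpTo α p) p′ *
      (Σ< n λ y → armCoordinate p′ y * rootCoeff (applyUpTo b k) y)

    -- The factors with b belong to the column and those with α to the row. The row factors are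
    -- expanded into powers t^{p′}, and the row of h_{l+p′+1} is written in the rows `delay y h`;
    -- the column factors then convert these into `legRow`. Linearity of `umbral` makes the
    -- coefficients independent of j.
    armRow-coordinates : ∀ {m n p j} → p < m → j < n →
      armRow α b p j ≈ Σ< n λ k → armCoordinateₐ m n p k * legRow b k j
    armRow-coordinates {m} {n} {p} {j} p<m j<n = begin
      armRow α b p j
        ≈⟨ umbral-++ bs (applyUpTo α p) (h ∘ suc) ⟩
      umbral (applyUpTo α p) (λ p′ → umbral bs (λ l → h (suc (l ℕ.+ p′))))
        ≈⟨ umbral-rootCoeff (applyUpTo α p) {m} _ (≡.subst (_< m) (≡.sym (List.length-applyUpTo α p)) p<m) ⟩
      (Σ< m λ p′ → A p′ * umbral bs (λ l → h (suc (l ℕ.+ p′))))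
        ≈⟨ ∑-cong (λ p′ → *-congˡ (inner (toℕ p′))) ⟩
      (Σ< m λ p′ → A p′ * (Σ< n λ k → B p′ k * legRow b k j))
        ≈⟨ ∑-cong (λ p′ → trans (*-∑ _ _) (∑-cong λ k → sym (*-assoc _ _ _))) ⟩
      (Σ< m λ p′ → Σ< n λ k → (A p′ * B p′ k) * legRow b k j)
        ≈⟨ ∑-swap _ ⟩
      (Σ< n λ k → Σ< m λ p′ → (A p′ * B p′ k) * legRow b k j)
        ≈⟨ ∑-cong (λ k → ∑-* (λ p′ → A (toℕ p′) * B (toℕ p′) (toℕ k)) (legRow b (toℕ k) j)) ⟨
      (Σ< n λ k → armCoordinateₐ m n p k * legRow b k j) ∎
      where
      bs = applyDownFrom b j

      A : ℕ → Carrier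
      A = rootCoeff (applyUpTo α p)

      B : ℕ → ℕ → Carrier
      B p′ k = Σ< n λ y → armCoordinate p′ y * rootCoeff (applyUpTo b k) y

      ∑-* : ∀ {m} (f : Fin m → Carrier) x → ∑ f * x ≈ ∑ λ i → f i * x
      ∑-* f x = trans (*-comm _ _) (trans (*-∑ _ _) (∑-cong λ i → *-comm _ _))

      inner : ∀ p′ → umbral bs (λ l → h (suc (l ℕ.+ p′))) ≈ Σ< n λ k → B p′ k * legRow b k j
      inner p′ = begin
        umbral bs (λ l → h (suc (l ℕ.+ p′)))
          ≈⟨ umbral-cong bs (λ l l≤ → coordinate-correct (λ l → h (suc (l ℕ.+ p′)))
               (ℕ.≤-<-trans (≡.subst (l ≤_) (List.length-applyDownFrom b j) l≤) j<n)) ⟩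
        umbral bs (λ l → Σ< n λ y → armCoordinate p′ y * delay y h l)
          ≈⟨ umbral-∑ bs (λ y → armCoordinate p′ (toℕ y)) (λ y → delay (toℕ y) h) ⟩
        (Σ< n λ y → armCoordinate p′ y * umbral bs (delay y h))
          ≈⟨ ∑-cong (λ y → *-congˡ (umbral-delay b (toℕ y) j<n)) ⟩
        (Σ< n λ y → armCoordinate p′ y * (Σ< n λ k → rootCoeff (applyUpTo b k) y * legRow b k j))
          ≈⟨ ∑-cong (λ y → trans (*-∑ _ _) (∑-cong λ k → sym (*-assoc _ _ _))) ⟩
        (Σ< n λ y → Σ< n λ k → (armCoordinate p′ y * rootCoeff (applyUpTo b k) y) * legRow b k j)
          ≈⟨ ∑-swap _ ⟩
        (Σ< n λ k → Σ< n λ y → (armCoordinate p′ y * rootCoeff (applyUpTo b k) y) * legRow b k j)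
          ≈⟨ ∑-cong (λ k → ∑-* _ _) ⟨
        (Σ< n λ k → B p′ k * legRow b k j) ∎

  Schur : ∀ {d} → ℕ → Vec ℕ d → Vec ℕ d → Carrier
  Schur n p q = Det {n} λ i j →
    hookRow (λ r l → h (suc (l ℕ.+ lookup p r))) (λ y → delay y h) q (toℕ i) (toℕ j)

  Schurₐ : ∀ {d} → (α b : ℕ → Carrier) → ℕ → Vec ℕ d → Vec ℕ d → Carrier
  Schurₐ α b n p q = Det {n} λ i j →
    hookRow (λ r → armRow α b (lookup p r)) (legRow b) q (toℕ i) (toℕ j)

  -- The signs cancel: `giambelli` contributes sign q, the leg determinant contributes sign q and
  -- sign q′, and `giambelli` read backwards for the unshifted rows absorbs sign q′.
  Schurₐ-expansion : ∀ {d} α b → (∀ i → b i ≈ - α i) → ∀ {m n} {p q : Vec ℕ d} →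
    StrictlyDecreasing (m ∷ p) → StrictlyDecreasing (n ∷ q) →
    Schurₐ α b n p q ≈ ∑ˢ d m λ p′ → ∑ˢ d n λ q′ →
      (coefficientDet α p p′ * coefficientDet α q q′) * Schur n p′ q′
  Schurₐ-expansion {d} α b b≈-α {m} {n} {p} {q} sp sq = begin
    Schurₐ α b n p q
      ≈⟨ giambelli n (legRow b) (legRow-diagonal b) (legRow-low b) _
           (λ i → armCoordinateₐ α b m n (lookup p i)) (λ i j j<n → armRow-coordinates α b (lookup< sp i) j<n) q sq ⟩
    sign q * Det (λ i j → armCoordinateₐ α b m n (lookup p i) (lookup q j))
      ≈⟨ *-congˡ (cauchy-binet m (λ i → rootCoeff (applyUpTo α (lookup p i)))
           (λ p′ j → Σ< n λ y → armCoordinate p′ y * rootCoeff (applyUpTo b (lookup q j)) y)) ⟩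
    sign q * (∑ˢ d m λ p′ → C p p′ * Det (λ i j → Σ< n λ y → armCoordinate (lookup p′ i) y * rootCoeff (applyUpTo b (lookup q j)) y))
      ≈⟨ *-congˡ (∑ˢ-cong d m λ p′ _ → *-congˡ (cauchy-binet n (λ i → armCoordinate (lookup p′ i))
           (λ y j → rootCoeff (applyUpTo b (lookup q j)) y))) ⟩
    sign q * (∑ˢ d m λ p′ → C p p′ * (∑ˢ d n λ q′ → X p′ q′ * Det λ i j → rootCoeff (applyUpTo b (lookup q j)) (lookup q′ i)))
      ≈⟨ *-congˡ (∑ˢ-cong d m λ p′ _ → *-∑ˢ d n _ _) ⟩
    _ ≈⟨ *-∑ˢ d m _ _ ⟩
    _ ≈⟨ ∑ˢ-cong d m (λ p′ _ → *-∑ˢ d n _ _) ⟩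
    (∑ˢ d m λ p′ → ∑ˢ d n λ q′ → sign q * (C p p′ * (X p′ q′ * Det λ i j → rootCoeff (applyUpTo b (lookup q j)) (lookup q′ i))))
      ≈⟨ ∑ˢ-cong d m (λ p′ _ → ∑ˢ-cong d n λ q′ sq′ → term p′ q′ sq′) ⟩
    (∑ˢ d m λ p′ → ∑ˢ d n λ q′ → (C p p′ * C q q′) * Schur n p′ q′) ∎
    where
    C : Vec ℕ d → Vec ℕ d → Carrier
    C = coefficientDet α

    X : Vec ℕ d → Vec ℕ d → Carrier
    X p′ q′ = Det λ i j → armCoordinate (lookup p′ i) (lookup q′ j)

    legs-det : ∀ q′ → Det (λ i j → rootCoeff (applyUpTo b (lookup q j)) (lookup q′ i)) ≈ sign q * (sign q′ * C q q′)
    legs-det q′ = begin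
      Det (λ i j → rootCoeff (applyUpTo b (lookup q j)) (lookup q′ i))
        ≈⟨ Det-transpose (λ i j → rootCoeff (applyUpTo b (lookup q i)) (lookup q′ j)) ⟩
      Det (λ i j → rootCoeff (applyUpTo b (lookup q i)) (lookup q′ j))
        ≈⟨ Det-cong (λ i j → rootCoeff-neg α b b≈-α (lookup q i) (lookup q′ j)) ⟩
      Det (λ i j → -1^ lookup q i * (-1^ lookup q′ j * rootCoeff (applyUpTo α (lookup q i)) (lookup q′ j)))
        ≈⟨ Det-scale-rows q _ ⟩
      sign q * Det (λ i j → -1^ lookup q′ j * rootCoeff (applyUpTo α (lookup q i)) (lookup q′ j))
        ≈⟨ *-congˡ (Det-scale-columns q′ _) ⟩
      sign q * (sign q′ * C q q′) ∎

    term : ∀ p′ q′ → StrictlyDecreasing (n ∷ q′) →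
      sign q * (C p p′ * (X p′ q′ * Det λ i j → rootCoeff (applyUpTo b (lookup q j)) (lookup q′ i))) ≈
      (C p p′ * C q q′) * Schur n p′ q′
    term p′ q′ sq′ = begin
      _ ≈⟨ *-congˡ (*-congˡ (*-congˡ (legs-det q′))) ⟩
      sign q * (C p p′ * (X p′ q′ * (sign q * (sign q′ * C q q′))))
        ≈⟨ solve 5 (λ s a x s′ c → s ⊕ (a ⊕ (x ⊕ (s ⊕ (s′ ⊕ c)))) ⊜ (s ⊕ s) ⊕ ((a ⊕ c) ⊕ (s′ ⊕ x))) refl
             (sign q) (C p p′) (X p′ q′) (sign q′) (C q q′) ⟩
      (sign q * sign q) * ((C p p′ * C q q′) * (sign q′ * X p′ q′))
        ≈⟨ trans (*-congʳ (sign² q)) (*-identityˡ _) ⟩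
      (C p p′ * C q q′) * (sign q′ * X p′ q′)
        ≈⟨ *-congˡ (giambelli n (λ y → delay y h) delay-diagonal delay-low _
             (λ i → armCoordinate (lookup p′ i)) (λ i j j<n → coordinate-correct (λ l → h (suc (l ℕ.+ lookup p′ i))) j<n) q′ sq′) ⟨
      (C p p′ * C q q′) * Schur n p′ q′ ∎

-- Diagrams as nested hooks.

padded-length : ∀ {q} rs → length rs ≤ q → length (List.map suc rs ++ replicate (q ∸ length rs) 1) ≡ q
padded-length []       z≤n     = List.length-replicate _
padded-length (_ ∷ rs) (s≤s h) = ≡.cong suc (padded-length rs h)

hooks-length≤ : ∀ {d n} (p : Vec ℕ d) {q} → StrictlyDecreasing (n ∷ q) → length (hooks p q) ≤ n
hooks-length≤ []      {[]}    _         = z≤n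
hooks-length≤ (_ ∷ p) {q ∷ _} (n>q ∷ s) = ≡.subst (_< _) (≡.sym (padded-length (hooks p _) (hooks-length≤ p s))) n>q

rowOf-beyond : ∀ rs {i} → length rs ≤ i → rowOf rs i ≡ 0
rowOf-beyond []       _       = ≡.refl
rowOf-beyond (_ ∷ rs) (s≤s h) = rowOf-beyond rs h

padded-row : ∀ {q} rs {i} → length rs ≤ q → i < q →
             rowOf (List.map suc rs ++ replicate (q ∸ length rs) 1) i ≡ suc (rowOf rs i)
padded-row {suc q} []       {zero}  _       _         = ≡.refl
padded-row {suc q} []       {suc i} _       (s≤s i<q) = padded-row {q} [] z≤n i<q
padded-row {suc q} (r ∷ rs) {zero}  _       _         = ≡.refl
padded-row {suc q} (r ∷ rs) {suc i} (s≤s h) (s≤s i<q) = padded-row rs h i<q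

suc-suc : ∀ m n → + suc m ℤ.- + suc n ≡ + m ℤ.- + n
suc-suc m n = ≡.trans (ℤ.[1+m]⊖[1+n]≡m⊖n m n) (≡.sym (ℤ.m-n≡m⊖n m n))

-- Enclosing a diagram in a hook moves row i < q to row i + 1 and adds one box to it, so row length
-- minus index is preserved. The rows from q + 1 on are empty.
hooks-row : ∀ {d n} (p : Vec ℕ d) {q} → StrictlyDecreasing (n ∷ q) → ∀ i →
  + rowOf (hooks p q) i ℤ.- + i ≡ hookRow (λ r → + suc (lookup p r)) (λ k → ℤ.- + k) q i
hooks-row []       {[]}     _       i       = ℤ.+-identityˡ (ℤ.- + i)
hooks-row (p ∷ ps) {q ∷ qs} _       zero    = ℤ.+-identityʳ (+ suc p)
hooks-row (p ∷ ps) {q ∷ qs} (_ ∷ s) (suc i) with i ℕ.<? q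
... | yes i<q = ≡.trans (≡.cong (λ r → + r ℤ.- + suc i) (padded-row (hooks ps qs) (hooks-length≤ ps s) i<q))
               (≡.trans (suc-suc (rowOf (hooks ps qs) i) i)
               (≡.trans (hooks-row ps s i) (≡.sym (hookRow-inside (λ r → + suc (lookup (p ∷ ps) r)) _ qs i<q))))
... | no  i≮q = ≡.trans (≡.cong (λ r → + r ℤ.- + suc i) (rowOf-beyond (List.map suc (hooks ps qs) ++ replicate (q ∸ length (hooks ps qs)) 1)
                  (≡.subst (_≤ i) (≡.sym (padded-length (hooks ps qs) (hooks-length≤ ps s))) (ℕ.≮⇒≥ i≮q))))
               (≡.trans (ℤ.+-identityˡ (ℤ.- + suc i)) (≡.sym (hookRow-outside (λ r → + suc (lookup (p ∷ ps) r)) _ qs (ℕ.≮⇒≥ i≮q))))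

-- The rows of a diagram after removal of its first column.
strip : List ℕ → List ℕ
strip []                 = []
strip (zero ∷ rs)        = []
strip (suc zero ∷ rs)    = []
strip (suc (suc r) ∷ rs) = suc r ∷ strip rs

strip-length : ∀ rs → length (strip rs) ≤ length rs
strip-length []                 = z≤n
strip-length (zero ∷ rs)        = z≤n
strip-length (suc zero ∷ rs)    = z≤n
strip-length (suc (suc r) ∷ rs) = s≤s (strip-length rs)

strip-positive : ∀ rs → All (0 <_) (strip rs)
strip-positive []                 = []
strip-positive (zero ∷ rs)        = []
strip-positive (suc zero ∷ rs)    = []
strip-positive (suc (suc r) ∷ rs) = z<s ∷ strip-positive rs

strip-decreasing : ∀ {rs} → LLinked.Linked _≥_ rs → LLinked.Linked _≥_ (strip rs)
strip-decreasing {[]}                             _         = []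
strip-decreasing {zero ∷ rs}                      _         = []
strip-decreasing {suc zero ∷ rs}                  _         = []
strip-decreasing {suc (suc r) ∷ []}               _         = [-]
strip-decreasing {suc (suc r) ∷ zero ∷ rs}        _         = [-]
strip-decreasing {suc (suc r) ∷ suc zero ∷ rs}    _         = [-]
strip-decreasing {suc (suc r) ∷ suc (suc s) ∷ rs} (h ∷ dec) = ℕ.≤-pred h ∷ strip-decreasing dec

ones : ∀ {rs} → LLinked.Linked _≥_ (1 ∷ rs) → All (0 <_) rs → rs ≡ replicate (length rs) 1
ones {[]}               _         _         = ≡.refl
ones {zero ∷ rs}        _         (() ∷ _)
ones {suc zero ∷ rs}    (_ ∷ dec) (_ ∷ pos) = ≡.cong (1 ∷_) (ones dec pos)
ones {suc (suc r) ∷ rs} (s≤s () ∷ _) _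

strip-padded : ∀ {rs} → LLinked.Linked _≥_ rs → All (0 <_) rs →
               rs ≡ List.map suc (strip rs) ++ replicate (length rs ∸ length (strip rs)) 1
strip-padded {[]}               _   _         = ≡.refl
strip-padded {zero ∷ rs}        _   (() ∷ _)
strip-padded {suc zero ∷ rs}    dec (_ ∷ pos) = ≡.cong (1 ∷_) (ones dec pos)
strip-padded {suc (suc r) ∷ rs} dec (_ ∷ pos) = ≡.cong (suc (suc r) ∷_) (strip-padded (LLinked.tail dec) pos)

strip-row₀ : ∀ {r rs} → LLinked.Linked _≥_ (suc r ∷ rs) → rowOf (strip rs) 0 ≤ r
strip-row₀ {rs = []}               _             = z≤n
strip-row₀ {rs = zero ∷ rs}        _             = z≤n
strip-row₀ {rs = suc zero ∷ rs}    _             = z≤n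
strip-row₀ {rs = suc (suc s) ∷ rs} (s≤s s≤r ∷ _) = s≤r

-- Peel off the outermost hook: its arm is read off the first row, its leg is the number of further
-- rows, and `strip` leaves what it encloses. The number n serves only for termination, as a
-- stripped list is no sublist of the original.
hooks-surjective : ∀ n rs → length rs ≤ n → LLinked.Linked _≥_ rs → All (0 <_) rs →
  Σ[ d ∈ ℕ ] Σ[ p ∈ Strict d ] Σ[ q ∈ Strict d ] rs ≡ hooks (proj₁ p) (proj₁ q)
hooks-surjective n       []            _         _   _         = 0 , ([] , []) , ([] , []) , ≡.refl
hooks-surjective (suc n) (zero ∷ rs)   _         _   (() ∷ _)
hooks-surjective (suc n) (suc r ∷ rs)  (s≤s len) dec (_ ∷ pos)
  with hooks-surjective n (strip rs) (ℕ.≤-trans (strip-length rs) len)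
         (strip-decreasing (LLinked.tail dec)) (strip-positive rs)
... | d , (p , dp) , (q , dq) , eq =
  suc d , (r ∷ p , cons-arms p q dp (≡.subst (λ rs → rowOf rs 0 ≤ r) eq (strip-row₀ dec)))
        , (length rs ∷ q , cons-legs p q dq (≡.subst (λ rs′ → length rs′ ≤ length rs) eq (strip-length rs)))
        , ≡.cong (suc r ∷_) (≡.trans (strip-padded (LLinked.tail dec) pos)
            (≡.cong (λ rs′ → List.map suc rs′ ++ replicate (length rs ∸ length rs′) 1) eq))
  where
  cons-arms : ∀ {d r} (p q : Vec ℕ d) → StrictlyDecreasing p → rowOf (hooks p q) 0 ≤ r → StrictlyDecreasing (r ∷ p)
  cons-arms []      []      _  _ = [-]
  cons-arms (_ ∷ _) (_ ∷ _) dp h = h ∷ dp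

  cons-legs : ∀ {d l} (p q : Vec ℕ d) → StrictlyDecreasing q → length (hooks p q) ≤ l → StrictlyDecreasing (l ∷ q)
  cons-legs []      []      _  _ = [-]
  cons-legs (_ ∷ p) (q ∷ qs) dq h =
    ≡.subst (_< _) (padded-length (hooks p qs) (hooks-length≤ p dq)) h ∷ dq

-- For legs this is the number of rows of the diagram and hence a sufficient size for the
-- determinants; for arms it is a cut-off of the sums.
bound : ∀ {d} → Vec ℕ d → ℕ
bound []      = 0
bound (p ∷ _) = suc p

bound-strict : ∀ {d} {p : Vec ℕ d} → StrictlyDecreasing p → StrictlyDecreasing (bound p ∷ p)
bound-strict {p = []}    _ = [-]
bound-strict {p = _ ∷ _} s = ℕ.≤-refl ∷ s

-- Comparison of the sums over `below` with the sums of Cauchy-Binet.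

module BelowSums {c ℓ} (R : CommutativeRing c ℓ) where

  open CommutativeRing R hiding (zero)
  open RingOperations R using () renaming (∑ to ∑ᴸ)
  open CauchyBinet R
  open import Relation.Binary.Reasoning.Setoid setoid

  module _ {x} {X : Set x} where

    ∑ᴸ-cong : ∀ (xs : List X) {f g : X → Carrier} → (∀ x → f x ≈ g x) → ∑ᴸ xs f ≈ ∑ᴸ xs g
    ∑ᴸ-cong []       eq = refl
    ∑ᴸ-cong (x ∷ xs) eq = +-cong (eq x) (∑ᴸ-cong xs eq)

    ∑ᴸ-0 : ∀ (xs : List X) → ∑ᴸ xs (λ _ → 0#) ≈ 0#
    ∑ᴸ-0 []       = refl
    ∑ᴸ-0 (x ∷ xs) = trans (+-identityˡ _) (∑ᴸ-0 xs)

    ∑ᴸ-++ : ∀ (xs ys : List X) f → ∑ᴸ (xs ++ ys) f ≈ ∑ᴸ xs f + ∑ᴸ ys f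
    ∑ᴸ-++ []       ys f = sym (+-identityˡ _)
    ∑ᴸ-++ (x ∷ xs) ys f = trans (+-congˡ (∑ᴸ-++ xs ys f)) (sym (+-assoc _ _ _))

    ∑ᴸ-map : ∀ {y} {Y : Set y} (g : X → Y) xs f → ∑ᴸ (List.map g xs) f ≈ ∑ᴸ xs (f ∘ g)
    ∑ᴸ-map g []       f = refl
    ∑ᴸ-map g (x ∷ xs) f = +-congˡ (∑ᴸ-map g xs f)

    ∑ᴸ-mapMaybe : ∀ {y} {Y : Set y} (g : X → Maybe Y) xs f →
                  ∑ᴸ (mapMaybe g xs) f ≈ ∑ᴸ xs λ x → maybe f 0# (g x)
    ∑ᴸ-mapMaybe g []       f = refl
    ∑ᴸ-mapMaybe g (x ∷ xs) f with g x
    ... | just y  = +-congˡ (∑ᴸ-mapMaybe g xs f)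
    ... | nothing = trans (∑ᴸ-mapMaybe g xs f) (sym (+-identityˡ _))

  ∑ᴸ-cartesianProductWith : ∀ {x y z} {X : Set x} {Y : Set y} {Z : Set z} (g : X → Y → Z) xs ys f →
    ∑ᴸ (cartesianProductWith g xs ys) f ≈ ∑ᴸ xs λ x → ∑ᴸ ys λ y → f (g x y)
  ∑ᴸ-cartesianProductWith g []       ys f = refl
  ∑ᴸ-cartesianProductWith g (x ∷ xs) ys f = trans (∑ᴸ-++ (List.map (g x) ys) _ f)
    (+-cong (∑ᴸ-map (g x) ys f) (∑ᴸ-cartesianProductWith g xs ys f))

  ∑ᴸ-applyUpTo : ∀ {x} {X : Set x} (g : ℕ → X) n f → ∑ᴸ (applyUpTo g n) f ≈ Σ< n (f ∘ g)
  ∑ᴸ-applyUpTo g zero    f = sym (∑-zero _)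
  ∑ᴸ-applyUpTo g (suc n) f = trans (+-congˡ (∑ᴸ-applyUpTo (g ∘ suc) n f)) (sym (∑-suc _))

  infix 5 _⇒_
  _⇒_ : ∀ {p} {P : Set p} → Dec P → Carrier → Carrier
  P? ⇒ x = if does P? then x else 0#

  ∑ˢ-step : ∀ d m (g : Vec ℕ (suc d) → Carrier) → ∑ˢ (suc d) m g ≈ Σ< m λ k → ∑ˢ d k λ v → g (k ∷ v)
  ∑ˢ-step d zero    g = sym (∑-zero _)
  ∑ˢ-step d (suc m) g = trans (+-congˡ (∑ˢ-step d m g)) (sym (Σ<-last m λ k → ∑ˢ d k λ v → g (k ∷ v)))

  -- Here m is the entry preceding the tuple, so that strictness is tested one entry at a time while
  -- the box is unfolded.
  box-sum : ∀ {d} m (p : Vec ℕ d) (g : Vec ℕ d → Carrier) →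
    (∀ v i → lookup p i < lookup v i → StrictlyDecreasing (m ∷ v) → g v ≈ 0#) →
    ∑ᴸ (box p) (λ v → Linked.linked? ℕ._>?_ (m ∷ v) ⇒ g v) ≈ ∑ˢ d m g
  box-sum         m []       g g≈0 = +-identityʳ _
  box-sum {suc d} m (p ∷ ps) g g≈0 = begin
    ∑ᴸ (box (p ∷ ps)) (λ v → Linked.linked? ℕ._>?_ (m ∷ v) ⇒ g v)
      ≈⟨ ∑ᴸ-cartesianProductWith _∷_ (upTo (suc p)) (box ps) _ ⟩
    (∑ᴸ (upTo (suc p)) λ k → ∑ᴸ (box ps) λ v → Linked.linked? ℕ._>?_ (m ∷ k ∷ v) ⇒ g (k ∷ v))
      ≈⟨ ∑ᴸ-cong (upTo (suc p)) inner ⟩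
    ∑ᴸ (upTo (suc p)) T
      ≈⟨ ∑ᴸ-applyUpTo (λ k → k) (suc p) T ⟩
    Σ< (suc p) T
      -- The two ranges are compared through their maximum: indices k > p are killed by the
      -- hypothesis on g, indices k ≥ m by the guard in `T`.
      ≈⟨ Σ<-truncate T (ℕ.m≤m⊔n (suc p) m) T-large ⟨
    Σ< (suc p ℕ.⊔ m) T
      ≈⟨ Σ<-truncate T (ℕ.m≤n⊔m (suc p) m) (λ k m≤k → reflexive (≡.cong (λ t → if t then F k else 0#) (dec-false (k ℕ.<? m) (ℕ.≤⇒≯ m≤k)))) ⟩
    Σ< m T
      ≈⟨ Σ<-cong m (λ k k<m → reflexive (≡.cong (λ t → if t then F k else 0#) (dec-true (k ℕ.<? m) k<m))) ⟩
    Σ< m F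
      ≈⟨ ∑ˢ-step d m g ⟨
    ∑ˢ (suc d) m g ∎
    where
    F T : ℕ → Carrier
    F k = ∑ˢ d k λ v → g (k ∷ v)
    T k = (m ℕ.>? k) ⇒ F k

    T-large : ∀ k → suc p ≤ k → T k ≈ 0#
    T-large k p<k with m ℕ.>? k
    ... | no  m≯k rewrite dec-false (m ℕ.>? k) m≯k = refl
    ... | yes m>k rewrite dec-true (m ℕ.>? k) m>k = trans
      (∑ˢ-cong d k λ v s → g≈0 (k ∷ v) zero p<k (m>k ∷ s)) (∑ˢ-0 d k)
      where
      ∑ˢ-0 : ∀ d m → ∑ˢ d m (λ _ → 0#) ≈ 0#
      ∑ˢ-0 zero    m       = refl
      ∑ˢ-0 (suc d) zero    = refl
      ∑ˢ-0 (suc d) (suc m) = trans (+-cong (∑ˢ-0 d m) (∑ˢ-0 (suc d) m)) (+-identityˡ 0#)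

    inner : ∀ k → (∑ᴸ (box ps) λ v → Linked.linked? ℕ._>?_ (m ∷ k ∷ v) ⇒ g (k ∷ v)) ≈ T k
    inner k with m ℕ.>? k
    ... | no  m≯k rewrite dec-false (m ℕ.>? k) m≯k = ∑ᴸ-0 (box ps)
    ... | yes m>k rewrite dec-true (m ℕ.>? k) m>k =
      box-sum k ps (λ v → g (k ∷ v)) λ v i h s → g≈0 (k ∷ v) (suc i) h (m>k ∷ s)

  -- `below p` bounds every entry by its own p_i, whereas `∑ˢ` bounds only the first one; the
  -- hypothesis says that the additional tuples contribute nothing.
  below-sum : ∀ {d} (p : Vec ℕ d) (g : Vec ℕ d → Carrier) →
    (∀ v i → lookup p i < lookup v i → StrictlyDecreasing v → g v ≈ 0#) →
    ∑ᴸ (below p) (g ∘ proj₁) ≈ ∑ˢ d (bound p) g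
  below-sum {d} p g g≈0 = trans (∑ᴸ-mapMaybe strict? (box p) (g ∘ proj₁))
    (trans (∑ᴸ-cong (box p) strict-term) (sum p g g≈0))
    where
    strict-term : ∀ v → maybe (g ∘ proj₁) 0# (strict? v) ≈ (Linked.linked? ℕ._>?_ v ⇒ g v)
    strict-term v with Linked.linked? ℕ._>?_ v
    ... | yes _ = refl
    ... | no  _ = refl

    sum : ∀ {d} (p : Vec ℕ d) g → (∀ v i → lookup p i < lookup v i → StrictlyDecreasing v → g v ≈ 0#) →
      ∑ᴸ (box p) (λ v → Linked.linked? ℕ._>?_ v ⇒ g v) ≈ ∑ˢ d (bound p) g
    sum         []       g g≈0 = +-identityʳ _
    sum {suc d} (p ∷ ps) g g≈0 = begin
      ∑ᴸ (box (p ∷ ps)) (λ v → Linked.linked? ℕ._>?_ v ⇒ g v)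
        ≈⟨ ∑ᴸ-cartesianProductWith _∷_ (upTo (suc p)) (box ps) _ ⟩
      (∑ᴸ (upTo (suc p)) λ k → ∑ᴸ (box ps) λ v → Linked.linked? ℕ._>?_ (k ∷ v) ⇒ g (k ∷ v))
        ≈⟨ ∑ᴸ-cong (upTo (suc p)) (λ k → box-sum k ps (λ v → g (k ∷ v)) λ v i h s → g≈0 (k ∷ v) (suc i) h s) ⟩
      (∑ᴸ (upTo (suc p)) λ k → ∑ˢ d k λ v → g (k ∷ v))
        ≈⟨ ∑ᴸ-applyUpTo (λ k → k) (suc p) _ ⟩
      (Σ< (suc p) λ k → ∑ˢ d k λ v → g (k ∷ v))
        ≈⟨ ∑ˢ-step d (suc p) g ⟨
      ∑ˢ (suc d) (suc p) g ∎

-- Parameter windows and scalars inside Λ.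

applyUpTo-cong : ∀ {a} {A : Set a} {f g : ℕ → A} → f ≗ g → ∀ n → applyUpTo f n ≡ applyUpTo g n
applyUpTo-cong f≗g zero    = ≡.refl
applyUpTo-cong f≗g (suc n) = ≡.cong₂ _∷_ (f≗g 0) (applyUpTo-cong (f≗g ∘ suc) n)

-- The window f(1 - c - n), ..., f(p - c) is cut after f(-c). Arms use c = 0, where the cut
-- separates column factors from row factors; legs use p = 0.
applyUpTo-window : ∀ {a} {A : Set a} (f : ℤ → A) c n p →
  applyUpTo (λ m → f (+ suc m ℤ.- + (c ℕ.+ n))) (n ℕ.+ p) ≡
  applyDownFrom (λ i → f (ℤ.- + (c ℕ.+ i))) n ++ applyUpTo (λ m → f (+ suc m ℤ.- + c)) p
applyUpTo-window f c zero    p = applyUpTo-cong (λ m → ≡.cong (λ k → f (+ suc m ℤ.- + k)) (ℕ.+-identityʳ c)) p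
applyUpTo-window f c (suc n) p = ≡.cong₂ _∷_
  (≡.cong f (≡.trans (drop 0) (ℤ.+-identityˡ (ℤ.- + (c ℕ.+ n)))))
  (≡.trans (applyUpTo-cong (λ m → ≡.cong f (drop (suc m))) (n ℕ.+ p)) (applyUpTo-window f c n p))
  where
  drop : ∀ m → + suc m ℤ.- + (c ℕ.+ suc n) ≡ + m ℤ.- + (c ℕ.+ n)
  drop m = ≡.trans (≡.cong (λ k → + suc m ℤ.- + k) (ℕ.+-suc c n)) (suc-suc m (c ℕ.+ n))

module Constants {c ℓ} (K : CommutativeRing c ℓ) where

  open CommutativeRing K hiding (zero)
  open SymmetricFunctions K
  private
    module K  = Polynomials K
    module L  = Polynomials Λ
    module RK = RingOperations K
    module RΛ = RingOperations Λ
  open CommutativeRing Λ using () renaming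
    (refl to reflΛ; sym to symΛ; trans to transΛ; +-cong to +Λ-cong; *-cong to *Λ-cong; *-congˡ to *Λ-congˡ;
     -‿cong to -Λ-cong; *-identityˡ to *Λ-identityˡ)

  -- The expansion is carried out in the ring Λ itself, so the parameters have to be embedded there
  -- as constants.
  ι : Carrier → SymmetricFunction
  ι x = x • 1Λ

  convolution-scale : ∀ {F G : ℕ → ℕ → Carrier} {x} → (∀ i j → F i j ≈ x * G i j) →
                      ∀ n → convolution F n ≈ x * convolution G n
  convolution-scale eq zero    = eq 0 0
  convolution-scale eq (suc n) = trans (+-cong (eq 0 (suc n)) (convolution-scale (λ i → eq (suc i)) n)) (sym (distribˡ _ _ _))

  product-scale : ∀ x f g v → product (λ w → x * f w) g v ≈ x * product f g v
  product-scale x f g []      = *-assoc x _ _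
  product-scale x f g (m ∷ v) = convolution-scale (λ i j → product-scale x (λ w → f (i ∷ w)) (λ w → g (j ∷ w)) v) m

  •-ι : ∀ x f → x • f ≈Λ ι x *Λ f
  •-ι x f = pointwise λ v → sym (trans (product-scale x (coeff 1Λ) (coeff f) v)
    (*-congˡ (coeff-≈ (*Λ-identityˡ f) v)))

  ι-cong : ∀ {x y} → x ≈ y → ι x ≈Λ ι y
  ι-cong eq = pointwise λ v → *-congʳ eq

  ι-1 : ι 1# ≈Λ 1Λ
  ι-1 = pointwise λ v → *-identityˡ _

  ι-0 : ι 0# ≈Λ 0Λ
  ι-0 = pointwise λ v → zeroˡ _

  ι-+ : ∀ x y → ι (x + y) ≈Λ ι x +Λ ι y
  ι-+ x y = pointwise λ v → distribʳ _ _ _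

  ι-* : ∀ x y → ι (x * y) ≈Λ ι x *Λ ι y
  ι-* x y = transΛ (pointwise λ v → *-assoc _ _ _) (•-ι x (ι y))

  ι-neg : ∀ x → ι (- x) ≈Λ -Λ ι x
  ι-neg x = pointwise λ v → sym (-‿distribˡ-* x _)
    where open import Algebra.Properties.Ring ring using (-‿distribˡ-*)

  ι-∑ : ∀ {n} (f : Fin n → Carrier) → ι (K.∑ f) ≈Λ L.∑ (ι ∘ f)
  ι-∑ {zero}  f = transΛ (ι-cong (K.∑-zero f)) (transΛ ι-0 (symΛ (L.∑-zero _)))
  ι-∑ {suc n} f = transΛ (ι-cong (K.∑-suc f)) (transΛ (ι-+ _ _) (transΛ (+Λ-cong reflΛ (ι-∑ _)) (symΛ (L.∑-suc _))))

  ι--1^ : ∀ n → ι (RK.-1^ n) ≈Λ RΛ.-1^ n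
  ι--1^ zero    = ι-1
  ι--1^ (suc n) = transΛ (ι-* _ _) (*Λ-cong (transΛ (ι-neg 1#) (-Λ-cong ι-1)) (ι--1^ n))

  ι-Det : ∀ {n} (M : Fin n → Fin n → Carrier) → ι (K.Det M) ≈Λ L.Det (λ i j → ι (M i j))
  ι-Det {zero}  M = transΛ (ι-cong (K.Det-zero M)) (transΛ ι-1 (symΛ (L.Det-zero _)))
  ι-Det {suc n} M = transΛ (ι-cong (K.Det-suc M)) (transΛ (ι-∑ _) (transΛ
    (L.∑-cong λ j → transΛ (ι-* _ _) (*Λ-cong (ι--1^ (toℕ j)) (transΛ (ι-* _ _) (*Λ-congˡ (ι-Det _)))))
    (symΛ (L.Det-suc _))))

  ι-rootCoeff : ∀ xs i → ι (K.rootCoeff xs i) ≈Λ L.rootCoeff (List.map ι xs) i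
  ι-rootCoeff []       zero    = ι-1
  ι-rootCoeff []       (suc i) = ι-0
  ι-rootCoeff (x ∷ xs) zero    = transΛ (ι-* _ _) (*Λ-cong (ι-neg x) (ι-rootCoeff xs 0))
  ι-rootCoeff (x ∷ xs) (suc i) = transΛ (ι-+ _ _) (+Λ-cong (ι-rootCoeff xs i)
    (transΛ (ι-* _ _) (*Λ-cong (ι-neg x) (ι-rootCoeff xs (suc i)))))

-- Identification of the matrix entries with arm and leg rows.

module Entries {c ℓ} (K : CommutativeRing c ℓ) where

  open CommutativeRing K hiding (zero)
  open SymmetricFunctions K
  open SchurFunctions K
  open Constants K
  -- Reflexivity suffices because `1Λ` is `h 0` by definition.
  module FE = FrobeniusExpansion Λ h (CommutativeRing.refl Λ)
  private
    module K  = Polynomials K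
    module RK = RingOperations K
  open CommutativeRing Λ using () renaming
    (refl to reflΛ; sym to symΛ; trans to transΛ; reflexive to reflexiveΛ; *-congʳ to *Λ-congʳ; setoid to setoidΛ)
  open import Relation.Binary.Reasoning.Setoid setoidΛ

  -- Vieta's formulas applied to t(t - a_1)⋯(t - a_k). The extra factor t is the shift in `h ∘ suc`.
  hₐ-umbral : ∀ (a : ℤ → Carrier) k → hₐ a (+ suc k) ≈Λ FE.umbral (applyUpTo (λ m → ι (a (+ suc m))) k) (h ∘ suc)
  hₐ-umbral a k = begin
    hₐ a (+ suc k)
      ≈⟨ FE.∑≈sum {suc k} _ ⟨
    (FE.∑ {suc k} λ i → (RK.-1^ (k ∸ toℕ i) * RK.elementary (k ∸ toℕ i) xs) • h (suc (toℕ i)))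
      ≈⟨ FE.∑-cong {suc k} (λ i → transΛ (•-ι _ _) (*Λ-congʳ (transΛ
           (ι-cong (sym (K.rootCoeff-elementary xs (index i))))
           (ι-rootCoeff xs (toℕ i))))) ⟩
    FE.Σ< (suc k) (λ i → FE.rootCoeff (List.map ι xs) i *Λ h (suc i))
      ≈⟨ FE.umbral-rootCoeff (List.map ι xs) {suc k} (h ∘ suc) (ℕ.≤-reflexive (≡.cong suc
           (≡.trans (List.length-map ι xs) length-xs))) ⟨
    FE.umbral (List.map ι xs) (h ∘ suc)
      ≈⟨ reflexiveΛ (≡.cong (λ ys → FE.umbral ys (h ∘ suc)) (≡.trans
           (≡.cong (List.map ι) (List.map-upTo (λ m → a (+ suc m)) k))
           (List.map-applyUpTo (λ m → a (+ suc m)) ι k))) ⟩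
    FE.umbral (applyUpTo (λ m → ι (a (+ suc m))) k) (h ∘ suc) ∎
    where
    xs = List.map (λ m → a (+ suc m)) (upTo k)

    length-xs : length xs ≡ k
    length-xs = ≡.trans (List.length-map _ (upTo k)) (List.length-upTo k)

    index : ∀ (i : Fin (suc k)) → toℕ i ℕ.+ (k ∸ toℕ i) ≡ length xs
    index i = ≡.trans (ℕ.m+[n∸m]≡n (ℕ.≤-pred (Fin.toℕ<n i))) (≡.sym length-xs)

  hℤ-delay : ∀ k j → hℤ (ℤ.- + k ℤ.+ + j) ≈Λ FE.delay k h j
  hℤ-delay k j = transΛ (reflexiveΛ (≡.cong hℤ (≡.trans (ℤ.+-comm (ℤ.- + k) (+ j)) (ℤ.m-n≡m⊖n j k)))) (go k j)
    where
    go : ∀ k j → hℤ (j ℤ.⊖ k) ≈Λ FE.delay k h j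
    go zero    j       = reflΛ
    go (suc k) zero    = reflΛ
    go (suc k) (suc j) = transΛ (reflexiveΛ (≡.cong hℤ (ℤ.[1+m]⊖[1+n]≡m⊖n j k))) (go k j)

  module _ (a : ℤ → Carrier) where

    αΛ bΛ : ℕ → SymmetricFunction
    αΛ i = ι (a (+ suc i))
    bΛ i = ι (a (ℤ.- + i))

    hₐ-arm : ∀ p j → hₐ (τ (ℤ.- + j) a) (+ suc p ℤ.+ + j) ≈Λ FE.armRow αΛ bΛ p j
    hₐ-arm p j = transΛ (hₐ-umbral (τ (ℤ.- + j) a) (p ℕ.+ j))
      (reflexiveΛ (≡.cong (λ xs → FE.umbral xs (h ∘ suc)) (≡.trans
        (≡.cong (applyUpTo (λ m → ι (a (+ suc m ℤ.- + j)))) (ℕ.+-comm p j))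
        (≡.trans (applyUpTo-window (ι ∘ a) 0 j p)
          (≡.cong (applyDownFrom bΛ j ++_)
            (applyUpTo-cong (λ m → ≡.cong (ι ∘ a) (ℤ.+-identityʳ (+ suc m))) p))))))

    hₐ-leg : ∀ k j → hₐ (τ (ℤ.- + j) a) (ℤ.- + k ℤ.+ + j) ≈Λ FE.legRow bΛ k j
    hₐ-leg k j = transΛ (reflexiveΛ (≡.cong (hₐ (τ (ℤ.- + j) a))
      (≡.trans (ℤ.+-comm (ℤ.- + k) (+ j)) (ℤ.m-n≡m⊖n j k)))) (go (ℕ.compare j k))
      where
      legRow-far : ∀ b k m → FE.legRow b k (suc (k ℕ.+ m)) ≡ FE.umbral (applyDownFrom (λ i → b (suc k ℕ.+ i)) m) (h ∘ suc)
      legRow-far b zero    m = ≡.refl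
      legRow-far b (suc k) m = legRow-far (b ∘ suc) k m

      negative : ∀ j m → j ℤ.⊖ suc (j ℕ.+ m) ≡ -[1+ m ]
      negative zero    m = ≡.refl
      negative (suc j) m = ≡.trans (ℤ.[1+m]⊖[1+n]≡m⊖n j (suc (j ℕ.+ m))) (negative j m)

      positive′ : ∀ k m → suc (k ℕ.+ m) ℤ.⊖ k ≡ + suc m
      positive′ zero    m = ≡.refl
      positive′ (suc k) m = ≡.trans (ℤ.[1+m]⊖[1+n]≡m⊖n (suc (k ℕ.+ m)) k) (positive′ k m)

      go : ∀ {j k} → ℕ.Ordering j k → hₐ (τ (ℤ.- + j) a) (j ℤ.⊖ k) ≈Λ FE.legRow bΛ k j
      go (ℕ.less j m)    = transΛ (reflexiveΛ (≡.cong (hₐ (τ (ℤ.- + j) a)) (negative j m)))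
        (symΛ (FE.legRow-low bΛ (s≤s (ℕ.m≤m+n j m))))
      go (ℕ.equal j)     = transΛ (reflexiveΛ (≡.cong (hₐ (τ (ℤ.- + j) a)) (ℤ.n⊖n≡0 j)))
        (symΛ (FE.legRow-diagonal bΛ j))
      go (ℕ.greater k m) = begin
        hₐ (τ (ℤ.- + suc (k ℕ.+ m)) a) (suc (k ℕ.+ m) ℤ.⊖ k)
          ≈⟨ reflexiveΛ (≡.cong (hₐ (τ (ℤ.- + suc (k ℕ.+ m)) a)) (positive′ k m)) ⟩
        hₐ (τ (ℤ.- + suc (k ℕ.+ m)) a) (+ suc m)
          ≈⟨ hₐ-umbral (τ (ℤ.- + suc (k ℕ.+ m)) a) m ⟩
        FE.umbral (applyUpTo (λ n → ι (a (+ suc n ℤ.- + (suc k ℕ.+ m)))) m) (h ∘ suc)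
          ≈⟨ reflexiveΛ (≡.cong (λ xs → FE.umbral xs (h ∘ suc)) (≡.trans
               (≡.cong (applyUpTo (λ n → ι (a (+ suc n ℤ.- + (suc k ℕ.+ m))))) (≡.sym (ℕ.+-identityʳ m)))
               (≡.trans (applyUpTo-window (ι ∘ a) (suc k) m 0) (List.++-identityʳ _)))) ⟩
        FE.umbral (applyDownFrom (λ i → bΛ (suc k ℕ.+ i)) m) (h ∘ suc)
          ≈⟨ reflexiveΛ (legRow-far bΛ k m) ⟨
        FE.legRow bΛ k (suc (k ℕ.+ m)) ∎

-- The expansion for antisymmetric parameter sequences.

module Expansion {c ℓ} (K : CommutativeRing c ℓ) where

  open CommutativeRing K hiding (zero)
  open SymmetricFunctions K
  open SchurFunctions K
  open Constants K
  open Entries K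
  private
    module K  = Polynomials K
    module RK = RingOperations K
    module B  = BelowSums Λ
  open CommutativeRing Λ using () renaming
    (refl to reflΛ; sym to symΛ; trans to transΛ; reflexive to reflexiveΛ;
     *-cong to *Λ-cong; *-congˡ to *Λ-congˡ; *-congʳ to *Λ-congʳ; zeroˡ to zeroΛˡ; zeroʳ to zeroΛʳ; setoid to setoidΛ)
  open import Relation.Binary.Reasoning.Setoid setoidΛ

  -- Agrees with `s ⟨ p ∣ q ⟩` by definition but takes plain vectors, so it can stand under `∑ˢ`,
  -- which supplies no strictness proofs to its summand.
  schur : ∀ {d} → Vec ℕ d → Vec ℕ d → SymmetricFunction
  schur p q = Λ.det {length (hooks p q)} λ i j → hℤ (+ rowOf (hooks p q) (toℕ i) ℤ.- + toℕ i ℤ.+ + toℕ j)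

  -- The diagrams in the expansion have different numbers of rows; stability of the Jacobi-Trudi
  -- determinant brings them all to the common size n.
  schur-Schur : ∀ {d n} {p q : Vec ℕ d} → StrictlyDecreasing p → StrictlyDecreasing (n ∷ q) →
                schur p q ≈Λ FE.Schur n p q
  schur-Schur {n = n} {p} {q} sp sq = begin
    schur p q
      ≈⟨ schurDet-stable {n} ⟨ p , sp ∣ q , Linked.tail sq ⟩ (hooks-length≤ p sq) ⟨
    schurDet n ⟨ p , sp ∣ q , Linked.tail sq ⟩
      ≈⟨ FE.Det≈det {n} _ ⟨
    FE.Det {n} (λ i j → hℤ (+ rowOf (hooks p q) (toℕ i) ℤ.- + toℕ i ℤ.+ + toℕ j))
      ≈⟨ FE.Det-cong {n} (λ i j → transΛ
           (reflexiveΛ (≡.cong (λ x → hℤ (x ℤ.+ + toℕ j)) (hooks-row p sq (toℕ i))))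
           (hookRow-lift Represents (λ r j → reflexiveΛ (≡.cong (λ l → h (suc l)) (ℕ.+-comm (lookup p r) j)))
             q (toℕ i) (λ k _ j → hℤ-delay k j) (toℕ j))) ⟩
    FE.Schur n p q ∎
    where
    Represents : ℤ → (ℕ → SymmetricFunction) → Set ℓ
    Represents x v = ∀ j → hℤ (x ℤ.+ + j) ≈Λ v j

  module _ (a : ℤ → Carrier) where

    sₐ-Schurₐ : ∀ {d n} {p q : Vec ℕ d} (sp : StrictlyDecreasing p) (sq : StrictlyDecreasing (n ∷ q)) →
                sₐ ⟨ p , sp ∣ q , Linked.tail sq ⟩ a ≈Λ FE.Schurₐ (αΛ a) (bΛ a) n p q
    sₐ-Schurₐ {n = n} {p} {q} sp sq = begin
      sₐ ⟨ p , sp ∣ q , Linked.tail sq ⟩ a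
        ≈⟨ schurDetₐ-stable {n} ⟨ p , sp ∣ q , Linked.tail sq ⟩ a (hooks-length≤ p sq) ⟨
      schurDetₐ n ⟨ p , sp ∣ q , Linked.tail sq ⟩ a
        ≈⟨ FE.Det≈det {n} _ ⟨
      FE.Det {n} (λ i j → hₐ (τ (ℤ.- + toℕ j) a) (+ rowOf (hooks p q) (toℕ i) ℤ.- + toℕ i ℤ.+ + toℕ j))
        ≈⟨ FE.Det-cong {n} (λ i j → transΛ
             (reflexiveΛ (≡.cong (λ x → hₐ (τ (ℤ.- + toℕ j) a) (x ℤ.+ + toℕ j)) (hooks-row p sq (toℕ i))))
             (hookRow-lift Represents (λ r → hₐ-arm a (lookup p r)) q (toℕ i) (λ k _ → hₐ-leg a k) (toℕ j))) ⟩
      FE.Schurₐ (αΛ a) (bΛ a) n p q ∎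
      where
      Represents : ℤ → (ℕ → SymmetricFunction) → Set ℓ
      Represents x v = ∀ j → hₐ (τ (ℤ.- + j) a) (x ℤ.+ + j) ≈Λ v j

    sₐ-expansion : (C : ℕ → ℕ → Carrier) →
      (∀ p p′ → C p p′ ≈ K.rootCoeff (applyUpTo (λ i → a (+ suc i)) p) p′) →
      (∀ i → a (ℤ.- + i) ≈ - a (+ suc i)) →
      ∀ {d} (p q : Vec ℕ d) (sp : StrictlyDecreasing p) (sq : StrictlyDecreasing q) →
      sₐ ⟨ p , sp ∣ q , sq ⟩ a ≈Λ Λ.∑ (below p) λ p′ → Λ.∑ (below q) λ q′ →
        (RK.det (λ i j → C (lookup p i) (lookup (proj₁ p′) j)) *
         RK.det (λ i j → C (lookup q i) (lookup (proj₁ q′) j))) • s ⟨ p′ ∣ q′ ⟩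
    sₐ-expansion C C≈ a-odd {d} p q sp sq = begin
      sₐ ⟨ p , sp ∣ q , sq ⟩ a
        ≈⟨ sₐ-Schurₐ sp (bound-strict sq) ⟩
      FE.Schurₐ (αΛ a) (bΛ a) (bound q) p q
        ≈⟨ FE.Schurₐ-expansion (αΛ a) (bΛ a) (λ i → transΛ (ι-cong (a-odd i)) (ι-neg _)) (bound-strict sp) (bound-strict sq) ⟩
      (FE.∑ˢ d (bound p) λ p′ → FE.∑ˢ d (bound q) λ q′ → (D p p′ *Λ D q q′) *Λ FE.Schur (bound q) p′ q′)
        ≈⟨ FE.∑ˢ-cong d (bound p) (λ p′ sp′ → FE.∑ˢ-cong d (bound q) λ q′ sq′ →
             *Λ-congˡ (symΛ (schur-Schur (Linked.tail sp′) sq′))) ⟩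
      FE.∑ˢ d (bound p) (λ p′ → FE.∑ˢ d (bound q) (term p′))
        -- Outside the boxes a coefficient determinant vanishes, so the sums shrink to `below`, the
        -- inner one first.
        ≈⟨ FE.∑ˢ-cong d (bound p) (λ p′ sp′ → symΛ (B.below-sum q (term p′) λ q′ i q<q′ sq′ → transΛ
             (*Λ-congʳ (transΛ (*Λ-congˡ (FE.coefficientDet-vanishes (αΛ a) sq sq′ i q<q′)) (zeroΛʳ _))) (zeroΛˡ _))) ⟩
      FE.∑ˢ d (bound p) (λ p′ → Λ.∑ (below q) (term p′ ∘ proj₁))
        ≈⟨ B.below-sum p (λ p′ → Λ.∑ (below q) (term p′ ∘ proj₁)) (λ p′ i p<p′ sp′ → transΛ
             (B.∑ᴸ-cong (below q) λ q′ → transΛ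
               (*Λ-congʳ (transΛ (*Λ-congʳ (FE.coefficientDet-vanishes (αΛ a) sp sp′ i p<p′)) (zeroΛˡ _))) (zeroΛˡ _))
             (B.∑ᴸ-0 (below q))) ⟨
      Λ.∑ (below p) (λ p′ → Λ.∑ (below q) λ q′ → term (proj₁ p′) (proj₁ q′))
        ≈⟨ B.∑ᴸ-cong (below p) (λ p′ → B.∑ᴸ-cong (below q) λ q′ → transΛ
             (*Λ-congʳ (transΛ (*Λ-cong (D-det p (proj₁ p′)) (D-det q (proj₁ q′))) (symΛ (ι-* _ _))))
             (symΛ (•-ι _ _))) ⟩
      (Λ.∑ (below p) λ p′ → Λ.∑ (below q) λ q′ →
        (RK.det (λ i j → C (lookup p i) (lookup (proj₁ p′) j)) *
         RK.det (λ i j → C (lookup q i) (lookup (proj₁ q′) j))) • s ⟨ p′ ∣ q′ ⟩) ∎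
      where
      D : Vec ℕ d → Vec ℕ d → SymmetricFunction
      D = FE.coefficientDet (αΛ a)

      term : Vec ℕ d → Vec ℕ d → SymmetricFunction
      term p′ q′ = (D p p′ *Λ D q q′) *Λ schur p′ q′

      D-det : ∀ p p′ → D p p′ ≈Λ ι (RK.det λ i j → C (lookup p i) (lookup p′ j))
      D-det p p′ = symΛ (transΛ (ι-cong (sym (K.Det≈det _))) (transΛ (ι-Det _) (FE.Det-cong λ i j → transΛ
        (ι-cong (C≈ (lookup p i) (lookup p′ j)))
        (transΛ (ι-rootCoeff (applyUpTo (λ i → a (+ suc i)) (lookup p i)) (lookup p′ j))
          (reflexiveΛ (≡.cong (λ xs → FE.rootCoeff xs (lookup p′ j)) (List.map-applyUpTo _ ι (lookup p i))))))))

-- The sequence of half-integers.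

module HalfIntegers {c ℓ} (K : CommutativeRing c ℓ) (½ : CommutativeRing.Carrier K)
  (½+½ : CommutativeRing._≈_ K (CommutativeRing._+_ K ½ ½) (CommutativeRing.1# K)) where

  open CommutativeRing K hiding (zero)
  open RingOperations K using (-1^_; elementary)
  open FrobeniusSchur K ½
  open Polynomials K
  open import Algebra.Definitions.RawMonoid +-rawMonoid using () renaming (_×_ to _·_)
  open import Algebra.Properties.Ring ring using (-‿+-comm)
  open import Relation.Binary.Reasoning.Setoid setoid

  odd : ℕ → Carrier
  odd i = suc (2 ℕ.* i) · ½

  odd+½ : ∀ i → suc i · 1# ≈ odd i + ½
  odd+½ zero    = begin
    1# + 0#        ≈⟨ +-identityʳ 1# ⟩
    1#             ≈⟨ ½+½ ⟨
    ½ + ½          ≈⟨ +-congʳ (+-identityʳ ½) ⟨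
    (½ + 0#) + ½   ∎
  odd+½ (suc i) = begin
    1# + suc i · 1#            ≈⟨ +-cong (sym ½+½) (odd+½ i) ⟩
    (½ + ½) + (odd i + ½)      ≈⟨ +-assoc _ _ _ ⟨
    ((½ + ½) + odd i) + ½      ≈⟨ +-congʳ (+-assoc _ _ _) ⟩
    (½ + (½ + odd i)) + ½      ≈⟨ +-congʳ (reflexive (≡.cong (λ n → suc n · ½) (≡.sym (ℕ.*-suc 2 i)))) ⟩
    odd (suc i) + ½            ∎

  +-cancel : ∀ x y → (x + y) - y ≈ x
  +-cancel x y = trans (+-assoc _ _ _) (trans (+-congˡ (-‿inverseʳ y)) (+-identityʳ x))

  a-positive : ∀ i → a (+ suc i) ≈ odd i
  a-positive i = trans (+-congʳ (odd+½ i)) (+-cancel (odd i) ½)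

  a-odd : ∀ i → a (ℤ.- + i) ≈ - a (+ suc i)
  a-odd zero    = begin
    0# - ½              ≈⟨ +-identityˡ _ ⟩
    - ½                 ≈⟨ -‿cong (trans (a-positive 0) (+-identityʳ ½)) ⟨
    - a (+ 1)           ∎
  a-odd (suc i) = begin
    - (suc i · 1#) - ½           ≈⟨ -‿+-comm _ _ ⟩
    - (suc i · 1# + ½)           ≈⟨ -‿cong (sym (begin
      (1# + suc i · 1#) - ½        ≈⟨ +-congʳ (trans (+-comm _ _) (+-congˡ (sym ½+½))) ⟩
      (suc i · 1# + (½ + ½)) - ½   ≈⟨ +-congʳ (+-assoc _ _ _) ⟨
      ((suc i · 1# + ½) + ½) - ½   ≈⟨ +-cancel _ ½ ⟩
      suc i · 1# + ½               ∎)) ⟩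
    - a (+ suc (suc i))          ∎

  rootCoeff-cong : ∀ {f g : ℕ → Carrier} → (∀ i → f i ≈ g i) → ∀ n i →
                   rootCoeff (applyUpTo f n) i ≈ rootCoeff (applyUpTo g n) i
  rootCoeff-cong f≈g zero    i       = refl
  rootCoeff-cong f≈g (suc n) zero    = *-cong (-‿cong (f≈g 0)) (rootCoeff-cong (f≈g ∘ suc) n 0)
  rootCoeff-cong f≈g (suc n) (suc i) = +-cong (rootCoeff-cong (f≈g ∘ suc) n i)
    (*-cong (-‿cong (f≈g 0)) (rootCoeff-cong (f≈g ∘ suc) n (suc i)))

  c-rootCoeff : ∀ p p′ → c[ p , p′ ] ≈ rootCoeff (applyUpTo (λ i → a (+ suc i)) p) p′
  c-rootCoeff p p′ = trans c-odd (sym (rootCoeff-cong a-positive p p′))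
    where
    c-odd : c[ p , p′ ] ≈ rootCoeff (applyUpTo odd p) p′
    c-odd with p′ ℕ.≤? p
    ... | no  p′≰p rewrite dec-false (p′ ℕ.≤? p) p′≰p = sym (rootCoeff-beyond (applyUpTo odd p)
      (≡.subst (_< p′) (≡.sym (List.length-applyUpTo odd p)) (ℕ.≰⇒> p′≰p)))
    ... | yes p′≤p rewrite dec-true (p′ ℕ.≤? p) p′≤p = trans
      (reflexive (≡.cong (λ xs → -1^ (p ∸ p′) * elementary (p ∸ p′) xs) (List.map-upTo odd p)))
      (sym (rootCoeff-elementary (applyUpTo odd p)
        (≡.trans (ℕ.m+[n∸m]≡n p′≤p) (≡.sym (List.length-applyUpTo odd p)))))

theorem9 :
    ∀ {c ℓ} (K : CommutativeRing c ℓ) →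
    let open CommutativeRing K
        open RingOperations K using (det)
        open SymmetricFunctions K
        open SchurFunctions K
    in
    (½ : Carrier) → ½ + ½ ≈ 1# →
    let open FrobeniusSchur K ½ in
    (μ : YoungDiagram) →
    let p = arms μ
        q = legs μ
    in
    FS μ ≈Λ Λ.∑ (below p) λ p′ → Λ.∑ (below q) λ q′ →
      (det (λ i j → c[ lookup p i , lookup (proj₁ p′) j ]) *
       det (λ i j → c[ lookup q i , lookup (proj₁ q′) j ])) • s ⟨ p′ ∣ q′ ⟩
theorem9 K ½ ½+½ (youngDiagram rs dec pos) with hooks-surjective (length rs) rs ℕ.≤-refl dec pos
... | d , (p , sp) , (q , sq) , ≡.refl =
  -- The given proofs `dec` and `pos` need not be those inside `⟨ p ∣ q ⟩`, but both sides depend on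
  -- the list of rows only.
  transport (⟨∣⟩-diagonal (p , sp) (q , sq))
    (λ i → rowOf (hooks p q) i ∸ suc i) (λ j → columnOf (hooks p q) j ∸ suc j)
    (⟨∣⟩-row (p , sp) (q , sq)) (⟨∣⟩-column (p , sp) (q , sq))
  where
  open CommutativeRing K using (_*_)
  open RingOperations K using (det)
  open SymmetricFunctions K
  open SchurFunctions K
  open FrobeniusSchur K ½
  module H = HalfIntegers K ½ ½+½

  ExpandsWith : ∀ {d} → Vec ℕ d → Vec ℕ d → Set _
  ExpandsWith p′ q′ = FS ⟨ p , sp ∣ q , sq ⟩ ≈Λ Λ.∑ (below p′) λ p″ → Λ.∑ (below q′) λ q″ →
    (det (λ i j → c[ lookup p′ i , lookup (proj₁ p″) j ]) *
     det (λ i j → c[ lookup q′ i , lookup (proj₁ q″) j ])) • s ⟨ p″ ∣ q″ ⟩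

  -- The vectors `arms` and `legs` have length `diagonal μ`, which equals d only propositionally.
  -- Generalising the length and the tabulated functions allows the equation to be matched with
  -- `refl`.
  transport : ∀ {d′} → d′ ≡ d → ∀ (f g : ℕ → ℕ) →
    (∀ i → f (toℕ i) ≡ lookup p i) → (∀ i → g (toℕ i) ≡ lookup q i) →
    ExpandsWith {d′} (tabulate (f ∘ toℕ)) (tabulate (g ∘ toℕ))
  transport ≡.refl f g f≡p g≡q = ≡.subst₂ ExpandsWith
    (≡.sym (≡.trans (Vec.tabulate-cong f≡p) (Vec.tabulate∘lookup p)))
    (≡.sym (≡.trans (Vec.tabulate-cong g≡q) (Vec.tabulate∘lookup q)))
    (Expansion.sₐ-expansion K a c[_,_] H.c-rootCoeff H.a-odd p q sp sq)
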